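{- Let $n,k,s,q$ be positive integers. Let $\mathcal A\subset {[n]\choose k}$ and let $\mathcal{F}\subset \mathcal A$. Suppose that $\mathcal A$ is $r$-spread for some $r>\max\{4(s-1)q,\; 2^9 s\log_2(2k)\}$ and that $\nu(\mathcal{F})<s$. Then there exist a family $\mathcal S\subset {[n]\choose \leq q}$ with $\nu(\mathcal S)<s$ and a family $\mathcal{F}'\subset \mathcal{F}$ such that: (i) $\mathcal{F}\setminus \mathcal{F}'\subset \mathcal A[\mathcal S]$; (ii) for every $B\in \mathcal S$ there is a family $\mathcal{F}_B\subset \mathcal{F}$ such that $\mathcal{F}_B(B)$ is $\frac r2$-spread; (iii) $|\mathcal{F}'|\leq 2^{ -q-1}|\mathcal A|$.
   Context: ${[n]\choose k}$ (resp. ${[n]\choose\le q}$) is the set of $k$-element (resp. at most $q$-element) subsets of $[n]$. $\nu(\mathcal G)$ is the maximum number of pairwise disjoint sets in $\mathcal G$. $\mathcal{F}(X):=\{F\setminus X: X\subset F\in\mathcal{F}\}$, $\mathcal A[X]:=\{F\in\mathcal A: X\subset F\}$, and $\mathcal A[\mathcal S]:=\bigcup_{B\in\mathcal S}\mathcal A[B]$. A family $\mathcal G$ is $r$-spread if $|\mathcal G(X)|\le r^{ -|X|}|\mathcal G|$ for every $X\subset[n]$. -}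

module Defs where

open import Data.Bool using (Bool; T; T?; _∧_; not)
open import Data.Bool.Properties using () renaming (_≟_ to _≟ᵇ_)
open import Data.Fin.Subset using (Subset; inside; outside; _⊆_; _∩_; _─_; Empty; ∣_∣)
open import Data.Fin.Subset.Properties using (_⊆?_; nonempty?; anySubset?)
open import Data.Integer using (ℤ; +_; -[1+_])
open import Data.List using (List; []; _∷_; _++_; map; filter; filterᵇ; length)
open import Data.List.Extrema.Nat using (max)
open import Data.List.Relation.Unary.AllPairs using (allPairs?)
open import Data.Nat as ℕ using (ℕ; zero; suc)
open import Data.Nat.Properties using (m^n≢0)
open import Data.Product using (Σ; ∃; _×_; proj₁)
open import Data.Rational as ℚ using (ℚ; 0ℚ; 1ℚ; ½; ↥_; ↧ₙ_)
open import Data.Sum using (_⊎_)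
open import Data.Vec using ([]; _∷_)
open import Data.Vec.Properties using (≡-dec)
open import Function using (_⇔_)
open import Relation.Binary.Definitions using (DecidableEquality; Decidable)
open import Relation.Binary.PropositionalEquality using (_≡_)
open import Relation.Nullary using (¬_; does; ¬?; _×-dec_)

------------------------------------------------------------------------
-- Real numbers

-- The cut of a real x consists of the rationals p < x and the rationals
-- p > x.  Operations are given on bare pairs of predicates; ℝ adds the
-- axioms of a two-sided (constructive) Dedekind cut.

record Cut : Set₁ where
  field
    lower : ℚ → Set
    upper : ℚ → Set

open Cut public

record IsDedekind (x : Cut) : Set where
  field
    lower-inhabited : ∃ (lower x)
    upper-inhabited : ∃ (upper x)
    lower-rounded   : ∀ p → lower x p ⇔ (∃ λ q → p ℚ.< q × lower x q)
    upper-rounded   : ∀ p → upper x p ⇔ (∃ λ q → q ℚ.< p × upper x q)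
    disjoint        : ∀ p → ¬ (lower x p × upper x p)
    located         : ∀ {p q} → p ℚ.< q → lower x p ⊎ upper x q

ℝ : Set₁
ℝ = Σ Cut IsDedekind

cut : ℝ → Cut
cut = proj₁

infix 4 _<ᶜ_ _≤ᶜ_
infixl 6 _⊔ᶜ_
infixl 7 _*ᶜ_
infixr 8 _^ᶜ_
infix 9 _⁻¹

_<ᶜ_ : Cut → Cut → Set
x <ᶜ y = ∃ λ p → upper x p × lower y p

_≤ᶜ_ : Cut → Cut → Set
x ≤ᶜ y = ∀ p → upper y p → upper x p

fromℚ : ℚ → Cut
fromℚ c = record { lower = ℚ._< c ; upper = c ℚ.<_ }

fromℕ : ℕ → Cut
fromℕ m = fromℚ (+ m ℚ./ 1)

_⊔ᶜ_ : Cut → Cut → Cut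
x ⊔ᶜ y = record
  { lower = λ p → lower x p ⊎ lower y p
  ; upper = λ p → upper x p × upper y p
  }

-- Correct for x , y ≥ 0 (the elements of the upper cuts are then positive).
_*ᶜ_ : Cut → Cut → Cut
x *ᶜ y = record
  { lower = λ p → p ℚ.< 0ℚ ⊎
      (∃ λ a → ∃ λ b → 0ℚ ℚ.≤ a × 0ℚ ℚ.≤ b × lower x a × lower y b × p ℚ.< a ℚ.* b)
  ; upper = λ p → ∃ λ a → ∃ λ b → upper x a × upper y b × a ℚ.* b ℚ.< p
  }

_^ᶜ_ : Cut → ℕ → Cut
x ^ᶜ zero  = fromℕ 1
x ^ᶜ suc m = x *ᶜ (x ^ᶜ m)

-- Correct for x > 0.
_⁻¹ : Cut → Cut
x ⁻¹ = record
  { lower = λ p → ∃ λ a → upper x a × p ℚ.* a ℚ.< 1ℚ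
  ; upper = λ p → ∃ λ a → 0ℚ ℚ.< a × lower x a × 1ℚ ℚ.< p ℚ.* a
  }

half : Cut → Cut
half x = x *ᶜ fromℚ ½

2^ : ℤ → ℚ
2^ (+ a)    = + (2 ℕ.^ a) ℚ./ 1
2^ -[1+ a ] = ℚ._/_ (+ 1) (2 ℕ.^ suc a) {{m^n≢0 2 (suc a)}}

-- For m ≥ 1: a / b < log₂ m iff 2 ^ a < m ^ b.
log₂ : ℕ → Cut
log₂ m = record
  { lower = λ p → 2^ (↥ p) ℚ.< + (m ℕ.^ ↧ₙ p) ℚ./ 1
  ; upper = λ p → + (m ℕ.^ ↧ₙ p) ℚ./ 1 ℚ.< 2^ (↥ p)
  }

------------------------------------------------------------------------
-- Families of subsets of [n], represented by their indicator functions

Family : ℕ → Set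
Family n = Subset n → Bool

private
  variable
    n : ℕ

infix 4 _∈ᶠ_ _⊆ᶠ_
infixl 6 _∖ᶠ_

_∈ᶠ_ : Subset n → Family n → Set
X ∈ᶠ 𝓖 = T (𝓖 X)

_⊆ᶠ_ : Family n → Family n → Set
𝓖 ⊆ᶠ 𝓗 = ∀ X → X ∈ᶠ 𝓖 → X ∈ᶠ 𝓗

_∖ᶠ_ : Family n → Family n → Family n
(𝓖 ∖ᶠ 𝓗) X = 𝓖 X ∧ not (𝓗 X)

Uniform : ℕ → Family n → Set
Uniform k 𝓖 = ∀ X → X ∈ᶠ 𝓖 → ∣ X ∣ ≡ k

AtMost : ℕ → Family n → Set
AtMost q 𝓖 = ∀ X → X ∈ᶠ 𝓖 → ∣ X ∣ ℕ.≤ q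

allSubsets : ∀ n → List (Subset n)
allSubsets zero    = [] ∷ []
allSubsets (suc n) = map (outside ∷_) (allSubsets n) ++ map (inside ∷_) (allSubsets n)

members : Family n → List (Subset n)
members 𝓖 = filterᵇ 𝓖 (allSubsets _)

card : Family n → ℕ
card 𝓖 = length (members 𝓖)

Disjoint : Subset n → Subset n → Set
Disjoint X Y = Empty (X ∩ Y)

disjoint? : Decidable (Disjoint {n})
disjoint? X Y = ¬? (nonempty? (X ∩ Y))

sublists : ∀ {a} {A : Set a} → List A → List (List A)
sublists []       = [] ∷ []
sublists (x ∷ xs) = sublists xs ++ map (x ∷_) (sublists xs)

ν : Family n → ℕ
ν 𝓖 = max 0 (map length (filter (allPairs? disjoint?) (sublists (members 𝓖))))

_≟ˢ_ : DecidableEquality (Subset n)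
_≟ˢ_ = ≡-dec _≟ᵇ_

-- 𝓕 ⟨ X ⟩ = { F ∖ X : X ⊆ F ∈ 𝓕 }
_⟨_⟩ : Family n → Subset n → Family n
(𝓕 ⟨ X ⟩) Y = does (anySubset? λ F → T? (𝓕 F) ×-dec (X ⊆? F) ×-dec (Y ≟ˢ (F ─ X)))

-- 𝓐 [ X ] = { F ∈ 𝓐 : X ⊆ F }
_[_] : Family n → Subset n → Family n
(𝓐 [ X ]) F = 𝓐 F ∧ does (X ⊆? F)

-- 𝓐 [[ 𝓢 ]] = ⋃_{B ∈ 𝓢} 𝓐 [ B ]
_[[_]] : Family n → Family n → Family n
(𝓐 [[ 𝓢 ]]) F = does (anySubset? λ B → T? (𝓢 B) ×-dec T? ((𝓐 [ B ]) F))

-- The empty family is r-spread for every r.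
IsSpread : Cut → Family n → Set
IsSpread r 𝓖 = ∀ X → fromℕ (card (𝓖 ⟨ X ⟩)) ≤ᶜ ((r ⁻¹) ^ᶜ ∣ X ∣) *ᶜ fromℕ (card 𝓖)

-- Since the empty family is spread, asking for 𝓕_B ⊆ 𝓕 with 𝓕_B(B) spread has content
-- only if 𝓕_B(B) ≠ ∅: otherwise 𝓢 = {∅}, 𝓕′ = 𝓕_∅ = ∅ would do whenever s ≥ 2.
NonemptyFamily : Family n → Set
NonemptyFamily 𝓖 = ∃ λ X → X ∈ᶠ 𝓖

{-# OPTIONS --safe #-}

-- Let r* ≥ r be the largest real for which 𝓐 is r*-spread, that is, the minimum of
-- (|𝓐| / |𝓐(X)|)^(1/|X|).  Since r*^d is an explicit quotient a / b of natural numbers, powers of r*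
-- can be compared with rationals, which is not possible for an arbitrary Dedekind real r; and the
-- conclusion for r* implies the one for r.
--
-- Repeatedly choose B maximising |𝓖(B)| (r*/2)^|B|, where 𝓖 is what is left of 𝓕.  Maximality makes
-- 𝓖(B) an r*/2-spread family.  If |B| ≤ q, put B into 𝓢 and remove 𝓖[B]; otherwise stop with 𝓕′ = 𝓖,
-- and |𝓖| ≤ (r*/2)^|B| |𝓐(B)| ≤ 2^-|B| |𝓐|.
--
-- If 𝓢 had s pairwise disjoint members B_i, then at least half of each 𝓕_{B_i}(B_i) would avoid the
-- other B_j.  Color [n] at random with 2s colors.  A given color class contains no member of a given
-- one of these families with probability at most 1/16: each color is split into L = ⌊log₂ 2k⌋ shades,
-- and every shade at least halves the size of the minimal fragments (a set S is replaced by the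
-- smallest S′ ∖ W with S′ ⊆ W ∪ S in the current family, W being the shade class).  These failures are
-- negatively correlated over the colors, so with probability at least 1 − 4^-s a family fails for at
-- most s of the 2s colors.  Hence some coloring is good for all s families at once, distinct colors
-- can be chosen greedily, and 𝓕 has s pairwise disjoint members.

module Submission where

open import Defs
open import Data.Bool using (Bool; true; false; T; T?; _∧_; _∨_; not)
open import Data.Bool.Properties using (T-∨)
open import Data.Empty using (⊥-elim) renaming (⊥ to Void)
open import Data.Fin using (Fin; zero; suc)
import Data.Fin.Properties as Fin
open import Data.Fin.Subset using (Subset; inside; outside; _⊆_; _∪_; _∩_; _─_; ⊥; ∣_∣; ⋃; Nonempty; ⁅_⁆) renaming (_∈_ to _∈ˢ_; _∉_ to _∉ˢ_)
open import Data.Fin.Subset.Properties using (_⊆?_; _∈?_; nonempty?; anySubset?; ⊆-antisym; ⊥⊆; ∉⊥; out⊆; s⊆s; drop-∷-⊆; p⊂q⇒∣p∣<∣q∣; p⊆q⇒∣p∣≤∣q∣; ∣p∣≤n; ∣⊥∣≡0; ∣⁅x⁆∣≡1; x∈⁅y⁆⇒x≡y; ∩-comm; x∈p∩q⁺; x∈p∩q⁻; x∈p∪q⁺; x∈p∪q⁻; p─q⊆p; p─⊥≡p; p─q─r≡p─q∪r; ∣p─q∣≤∣p∣; x∈p∧x∉q⇒x∈p─q)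
open import Data.Integer as ℤ using (-[1+_])
import Data.Integer.Properties as ℤ
open import Data.List using (List; []; _∷_; _++_; map; filter; filterᵇ; length; concatMap; cartesianProduct; take; allFin; upTo)
open import Data.List.Extrema.Nat using (argmin; argmin-all; f[argmin]≤v⁺; argmax; argmax-sel; f[xs]≤f[argmax]; xs≤max)
open import Data.List.Membership.Propositional using (_∈_; _∉_; lose; find)
open import Data.List.Membership.Propositional.Properties using (∈-map⁺; ∈-map⁻; ∈-filter⁺; ∈-filter⁻; ∈-++⁺ˡ; ∈-++⁺ʳ; ∈-++⁻; ∈-∃++; ∈-upTo⁺; ∈-cartesianProduct⁺)
import Data.List.Membership.DecPropositional as DecMembership
open import Data.List.Properties using (length-++; length-map; length-take; length-upTo; length-tabulate)
open import Data.List.Relation.Unary.All as All using (All; []; _∷_)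
import Data.List.Relation.Unary.All.Properties as All
open import Data.List.Relation.Unary.AllPairs using (AllPairs; []; _∷_; allPairs?)
import Data.List.Relation.Unary.AllPairs.Properties as AllPairs
open import Data.List.Relation.Unary.Any as Any using (Any; here; there; any?)
open import Data.List.Relation.Unary.Unique.Propositional using (Unique)
import Data.List.Relation.Unary.Unique.Propositional.Properties as Unique
open import Data.Nat using (ℕ; zero; suc; _+_; _*_; _∸_; _^_; _≤_; _<_; _≤?_; _<?_; z≤n; s≤s; NonZero; >-nonZero)
import Data.Nat.Coprimality as Coprimality
open import Data.Nat.Properties hiding (_≟_)
open import Data.Nat.Tactic.RingSolver using (solve-∀)
open import Data.Product using (∃; ∃₂; _×_; _,_; proj₁; proj₂)
open import Data.Product.Properties using (≡-dec)
open import Data.Rational as ℚ using (ℚ; 0ℚ; 1ℚ; ½; mkℚ; *≤*; *<*; toℚᵘ; 1/_)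
import Data.Rational.Properties as ℚ
open import Data.Rational.Unnormalised as ℚᵘ using (mkℚᵘ; *≡*)
import Data.Rational.Unnormalised.Properties as ℚᵘ
open import Data.Sum using (_⊎_; inj₁; inj₂)
open import Data.Vec as Vec using (Vec; []; _∷_; lookup)
open import Data.Vec.Properties using (lookup-map; lookup⇒[]=; []=⇒lookup; ∷-injectiveʳ)
open import Function using (_∘_; id; _on_; Equivalence)
open import Relation.Binary.Definitions using (DecidableEquality)
open import Relation.Binary.PropositionalEquality hiding ([_])
open import Relation.Nullary using (¬_; ¬?; Dec; yes; no; does; contradiction; _×-dec_)
open import Relation.Nullary.Decidable using (dec-true)

-- Why `2 * s` colors: assigning `s` families to `s` classes in advance and taking a union bound
-- would need a failure probability below 1/s, while the argument below yields a constant. If a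
-- family may miss half of twice as many classes, a constant suffices. The constants: in `2 ^ 9 * s`
-- times `log₂ (2 * k)`, one factor 2 pays for passing from r* to r*/2, one for the `2 * s` colors,
-- and 128 = 4 · 32 remains. A round that cuts the size bound from 2h to h gains 128^h from
-- spreadness; 4^h pays for guessing a lost fragment inside a set with fewer than 2h elements, and
-- 32^h keeps the total loss below 1/32 of the size of the link. Since only half of the link is sure
-- to avoid the other B_j, 1/32 becomes 1/16. In `4 * (s ∸ 1) * q`, one factor 2 again pays for
-- r*/2, the other for keeping that half. Probabilities are counts of colorings, and the
-- combinatorial inequalities are between natural numbers, with roots, denominators and subtractions
-- cleared. The real `r` enters only through rationals below it, one of which separates it from the
-- threshold.

private
  variable
    A B : Set
    n : ℕ

-- Finite sums

∑ : List A → (A → ℕ) → ℕ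
∑ []       f = 0
∑ (x ∷ xs) f = f x + ∑ xs f

∑-mono-∈ : ∀ (xs : List A) {f g : A → ℕ} → (∀ {x} → x ∈ xs → f x ≤ g x) → ∑ xs f ≤ ∑ xs g
∑-mono-∈ []       le = z≤n
∑-mono-∈ (x ∷ xs) le = +-mono-≤ (le (here refl)) (∑-mono-∈ xs (le ∘ there))

∑-mono : ∀ (xs : List A) {f g : A → ℕ} → (∀ x → f x ≤ g x) → ∑ xs f ≤ ∑ xs g
∑-mono xs le = ∑-mono-∈ xs (λ {x} _ → le x)

∑-cong : ∀ (xs : List A) {f g : A → ℕ} → (∀ x → f x ≡ g x) → ∑ xs f ≡ ∑ xs g
∑-cong []       eq = refl
∑-cong (x ∷ xs) eq = cong₂ _+_ (eq x) (∑-cong xs eq)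

∑-+ : ∀ (xs : List A) (f g : A → ℕ) → ∑ xs (λ x → f x + g x) ≡ ∑ xs f + ∑ xs g
∑-+ []       f g = refl
∑-+ (x ∷ xs) f g rewrite ∑-+ xs f g = lemma (f x) (g x) (∑ xs f) (∑ xs g)
  where
  lemma : ∀ a b c d → a + b + (c + d) ≡ a + c + (b + d)
  lemma = solve-∀

∑-*ˡ : ∀ (xs : List A) (c : ℕ) (f : A → ℕ) → ∑ xs (λ x → c * f x) ≡ c * ∑ xs f
∑-*ˡ []       c f = sym (*-zeroʳ c)
∑-*ˡ (x ∷ xs) c f = trans (cong (c * f x +_) (∑-*ˡ xs c f)) (sym (*-distribˡ-+ c (f x) (∑ xs f)))

∑-*ʳ : ∀ (xs : List A) (c : ℕ) (f : A → ℕ) → ∑ xs (λ x → f x * c) ≡ ∑ xs f * c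
∑-*ʳ xs c f = trans (∑-cong xs (λ x → *-comm (f x) c)) (trans (∑-*ˡ xs c f) (*-comm c _))

∑-const : ∀ (xs : List A) (c : ℕ) → ∑ xs (λ _ → c) ≡ length xs * c
∑-const []       c = refl
∑-const (x ∷ xs) c = cong (c +_) (∑-const xs c)

length≡∑1 : (xs : List A) → length xs ≡ ∑ xs (λ _ → 1)
length≡∑1 xs = sym (trans (∑-const xs 1) (*-identityʳ _))

∑-zero : ∀ (xs : List A) → ∑ xs (λ _ → 0) ≡ 0
∑-zero xs = trans (∑-const xs 0) (*-zeroʳ (length xs))

∑-swap : ∀ (xs : List A) (ys : List B) (f : A → B → ℕ) →
  ∑ xs (λ x → ∑ ys (f x)) ≡ ∑ ys (λ y → ∑ xs (λ x → f x y))
∑-swap []       ys f = sym (∑-zero ys)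
∑-swap (x ∷ xs) ys f =
  trans (cong (∑ ys (f x) +_) (∑-swap xs ys f)) (sym (∑-+ ys (f x) _))

∑-++ : ∀ (xs ys : List A) (f : A → ℕ) → ∑ (xs ++ ys) f ≡ ∑ xs f + ∑ ys f
∑-++ []       ys f = refl
∑-++ (x ∷ xs) ys f = trans (cong (f x +_) (∑-++ xs ys f)) (sym (+-assoc (f x) _ _))

∑-map : ∀ (h : A → B) (xs : List A) (f : B → ℕ) → ∑ (map h xs) f ≡ ∑ xs (f ∘ h)
∑-map h []       f = refl
∑-map h (x ∷ xs) f = cong (f (h x) +_) (∑-map h xs f)

∑-concatMap : ∀ (h : A → List B) (xs : List A) (f : B → ℕ) →
  ∑ (concatMap h xs) f ≡ ∑ xs (λ x → ∑ (h x) f)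
∑-concatMap h []       f = refl
∑-concatMap h (x ∷ xs) f =
  trans (∑-++ (h x) (concatMap h xs) f) (cong (∑ (h x) f +_) (∑-concatMap h xs f))

∑-term : ∀ {xs : List A} {x} (f : A → ℕ) → x ∈ xs → f x ≤ ∑ xs f
∑-term f (here refl) = m≤m+n _ _
∑-term f (there p)   = ≤-trans (∑-term f p) (m≤n+m _ _)

-- The first-moment method: a natural number below one on average vanishes somewhere. It turns the
-- union bound over families into an actual coloring.
∑<length⇒∃0 : ∀ (xs : List A) (f : A → ℕ) → ∑ xs f < length xs → ∃ λ x → x ∈ xs × f x ≡ 0
∑<length⇒∃0 (x ∷ xs) f lt with f x in eq
... | zero  = x , here refl , eq
... | suc m with y , y∈ , fy ← ∑<length⇒∃0 xs f (≤-trans (s≤s (m≤n+m _ m)) (≤-pred lt)) =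
  y , there y∈ , fy

-- Indicators and counting in lists

𝟙 : Bool → ℕ
𝟙 true  = 1
𝟙 false = 0

𝟙≤ : ∀ b {m} → (T b → 1 ≤ m) → 𝟙 b ≤ m
𝟙≤ true  p = p _
𝟙≤ false p = z≤n

𝟙-mono : ∀ b c → (T b → T c) → 𝟙 b ≤ 𝟙 c
𝟙-mono true  true  p = s≤s z≤n
𝟙-mono true  false p = ⊥-elim (p _)
𝟙-mono false c     p = z≤n

T⇒𝟙 : ∀ {b} → T b → 𝟙 b ≡ 1
T⇒𝟙 {true} _ = refl

𝟙≤1 : ∀ b → 𝟙 b ≤ 1
𝟙≤1 b = 𝟙≤ b (λ _ → s≤s z≤n)

*𝟙-≤ : ∀ b {m k} → (T b → m ≤ k) → m * 𝟙 b ≤ k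
*𝟙-≤ true  {m} le = ≤-trans (≤-reflexive (*-identityʳ m)) (le _)
*𝟙-≤ false {m} le = ≤-trans (≤-reflexive (*-zeroʳ m)) z≤n

𝟙-not : ∀ b → 𝟙 b + 𝟙 (not b) ≡ 1
𝟙-not true  = refl
𝟙-not false = refl

T-does⁻ : {P : Set} (d : Dec P) → T (does d) → P
T-does⁻ (yes p) _ = p

T-does⁺ : {P : Set} (d : Dec P) → P → T (does d)
T-does⁺ (yes _) _ = _
T-does⁺ (no ¬p) p = ¬p p

T-not-does⁻ : {P : Set} (d : Dec P) → T (not (does d)) → ¬ P
T-not-does⁻ (no ¬p) _ = ¬p

T-not-does⁺ : {P : Set} (d : Dec P) → ¬ P → T (not (does d))
T-not-does⁺ (yes p) ¬p = ¬p p
T-not-does⁺ (no _)  _  = _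

T-∧⁺ : ∀ {b c} → T b → T c → T (b ∧ c)
T-∧⁺ {true} {true} _ _ = _

T-∧⁻ : ∀ {b c} → T (b ∧ c) → T b × T c
T-∧⁻ {true} {true} _ = _ , _

length-filter : ∀ {P : A → Set} (P? : ∀ x → Dec (P x)) xs → length (filter P? xs) ≡ ∑ xs (𝟙 ∘ does ∘ P?)
length-filter P? []       = refl
length-filter P? (x ∷ xs) with does (P? x)
... | true  = cong suc (length-filter P? xs)
... | false = length-filter P? xs

length-filterᵇ : ∀ (p : A → Bool) xs → length (filterᵇ p xs) ≡ ∑ xs (𝟙 ∘ p)
length-filterᵇ p = length-filter (T? ∘ p)

∈-filterᵇ⁻ : ∀ (p : A → Bool) xs {x} → x ∈ filterᵇ p xs → x ∈ xs × T (p x)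
∈-filterᵇ⁻ p xs = ∈-filter⁻ (T? ∘ p) {xs = xs}

∑-filterᵇ : ∀ (p : A → Bool) xs (f : A → ℕ) → ∑ (filterᵇ p xs) f ≡ ∑ xs (λ x → 𝟙 (p x) * f x)
∑-filterᵇ p []       f = refl
∑-filterᵇ p (x ∷ xs) f with p x
... | true  = cong₂ _+_ (sym (+-identityʳ (f x))) (∑-filterᵇ p xs f)
... | false = ∑-filterᵇ p xs f

unique-⊆-length : ∀ {xs ys : List A} → Unique xs → (∀ {x} → x ∈ xs → x ∈ ys) → length xs ≤ length ys
unique-⊆-length [] _ = z≤n
unique-⊆-length {xs = x ∷ xs} (x∉ ∷ u) sub with ∈-∃++ (sub (here refl))
... | as , bs , refl = begin
  suc (length xs)        ≤⟨ s≤s (unique-⊆-length u sub′) ⟩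
  suc (length (as ++ bs)) ≡⟨ cong suc (length-++ as) ⟩
  suc (length as + length bs) ≡⟨ +-suc (length as) (length bs) ⟨
  length as + suc (length bs) ≡⟨ length-++ as ⟨
  length (as ++ x ∷ bs) ∎
  where
  open ≤-Reasoning
  sub′ : ∀ {y} → y ∈ xs → y ∈ as ++ bs
  sub′ {y} y∈ with ∈-++⁻ as (sub (there y∈))
  ... | inj₁ p          = ∈-++⁺ˡ p
  ... | inj₂ (here eq)  = contradiction (sym eq) (All.lookup x∉ y∈)
  ... | inj₂ (there p)  = ∈-++⁺ʳ as p

-- Powers of natural numbers

^-cancelʳ-≤ : ∀ {m n} d .{{_ : NonZero d}} → m ^ d ≤ n ^ d → m ≤ n
^-cancelʳ-≤ {m} {n} d le with m ≤? n
... | yes p = p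
... | no ¬p = contradiction le (<⇒≱ (^-monoˡ-< d (≰⇒> ¬p)))

^-distribʳ-* : ∀ m n d → (m * n) ^ d ≡ m ^ d * n ^ d
^-distribʳ-* m n zero    = refl
^-distribʳ-* m n (suc d) rewrite ^-distribʳ-* m n d = lemma m n (m ^ d) (n ^ d)
  where
  lemma : ∀ a b c d → a * b * (c * d) ≡ a * c * (b * d)
  lemma = solve-∀

^-comm : ∀ m i j → (m ^ i) ^ j ≡ (m ^ j) ^ i
^-comm m i j = trans (^-*-assoc m i j) (trans (cong (m ^_) (*-comm i j)) (sym (^-*-assoc m j i)))

0^d≡0 : ∀ d .{{_ : NonZero d}} → 0 ^ d ≡ 0
0^d≡0 (suc d) = refl

1≤m^d⇒1≤m : ∀ m d .{{_ : NonZero d}} → 1 ≤ m ^ d → 1 ≤ m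
1≤m^d⇒1≤m (suc m) d       le = s≤s z≤n
1≤m^d⇒1≤m zero    (suc d) ()

n<2^n : ∀ m → m < 2 ^ m
n<2^n zero    = s≤s z≤n
n<2^n (suc m) = +-mono-≤ (m^n>0 2 m) (≤-trans (n<2^n m) (m≤m+n _ 0))

n<4^n : ∀ m → m < 4 ^ m
n<4^n zero    = s≤s z≤n
n<4^n (suc m) = +-mono-≤ (m^n>0 4 m) (≤-trans (n<4^n m) (m≤m+n _ _))

-- Colorings and the spread lemma

x∈p─q⇒x∉q : ∀ (p q : Subset n) {x} → x ∈ˢ p ─ q → x ∉ˢ q
x∈p─q⇒x∉q (_ ∷ p) (outside ∷ q) (Vec.there x∈) (Vec.there x∈q) = x∈p─q⇒x∉q p q x∈ x∈q
x∈p─q⇒x∉q (_ ∷ p) (inside ∷ q) (Vec.there x∈) (Vec.there x∈q) = x∈p─q⇒x∉q p q x∈ x∈q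

⊆-card⇒⊇ : ∀ {p q : Subset n} → p ⊆ q → ∣ q ∣ ≤ ∣ p ∣ → q ⊆ p
⊆-card⇒⊇ {p = p} p⊆q le {x} x∈q with x ∈? p
... | yes x∈p = x∈p
... | no  x∉p = contradiction le (<⇒≱ (p⊂q⇒∣p∣<∣q∣ (p⊆q , x , x∈q , x∉p)))

∈-allSubsets : (p : Subset n) → p ∈ allSubsets n
∈-allSubsets []            = here refl
∈-allSubsets (outside ∷ p) = ∈-++⁺ˡ (∈-map⁺ (outside ∷_) (∈-allSubsets p))
∈-allSubsets (inside ∷ p)  = ∈-++⁺ʳ _ (∈-map⁺ (inside ∷_) (∈-allSubsets p))

∑-allSubsets : ∀ n (f : Subset (suc n) → ℕ) →
  ∑ (allSubsets (suc n)) f ≡ ∑ (allSubsets n) (f ∘ (outside ∷_)) + ∑ (allSubsets n) (f ∘ (inside ∷_))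
∑-allSubsets n f = trans (∑-++ (map (outside ∷_) (allSubsets n)) _ f)
  (cong₂ _+_ (∑-map (outside ∷_) (allSubsets n) f) (∑-map (inside ∷_) (allSubsets n) f))

∑-subsets : (p : Subset n) → ∑ (allSubsets n) (λ q → 𝟙 (does (q ⊆? p))) ≤ 2 ^ ∣ p ∣
∑-subsets [] = ≤-refl
∑-subsets {suc n} (s ∷ p) = begin
  ∑ (allSubsets (suc n)) (λ q → 𝟙 (does (q ⊆? (s ∷ p))))
    ≡⟨ ∑-allSubsets n _ ⟩
  ∑ (allSubsets n) (λ q → 𝟙 (does ((outside ∷ q) ⊆? (s ∷ p)))) + ∑ (allSubsets n) (λ q → 𝟙 (does ((inside ∷ q) ⊆? (s ∷ p))))
    ≤⟨ lemma s ⟩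
  2 ^ ∣ s ∷ p ∣ ∎
  where
  open ≤-Reasoning
  part : ∀ s t → ∑ (allSubsets n) (λ q → 𝟙 (does ((t ∷ q) ⊆? (s ∷ p)))) ≤ 2 ^ ∣ p ∣
  part s t = ≤-trans (∑-mono (allSubsets n) λ q → 𝟙-mono _ _
    (λ h → T-does⁺ (q ⊆? p) (drop-∷-⊆ (T-does⁻ ((t ∷ q) ⊆? (s ∷ p)) h)))) (∑-subsets p)
  lemma : ∀ s → ∑ (allSubsets n) (λ q → 𝟙 (does ((outside ∷ q) ⊆? (s ∷ p))))
    + ∑ (allSubsets n) (λ q → 𝟙 (does ((inside ∷ q) ⊆? (s ∷ p)))) ≤ 2 ^ ∣ s ∷ p ∣
  lemma inside  = +-mono-≤ (part inside outside) (≤-trans (part inside inside) (m≤m+n _ 0))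
  lemma outside = ≤-trans (+-mono-≤ (part outside outside)
    (≤-trans (∑-mono (allSubsets n) {g = λ _ → 0} λ q → 𝟙≤ (does ((inside ∷ q) ⊆? (outside ∷ p)))
      (λ h → case (T-does⁻ ((inside ∷ q) ⊆? (outside ∷ p)) h Vec.here)))
      (≤-reflexive (∑-zero (allSubsets n)))))
    (≤-reflexive (+-identityʳ _))
    where
    case : {P : Set} → zero ∈ˢ (outside ∷ p) → P
    case ()

-- The probability space: expectations are sums over this list, compared with multiples of its
-- length.
colorings : List A → ∀ n → List (Vec A n)
colorings cols zero    = [] ∷ []
colorings cols (suc n) = concatMap (λ c → map (c ∷_) (colorings cols n)) cols

∑-colorings : ∀ (cols : List A) n (f : Vec A (suc n) → ℕ) →
  ∑ (colorings cols (suc n)) f ≡ ∑ cols (λ c → ∑ (colorings cols n) (λ v → f (c ∷ v)))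
∑-colorings cols n f = trans (∑-concatMap (λ c → map (c ∷_) (colorings cols n)) cols f)
  (∑-cong cols λ c → ∑-map (c ∷_) (colorings cols n) f)

length-colorings : ∀ (cols : List A) n → length (colorings cols n) ≡ length cols ^ n
length-colorings cols zero    = refl
length-colorings cols (suc n) = begin
  length (colorings cols (suc n))                ≡⟨ length≡∑1 (colorings cols (suc n)) ⟩
  ∑ (colorings cols (suc n)) (λ _ → 1)           ≡⟨ ∑-colorings cols n _ ⟩
  ∑ cols (λ _ → ∑ (colorings cols n) (λ _ → 1))  ≡⟨ ∑-const cols _ ⟩
  length cols * ∑ (colorings cols n) (λ _ → 1)
    ≡⟨ cong (length cols *_) (trans (sym (length≡∑1 (colorings cols n))) (length-colorings cols n)) ⟩
  length cols * length cols ^ n ∎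
  where open ≡-Reasoning

recolor : Subset n → A → Vec A n → Vec A n
recolor []            c []      = []
recolor (inside ∷ p)  c (x ∷ v) = c ∷ recolor p c v
recolor (outside ∷ p) c (x ∷ v) = x ∷ recolor p c v

lookup-recolor-∈ : ∀ {p : Subset n} {c : A} {v x} → x ∈ˢ p → lookup (recolor p c v) x ≡ c
lookup-recolor-∈ {p = inside ∷ p}  {v = y ∷ v} Vec.here       = refl
lookup-recolor-∈ {p = inside ∷ p}  {v = y ∷ v} (Vec.there x∈) = lookup-recolor-∈ {p = p} x∈
lookup-recolor-∈ {p = outside ∷ p} {v = y ∷ v} (Vec.there x∈) = lookup-recolor-∈ {p = p} x∈

lookup-recolor-∉ : ∀ {p : Subset n} {c : A} {v x} → x ∉ˢ p → lookup (recolor p c v) x ≡ lookup v x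
lookup-recolor-∉ {p = inside ∷ p}  {v = y ∷ v} {zero}  x∉ = ⊥-elim (x∉ Vec.here)
lookup-recolor-∉ {p = outside ∷ p} {v = y ∷ v} {zero}  x∉ = refl
lookup-recolor-∉ {p = inside ∷ p}  {v = y ∷ v} {suc x} x∉ = lookup-recolor-∉ {p = p} (x∉ ∘ Vec.there)
lookup-recolor-∉ {p = outside ∷ p} {v = y ∷ v} {suc x} x∉ = lookup-recolor-∉ {p = p} (x∉ ∘ Vec.there)

-- Recoloring forgets the coordinates in `p`, which gives the power of `length cols`; the colorings
-- that are constantly `c` on `p` contribute only a part of the full sum.
∑-recolor : ∀ {cols : List A} {c} → c ∈ cols → (p : Subset n) (f : Vec A n → ℕ) →
  ∑ (colorings cols n) (f ∘ recolor p c) ≤ length cols ^ ∣ p ∣ * ∑ (colorings cols n) f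
∑-recolor c∈ [] f = ≤-reflexive (sym (*-identityˡ _))
∑-recolor {n = suc n} {cols = cols} {c} c∈ (inside ∷ p) f = begin
  ∑ (colorings cols (suc n)) (f ∘ recolor (inside ∷ p) c)
    ≡⟨ ∑-colorings cols n _ ⟩
  ∑ cols (λ _ → ∑ (colorings cols n) (λ v → f (c ∷ recolor p c v)))
    ≡⟨ ∑-const cols _ ⟩
  length cols * ∑ (colorings cols n) (λ v → f (c ∷ recolor p c v))
    ≤⟨ *-monoʳ-≤ (length cols) (∑-recolor c∈ p (f ∘ (c ∷_))) ⟩
  length cols * (length cols ^ ∣ p ∣ * ∑ (colorings cols n) (λ v → f (c ∷ v)))
    ≡⟨ *-assoc (length cols) _ _ ⟨
  length cols ^ suc ∣ p ∣ * ∑ (colorings cols n) (λ v → f (c ∷ v))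
    ≤⟨ *-monoʳ-≤ (length cols ^ suc ∣ p ∣) (∑-term (λ x → ∑ (colorings cols n) (λ v → f (x ∷ v))) c∈) ⟩
  length cols ^ suc ∣ p ∣ * ∑ cols (λ x → ∑ (colorings cols n) (λ v → f (x ∷ v)))
    ≡⟨ cong (length cols ^ suc ∣ p ∣ *_) (∑-colorings cols n f) ⟨
  length cols ^ suc ∣ p ∣ * ∑ (colorings cols (suc n)) f ∎
  where open ≤-Reasoning
∑-recolor {n = suc n} {cols = cols} {c} c∈ (outside ∷ p) f = begin
  ∑ (colorings cols (suc n)) (f ∘ recolor (outside ∷ p) c)
    ≡⟨ ∑-colorings cols n _ ⟩
  ∑ cols (λ x → ∑ (colorings cols n) (λ v → f (x ∷ recolor p c v)))
    ≤⟨ ∑-mono cols (λ x → ∑-recolor c∈ p (f ∘ (x ∷_))) ⟩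
  ∑ cols (λ x → length cols ^ ∣ p ∣ * ∑ (colorings cols n) (λ v → f (x ∷ v)))
    ≡⟨ ∑-*ˡ cols (length cols ^ ∣ p ∣) _ ⟩
  length cols ^ ∣ p ∣ * ∑ cols (λ x → ∑ (colorings cols n) (λ v → f (x ∷ v)))
    ≡⟨ cong (length cols ^ ∣ p ∣ *_) (∑-colorings cols n f) ⟨
  length cols ^ ∣ p ∣ * ∑ (colorings cols (suc n)) f ∎
  where open ≤-Reasoning

-- Minimal fragments relative to an exposed class

module _ (H : List (Subset n)) (W : Subset n) where

  abstract

    -- The default `S` is itself contained in `W ∪ S`, so the minimum never runs over an empty
    -- range. For `S ∈ H` the result is a true minimiser within `H`.
    nearest : Subset n → Subset n
    nearest S = argmin (λ S′ → ∣ S′ ─ W ∣) S (filter (_⊆? (W ∪ S)) H)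

    nearest-∈ : ∀ {S} → S ∈ H → nearest S ∈ H
    nearest-∈ {S} S∈ = argmin-all (λ S′ → ∣ S′ ─ W ∣) S∈
      (All.tabulate (λ x∈ → proj₁ (∈-filter⁻ (_⊆? (W ∪ S)) {xs = H} x∈)))

    nearest-⊆ : ∀ S → nearest S ⊆ W ∪ S
    nearest-⊆ S = argmin-all (λ S′ → ∣ S′ ─ W ∣) {S} {filter (_⊆? (W ∪ S)) H} {λ S′ → S′ ⊆ W ∪ S}
      (x∈p∪q⁺ ∘ inj₂) (All.tabulate (λ x∈ → proj₂ (∈-filter⁻ (_⊆? (W ∪ S)) {xs = H} x∈)))

    nearest-min : ∀ S {S′} → S′ ∈ H → S′ ⊆ W ∪ S → ∣ nearest S ─ W ∣ ≤ ∣ S′ ─ W ∣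
    nearest-min S S′∈ S′⊆ = f[argmin]≤v⁺ {f = λ S′ → ∣ S′ ─ W ∣} S (filter (_⊆? (W ∪ S)) H)
      (inj₂ (lose (∈-filter⁺ (_⊆? (W ∪ S)) S′∈ S′⊆) ≤-refl))

  fragment : Subset n → Subset n
  fragment S = nearest S ─ W

  fragment-⊆ : ∀ S → fragment S ⊆ S
  fragment-⊆ S x∈ with x∈p∪q⁻ W S (nearest-⊆ S (p─q⊆p (nearest S) W x∈))
  ... | inj₁ x∈W = contradiction x∈W (x∈p─q⇒x∉q (nearest S) W x∈)
  ... | inj₂ x∈S = x∈S

small? : ℕ → Subset n → Bool
small? h S = does (∣ S ∣ <? h)

step : ℕ → List (Subset n) → Subset n → List (Subset n)
step h H W = filterᵇ (small? h) (map (fragment H W) H)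

lost : ℕ → List (Subset n) → Subset n → ℕ
lost h H W = ∑ H (λ S → 𝟙 (not (small? h (fragment H W S))))

length-step : ∀ h (H : List (Subset n)) W → length (step h H W) + lost h H W ≡ length H
length-step h H W = begin
  length (step h H W) + lost h H W
    ≡⟨ cong (_+ lost h H W) (trans (length-filterᵇ (small? h) (map (fragment H W) H)) (∑-map (fragment H W) H _)) ⟩
  ∑ H (λ S → 𝟙 (small? h (fragment H W S))) + lost h H W
    ≡⟨ ∑-+ H _ _ ⟨
  ∑ H (λ S → 𝟙 (small? h (fragment H W S)) + 𝟙 (not (small? h (fragment H W S))))
    ≡⟨ ∑-cong H (λ S → 𝟙-not (small? h (fragment H W S))) ⟩
  ∑ H (λ _ → 1)
    ≡⟨ length≡∑1 H ⟨
  length H ∎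
  where open ≡-Reasoning

∈-step⁻ : ∀ h (H : List (Subset n)) W {S} → S ∈ step h H W →
  ∃ λ S′ → S′ ∈ H × S ≡ fragment H W S′ × ∣ S ∣ < h
∈-step⁻ h H W {S} S∈ with S∈′ , sm ← ∈-filterᵇ⁻ (small? h) (map (fragment H W) H) S∈
  with S′ , S′∈ , eq ← ∈-map⁻ (fragment H W) S∈′ = S′ , S′∈ , eq , T-does⁻ (∣ S ∣ <? h) sm

-- List entries are counted, so equal fragments of different sets count separately; this keeps the
-- number of fragments comparable with the number of sets they come from.
degree : List (Subset n) → Subset n → ℕ
degree H X = ∑ H (λ S → 𝟙 (does (X ⊆? S)))

degree-step : ∀ h (H : List (Subset n)) W X → degree (step h H W) X ≤ degree H X
degree-step h H W X = begin
  degree (step h H W) X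
    ≡⟨ ∑-filterᵇ (small? h) (map (fragment H W) H) _ ⟩
  ∑ (map (fragment H W) H) (λ S → 𝟙 (small? h S) * 𝟙 (does (X ⊆? S)))
    ≡⟨ ∑-map (fragment H W) H _ ⟩
  ∑ H (λ S → 𝟙 (small? h (fragment H W S)) * 𝟙 (does (X ⊆? fragment H W S)))
    ≤⟨ ∑-mono H (λ S → ≤-trans (*-mono-≤ (𝟙≤1 (small? h (fragment H W S)))
         (𝟙-mono _ _ (λ t → T-does⁺ (X ⊆? S) (fragment-⊆ H W S ∘ T-does⁻ (X ⊆? fragment H W S) t))))
         (≤-reflexive (*-identityˡ _))) ⟩
  degree H X ∎
  where open ≤-Reasoning

-- A choice determined by `H` and `Z` alone, so that it can be repeated when only the recolored
-- coloring is known. The default `⊥` keeps the size bound valid when nothing fits.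
pick : List (Subset n) → Subset n → Subset n
pick []      Z = ⊥
pick (S ∷ H) Z with S ⊆? Z
... | yes _ = S
... | no _  = pick H Z

pick-⊥ : ∀ (H : List (Subset n)) Z → pick H Z ≡ ⊥ ⊎ pick H Z ∈ H
pick-⊥ []      Z = inj₁ refl
pick-⊥ (S ∷ H) Z with S ⊆? Z
... | yes _ = inj₂ (here refl)
... | no _ with pick-⊥ H Z
...   | inj₁ eq = inj₁ eq
...   | inj₂ p  = inj₂ (there p)

pick-∈ : ∀ (H : List (Subset n)) {Z S} → S ∈ H → S ⊆ Z → pick H Z ∈ H × pick H Z ⊆ Z
pick-∈ (S ∷ H) {Z} S∈ S⊆ with S ⊆? Z
pick-∈ (S ∷ H) {Z} S∈ S⊆          | yes p = here refl , p
pick-∈ (S ∷ H) {Z} (here refl) S⊆ | no ¬p = contradiction (λ {x} → S⊆ {x}) ¬p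
pick-∈ (S ∷ H) {Z} (there S∈) S⊆  | no ¬p = let a , b = pick-∈ H S∈ S⊆ in there a , b

module Class {Col : Set} (_≟_ : DecidableEquality Col) where

  class : Col → Vec Col n → Subset n
  class c = Vec.map (λ x → does (x ≟ c))

  ∈-class⁺ : ∀ {c} {v : Vec Col n} {x} → lookup v x ≡ c → x ∈ˢ class c v
  ∈-class⁺ {c = c} {v} {x} eq = lookup⇒[]= x (class c v)
    (trans (lookup-map x _ v) (dec-true (lookup v x ≟ c) eq))

  ∈-class⁻ : ∀ {c} {v : Vec Col n} {x} → x ∈ˢ class c v → lookup v x ≡ c
  ∈-class⁻ {c = c} {v} {x} x∈ = T-does⁻ (lookup v x ≟ c)
    (subst T (trans (sym ([]=⇒lookup x∈)) (lookup-map x _ v)) _)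

module Spread {Col : Set} (_≟_ : DecidableEquality Col) (cols : List Col) {n : ℕ}
  (deg : Subset n → ℕ) (K : ℕ) (deg-≤ : ∀ X → deg X * (128 * length cols) ^ ∣ X ∣ ≤ K) where

  open Class _≟_ public

  -- The two colorings show the same picture to an observer who sees the classes of the used colors
  -- and cannot tell the other colors apart.
  Agree : (Col → Set) → Vec Col n → Vec Col n → Set
  Agree Used v v′ = ∀ x → lookup v x ≡ lookup v′ x ⊎ (¬ Used (lookup v x) × ¬ Used (lookup v′ x))

  N : ℕ
  N = length (colorings cols n)

  -- H v lists, with multiplicity, the fragments that survive after the classes of the Used colors have
  -- been exposed.  Degrees are compared with those of the initial family, so lost sets need no
  -- renormalisation.
  record Process (Used : Col → Set) (b : ℕ) (H : Vec Col n → List (Subset n)) : Set where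
    field
      local   : ∀ {v v′} → Agree Used v v′ → H v ≡ H v′
      avoids  : ∀ {v S x} → S ∈ H v → x ∈ˢ S → ¬ Used (lookup v x)
      bounded : ∀ {v S} → S ∈ H v → ∣ S ∣ < b
      degrees : ∀ v X → degree (H v) X ≤ deg X

  module Round {Used h H} (P : Process Used (2 * h) H) {c : Col} (c∈ : c ∈ cols) (fresh : ¬ Used c) where
    open Process P

    W : Vec Col n → Subset n
    W = class c

    code? : Vec Col n → Subset n → Bool
    code? v S = not (small? h S) ∧ does (S ⊆? pick (H v) (W v))

    -- The lost fragment is recovered from the recolored v as a subset of the picked set.
    encode : ∀ v {S} → S ∈ H v → let F = fragment (H v) (W v) S in
      T (not (small? h F)) → T (code? (recolor F c v) F)
    encode v {S} S∈ big = T-∧⁺ {not (small? h F)} big (T-does⁺ (F ⊆? pick (H v′) (W v′)) F⊆pick)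
      where
      F = fragment (H v) (W v) S
      v′ = recolor F c v
      S′ = nearest (H v) (W v) S
      agree : Agree Used v v′
      agree x with x ∈? F
      ... | yes x∈ = inj₂ (avoids S∈ (fragment-⊆ (H v) (W v) S x∈) , subst (¬_ ∘ Used) (sym (lookup-recolor-∈ {p = F} x∈)) fresh)
      ... | no  x∉ = inj₁ (sym (lookup-recolor-∉ {p = F} x∉))
      H≡ : H v ≡ H v′
      H≡ = local agree
      S′⊆ : S′ ⊆ W v′
      S′⊆ {x} x∈ with x ∈? F
      ... | yes x∈F = ∈-class⁺ {v = v′} (lookup-recolor-∈ {p = F} x∈F)
      ... | no  x∉F with x ∈? W v
      ...   | yes x∈W = ∈-class⁺ {v = v′} (trans (lookup-recolor-∉ {p = F} x∉F) (∈-class⁻ {v = v} x∈W))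
      ...   | no  x∉W = contradiction (x∈p∧x∉q⇒x∈p─q x∈ x∉W) x∉F
      R = pick (H v′) (W v′)
      picked : R ∈ H v′ × R ⊆ W v′
      picked = pick-∈ (H v′) (subst (S′ ∈_) H≡ (nearest-∈ (H v) (W v) S∈)) S′⊆
      R∈ : R ∈ H v
      R∈ = subst (R ∈_) (sym H≡) (proj₁ picked)
      R⊆ : ∀ {x} → x ∈ˢ R → x ∈ˢ W v ⊎ x ∈ˢ F
      R⊆ {x} x∈ with x ∈? F
      ... | yes x∈F = inj₂ x∈F
      ... | no  x∉F = inj₁ (∈-class⁺ {v = v} (trans (sym (lookup-recolor-∉ {p = F} x∉F)) (∈-class⁻ {v = v′} (proj₂ picked x∈))))
      R─W⊆F : R ─ W v ⊆ F
      R─W⊆F x∈ with R⊆ (p─q⊆p R (W v) x∈)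
      ... | inj₁ x∈W = contradiction x∈W (x∈p─q⇒x∉q R (W v) x∈)
      ... | inj₂ x∈F = x∈F
      R⊆W∪S : R ⊆ W v ∪ S
      R⊆W∪S x∈ with R⊆ x∈
      ... | inj₁ x∈W = x∈p∪q⁺ (inj₁ x∈W)
      ... | inj₂ x∈F = x∈p∪q⁺ (inj₂ (fragment-⊆ (H v) (W v) S x∈F))
      -- `R` competes in the minimum that defines the fragment, so `R ─ W v` has at least as many
      -- elements as `F`; being a subset of `F`, it equals `F`.
      F⊆pick : F ⊆ R
      F⊆pick x∈ = p─q⊆p R (W v) (⊆-card⇒⊇ R─W⊆F (nearest-min (H v) (W v) S R∈ R⊆W∪S) x∈)

    -- A lost `S` is charged to the subset `X` equal to its fragment. The code does not mention `S`,
    -- so after exchanging the sums `S` enters only through the degree of `X`.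
    lost-≤ : ∀ v → lost h (H v) (W v) ≤ ∑ (allSubsets n) (λ X → 𝟙 (code? (recolor X c v) X) * deg X)
    lost-≤ v = begin
      lost h (H v) (W v)
        ≤⟨ ∑-mono-∈ (H v) (λ {S} S∈ → 𝟙≤ _ λ big → ≤-trans
             (≤-reflexive (sym (cong₂ _*_ (T⇒𝟙 (encode v S∈ big))
               (T⇒𝟙 (T-does⁺ (fragment (H v) (W v) S ⊆? S) (fragment-⊆ (H v) (W v) S))))))
             (∑-term (λ X → 𝟙 (code? (recolor X c v) X) * 𝟙 (does (X ⊆? S))) (∈-allSubsets (fragment (H v) (W v) S)))) ⟩
      ∑ (H v) (λ S → ∑ (allSubsets n) (λ X → 𝟙 (code? (recolor X c v) X) * 𝟙 (does (X ⊆? S))))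
        ≡⟨ ∑-swap (H v) (allSubsets n) _ ⟩
      ∑ (allSubsets n) (λ X → ∑ (H v) (λ S → 𝟙 (code? (recolor X c v) X) * 𝟙 (does (X ⊆? S))))
        ≡⟨ ∑-cong (allSubsets n) (λ X → ∑-*ˡ (H v) (𝟙 (code? (recolor X c v) X)) _) ⟩
      ∑ (allSubsets n) (λ X → 𝟙 (code? (recolor X c v) X) * degree (H v) X)
        ≤⟨ ∑-mono (allSubsets n) (λ X → *-monoʳ-≤ (𝟙 (code? (recolor X c v) X)) (degrees v X)) ⟩
      ∑ (allSubsets n) (λ X → 𝟙 (code? (recolor X c v) X) * deg X) ∎
      where open ≤-Reasoning

    -- Only `X` with at least `h` elements are coded. For these, spreadness absorbs the power of
    -- `length cols`, the price of undoing the recoloring, and leaves `128 ^ h` as a gain.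
    code-≤ : ∀ v X → 128 ^ h * (deg X * (length cols ^ ∣ X ∣ * 𝟙 (code? v X))) ≤ K * 𝟙 (does (X ⊆? pick (H v) (W v)))
    code-≤ v X with small? h X in eq
    ... | true  rewrite *-zeroʳ (length cols ^ ∣ X ∣) | *-zeroʳ (deg X) | *-zeroʳ (128 ^ h) = z≤n
    ... | false = begin
      128 ^ h * (deg X * (C ^ t * i))   ≤⟨ *-monoˡ-≤ _ (^-monoʳ-≤ 128 h≤t) ⟩
      128 ^ t * (deg X * (C ^ t * i))   ≡⟨ lemma (128 ^ t) (deg X) (C ^ t) i ⟩
      deg X * (128 ^ t * C ^ t) * i     ≡⟨ cong (λ z → deg X * z * i) (^-distribʳ-* 128 C t) ⟨
      deg X * (128 * C) ^ t * i         ≤⟨ *-monoˡ-≤ i (deg-≤ X) ⟩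
      K * i ∎
      where
      open ≤-Reasoning
      C = length cols
      t = ∣ X ∣
      i = 𝟙 (does (X ⊆? pick (H v) (W v)))
      h≤t : h ≤ t
      h≤t = ≮⇒≥ (T-not-does⁻ (t <? h) (subst (T ∘ not) (sym eq) _))
      lemma : ∀ a b c d → a * (b * (c * d)) ≡ b * (a * c) * d
      lemma = solve-∀

    pick-bounded : 1 ≤ h → ∀ v → ∣ pick (H v) (W v) ∣ < 2 * h
    pick-bounded 1≤h v with pick-⊥ (H v) (W v)
    ... | inj₁ eq rewrite eq | ∣⊥∣≡0 n = ≤-trans 1≤h (m≤m+n h _)
    ... | inj₂ p∈ = bounded p∈

    -- The picked set has at most 2h - 1 elements, hence at most `4 ^ h` / 2 subsets. Dividing the
    -- gain `128 ^ h` by this leaves `2 * 32 ^ h`.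
    round : 1 ≤ h → 2 * 32 ^ h * ∑ (colorings cols n) (λ v → lost h (H v) (W v)) ≤ K * N
    round 1≤h = *-cancelˡ-≤ (4 ^ h) {{m^n≢0 4 h}} (begin
      4 ^ h * (2 * 32 ^ h * L)
        ≡⟨ l₁ (4 ^ h) (32 ^ h) L ⟩
      2 * (4 ^ h * 32 ^ h * L)
        ≡⟨ cong (λ z → 2 * (z * L)) (^-distribʳ-* 4 32 h) ⟨
      2 * (128 ^ h * L)
        ≤⟨ *-monoʳ-≤ 2 (*-monoʳ-≤ (128 ^ h) (∑-mono Ω lost-≤)) ⟩
      2 * (128 ^ h * ∑ Ω (λ v → ∑ 𝓟 (λ X → 𝟙 (code? (recolor X c v) X) * deg X)))
        ≡⟨ cong (λ z → 2 * (128 ^ h * z)) (∑-swap Ω 𝓟 _) ⟩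
      2 * (128 ^ h * ∑ 𝓟 (λ X → ∑ Ω (λ v → 𝟙 (code? (recolor X c v) X) * deg X)))
        ≤⟨ *-monoʳ-≤ 2 (*-monoʳ-≤ (128 ^ h) (∑-mono 𝓟 per-X)) ⟩
      2 * (128 ^ h * ∑ 𝓟 (λ X → ∑ Ω (λ v → deg X * (length cols ^ ∣ X ∣ * 𝟙 (code? v X)))))
        ≡⟨ cong (λ z → 2 * (128 ^ h * z)) (∑-swap Ω 𝓟 _) ⟨
      2 * (128 ^ h * ∑ Ω (λ v → ∑ 𝓟 (λ X → deg X * (length cols ^ ∣ X ∣ * 𝟙 (code? v X)))))
        ≡⟨ cong (2 *_) (trans (sym (∑-*ˡ Ω (128 ^ h) _)) (∑-cong Ω (λ v → sym (∑-*ˡ 𝓟 (128 ^ h) _)))) ⟩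
      2 * ∑ Ω (λ v → ∑ 𝓟 (λ X → 128 ^ h * (deg X * (length cols ^ ∣ X ∣ * 𝟙 (code? v X)))))
        ≤⟨ *-monoʳ-≤ 2 (∑-mono Ω (λ v → ∑-mono 𝓟 (code-≤ v))) ⟩
      2 * ∑ Ω (λ v → ∑ 𝓟 (λ X → K * 𝟙 (does (X ⊆? pick (H v) (W v)))))
        ≡⟨ cong (2 *_) (trans (∑-cong Ω (λ v → ∑-*ˡ 𝓟 K _)) (∑-*ˡ Ω K _)) ⟩
      2 * (K * ∑ Ω (λ v → ∑ 𝓟 (λ X → 𝟙 (does (X ⊆? pick (H v) (W v))))))
        ≡⟨ l₂ K _ ⟩
      K * (2 * ∑ Ω (λ v → ∑ 𝓟 (λ X → 𝟙 (does (X ⊆? pick (H v) (W v))))))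
        ≡⟨ cong (K *_) (∑-*ˡ Ω 2 _) ⟨
      K * ∑ Ω (λ v → 2 * ∑ 𝓟 (λ X → 𝟙 (does (X ⊆? pick (H v) (W v)))))
        ≤⟨ *-monoʳ-≤ K (∑-mono Ω (λ v → ≤-trans (*-monoʳ-≤ 2 (∑-subsets (pick (H v) (W v))))
             (^-monoʳ-≤ 2 (pick-bounded 1≤h v)))) ⟩
      K * ∑ Ω (λ v → 2 ^ (2 * h))
        ≡⟨ cong (K *_) (∑-const Ω _) ⟩
      K * (N * 2 ^ (2 * h))
        ≡⟨ cong (λ z → K * (N * z)) (sym (^-*-assoc 2 2 h)) ⟩
      K * (N * 4 ^ h)
        ≡⟨ l₃ K N (4 ^ h) ⟩
      4 ^ h * (K * N) ∎)
      where
      open ≤-Reasoning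
      Ω = colorings cols n
      𝓟 = allSubsets n
      L = ∑ Ω (λ v → lost h (H v) (W v))
      l₁ : ∀ a b c → a * (2 * b * c) ≡ 2 * (a * b * c)
      l₁ = solve-∀
      l₂ : ∀ a b → 2 * (a * b) ≡ a * (2 * b)
      l₂ = solve-∀
      l₃ : ∀ a b c → a * (b * c) ≡ c * (a * b)
      l₃ = solve-∀
      per-X : ∀ X → ∑ Ω (λ v → 𝟙 (code? (recolor X c v) X) * deg X)
        ≤ ∑ Ω (λ v → deg X * (length cols ^ ∣ X ∣ * 𝟙 (code? v X)))
      per-X X = begin
        ∑ Ω (λ v → 𝟙 (code? (recolor X c v) X) * deg X)  ≡⟨ ∑-*ʳ Ω (deg X) _ ⟩
        ∑ Ω (λ v → 𝟙 (code? (recolor X c v) X)) * deg X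
          ≤⟨ *-monoˡ-≤ (deg X) (∑-recolor c∈ X (λ v → 𝟙 (code? v X))) ⟩
        length cols ^ ∣ X ∣ * ∑ Ω (λ v → 𝟙 (code? v X)) * deg X
          ≡⟨ *-comm _ (deg X) ⟩
        deg X * (length cols ^ ∣ X ∣ * ∑ Ω (λ v → 𝟙 (code? v X)))
          ≡⟨ cong (deg X *_) (∑-*ˡ Ω (length cols ^ ∣ X ∣) _) ⟨
        deg X * ∑ Ω (λ v → length cols ^ ∣ X ∣ * 𝟙 (code? v X))
          ≡⟨ ∑-*ˡ Ω (deg X) _ ⟨
        ∑ Ω (λ v → deg X * (length cols ^ ∣ X ∣ * 𝟙 (code? v X))) ∎

    next : Process (λ x → Used x ⊎ x ≡ c) h (λ v → step h (H v) (W v))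
    next = record
      { local   = λ {v} {v′} ag → cong₂ (step h) (local (weaken {v} {v′} ag)) (same-class {v} {v′} ag)
      ; avoids  = λ {v} {S} {x} S∈ x∈ → avoid v S∈ x∈
      ; bounded = λ {v} S∈ → let _ , _ , _ , b = ∈-step⁻ h (H v) (W v) S∈ in b
      ; degrees = λ v X → ≤-trans (degree-step h (H v) (W v) X) (degrees v X)
      }
      where
      Used′ = λ x → Used x ⊎ x ≡ c
      weaken : ∀ {v v′} → Agree Used′ v v′ → Agree Used v v′
      weaken ag x with ag x
      ... | inj₁ eq      = inj₁ eq
      ... | inj₂ (a , b) = inj₂ (a ∘ inj₁ , b ∘ inj₁)
      same-class : ∀ {v v′} → Agree Used′ v v′ → W v ≡ W v′
      same-class {v} {v′} ag = class-ext v v′ λ x → class-eq (ag x)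
        where
        class-eq : ∀ {y z} → y ≡ z ⊎ (¬ Used′ y × ¬ Used′ z) → does (y ≟ c) ≡ does (z ≟ c)
        class-eq (inj₁ refl) = refl
        class-eq {y} {z} (inj₂ (a , b)) with y ≟ c | z ≟ c
        ... | yes p | _     = contradiction (inj₂ p) a
        ... | no _  | yes p = contradiction (inj₂ p) b
        ... | no _  | no _  = refl
        class-ext : ∀ {m} (v v′ : Vec Col m) → (∀ x → does (lookup v x ≟ c) ≡ does (lookup v′ x ≟ c)) →
          Vec.map (λ x → does (x ≟ c)) v ≡ Vec.map (λ x → does (x ≟ c)) v′
        class-ext []      []        eq = refl
        class-ext (y ∷ v) (y′ ∷ v′) eq = cong₂ _∷_ (eq zero) (class-ext v v′ (eq ∘ suc))
      avoid : ∀ v {S x} → S ∈ step h (H v) (W v) → x ∈ˢ S → ¬ Used′ (lookup v x)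
      avoid v S∈ x∈ u with S′ , S′∈ , refl , _ ← ∈-step⁻ h (H v) (W v) S∈ with u
      ... | inj₁ used = avoids S′∈ (fragment-⊆ (H v) (W v) S′ x∈) used
      ... | inj₂ eq   = x∈p─q⇒x∉q (nearest (H v) (W v) S′) (W v) x∈ (∈-class⁺ {v = v} eq)

  -- On average over the colorings, 32 times the number of fragments surviving in failing colorings
  -- is at most (1 - 2^-m) `K`; the `K * N` on the left avoids the subtraction. Lowering the size
  -- bound from 2^(m+1) to 2^m costs at most 2^-(m+1) `K`, so the losses form a geometric series. At
  -- `m` = 0 only empty fragments could remain, and these are covered, so a failing coloring has
  -- none.
  spread-process : ∀ m {Used H} → Process Used (2 ^ m) H → (κ : ℕ → Col) →
    (∀ {i} → i < m → κ i ∈ cols × ¬ Used (κ i)) → (∀ {i j} → κ i ≡ κ j → i ≡ j) →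
    (fail : Vec Col n → Bool) →
    (∀ {v S} → T (fail v) → S ∈ H v → ¬ (∀ {x} → x ∈ˢ S → ∃ λ i → i < m × lookup v x ≡ κ i)) →
    32 * 2 ^ m * ∑ (colorings cols n) (λ v → 𝟙 (fail v) * length (H v)) + K * N ≤ 2 ^ m * (K * N)
  spread-process zero {H = H} P κ κ-ok κ-inj fail uncovered = ≤-reflexive (begin
    32 * ∑ Ω (λ v → 𝟙 (fail v) * length (H v)) + K * N
      ≡⟨ cong (λ z → 32 * z + K * N) (trans (∑-cong Ω vanish) (∑-zero Ω)) ⟩
    K * N
      ≡⟨ *-identityˡ (K * N) ⟨
    1 * (K * N) ∎)
    where
    open ≡-Reasoning
    open Process P
    Ω = colorings cols n
    empty : ∀ {p : Subset n} {x} → ∣ p ∣ < 1 → ¬ x ∈ˢ p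
    empty {p} {x} lt x∈ = <⇒≱ lt (subst (_< ∣ p ∣) (∣⊥∣≡0 n) (p⊂q⇒∣p∣<∣q∣ {p = ⊥} ((λ q∈ → ⊥-elim (∉⊥ q∈)) , x , x∈ , ∉⊥)))
    vanish : ∀ v → 𝟙 (fail v) * length (H v) ≡ 0
    vanish v with fail v in eq | H v in eqH
    ... | false | _     = refl
    ... | true  | []    = refl
    ... | true  | S ∷ _ = ⊥-elim (uncovered (subst T (sym eq) _) S∈ (λ x∈ → ⊥-elim (empty (bounded S∈) x∈)))
      where
      S∈ : S ∈ H v
      S∈ = subst (S ∈_) (sym eqH) (here refl)
  spread-process (suc m) {Used} {H} P κ κ-ok κ-inj fail uncovered = begin
    32 * (2 * 2 ^ m) * ∑ Ω (λ v → 𝟙 (fail v) * length (H v)) + K * N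
      ≤⟨ +-monoˡ-≤ (K * N) (*-monoʳ-≤ (32 * (2 * 2 ^ m)) (≤-trans (∑-mono Ω split) (≤-reflexive (∑-+ Ω _ _)))) ⟩
    32 * (2 * 2 ^ m) * (∑ Ω (λ v → 𝟙 (fail v) * length (H′ v)) + L) + K * N
      ≡⟨ l₁ (2 ^ m) _ L (K * N) ⟩
    2 * (32 * 2 ^ m * ∑ Ω (λ v → 𝟙 (fail v) * length (H′ v))) + 2 * (32 * 2 ^ m) * L + K * N
      ≤⟨ +-monoˡ-≤ (K * N) (+-monoʳ-≤ (2 * (32 * 2 ^ m * ∑ Ω (λ v → 𝟙 (fail v) * length (H′ v))))
           (≤-trans (*-monoˡ-≤ L (*-monoʳ-≤ 2 pow)) (round (m^n>0 2 m)))) ⟩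
    2 * (32 * 2 ^ m * ∑ Ω (λ v → 𝟙 (fail v) * length (H′ v))) + K * N + K * N
      ≡⟨ l₂ (32 * 2 ^ m * ∑ Ω (λ v → 𝟙 (fail v) * length (H′ v))) (K * N) ⟩
    2 * (32 * 2 ^ m * ∑ Ω (λ v → 𝟙 (fail v) * length (H′ v)) + K * N)
      ≤⟨ *-monoʳ-≤ 2 (spread-process m next κ ok′ κ-inj fail uncovered′) ⟩
    2 * (2 ^ m * (K * N))
      ≡⟨ *-assoc 2 (2 ^ m) (K * N) ⟨
    2 * 2 ^ m * (K * N) ∎
    where
    open ≤-Reasoning
    open Round {h = 2 ^ m} P (proj₁ (κ-ok ≤-refl)) (proj₂ (κ-ok {m} ≤-refl))
    Ω = colorings cols n
    H′ : Vec Col n → List (Subset n)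
    H′ v = step (2 ^ m) (H v) (W v)
    L = ∑ Ω (λ v → lost (2 ^ m) (H v) (W v))
    split : ∀ v → 𝟙 (fail v) * length (H v) ≤ 𝟙 (fail v) * length (H′ v) + lost (2 ^ m) (H v) (W v)
    split v with fail v
    ... | false = z≤n
    ... | true  = ≤-reflexive (trans (*-identityˡ _)
      (trans (sym (length-step (2 ^ m) (H v) (W v))) (cong (_+ lost (2 ^ m) (H v) (W v)) (sym (*-identityˡ _)))))
    l₁ : ∀ a b c d → 32 * (2 * a) * (b + c) + d ≡ 2 * (32 * a * b) + 2 * (32 * a) * c + d
    l₁ = solve-∀
    l₂ : ∀ a b → 2 * a + b + b ≡ 2 * (a + b)
    l₂ = solve-∀
    -- The loss decays doubly exponentially in `m`; a single factor `2 ^ m` of it is enough for the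
    -- geometric series.
    pow : 32 * 2 ^ m ≤ 32 ^ (2 ^ m)
    pow = ≤-trans (*-monoʳ-≤ 32 (^-monoˡ-≤ m {2} {32} (s≤s (s≤s z≤n)))) (^-monoʳ-≤ 32 (n<2^n m))
    ok′ : ∀ {i} → i < m → κ i ∈ cols × ¬ (Used (κ i) ⊎ κ i ≡ κ m)
    ok′ {i} i<m = proj₁ (κ-ok (m<n⇒m<1+n i<m)) , λ
      { (inj₁ u)  → proj₂ (κ-ok (m<n⇒m<1+n i<m)) u
      ; (inj₂ eq) → <⇒≢ i<m (κ-inj eq) }
    uncovered′ : ∀ {v S} → T (fail v) → S ∈ H′ v → ¬ (∀ {x} → x ∈ˢ S → ∃ λ i → i < m × lookup v x ≡ κ i)
    uncovered′ {v} f S∈ cov with S′ , S′∈ , refl , _ ← ∈-step⁻ (2 ^ m) (H v) (W v) S∈ =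
      uncovered f (nearest-∈ (H v) (W v) S′∈) λ {x} x∈ → covered x x∈
      where
      covered : ∀ x → x ∈ˢ nearest (H v) (W v) S′ → ∃ λ i → i < suc m × lookup v x ≡ κ i
      covered x x∈ with x ∈? W v
      ... | yes x∈W = m , ≤-refl , ∈-class⁻ {v = v} x∈W
      ... | no  x∉W with i , i<m , eq ← cov (x∈p∧x∉q⇒x∈p─q x∈ x∉W) = i , m<n⇒m<1+n i<m , eq

-- Negative correlation and cross-matchings

Antitone : (Subset n → ℕ) → Set
Antitone φ = ∀ {p q} → p ⊆ q → φ q ≤ φ p

rearrangement : ∀ {a a′ b b′} → a ≤ a′ → b′ ≤ b → a * b + a′ * b′ ≤ a * b′ + a′ * b
rearrangement {a} {a′} {b} {b′} a≤ b≥ with m≤n⇒∃[o]m+o≡n a≤ | m≤n⇒∃[o]m+o≡n b≥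
... | i , refl | j , refl = ≤-trans (m≤m+n _ (i * j)) (≤-reflexive (lemma a i b′ j))
  where
  lemma : ∀ a i b j → a * (b + j) + (a + i) * b + i * j ≡ a * b + (a + i) * (b + j)
  lemma = solve-∀

-- Chebyshev's sum inequality, by summing over all ordered pairs. Opposite ordering is assumed pair
-- by pair because colors carry no order.
chebyshev : ∀ (xs : List A) (f g : A → ℕ) → (∀ x y → f x * g x + f y * g y ≤ f x * g y + f y * g x) →
  length xs * ∑ xs (λ x → f x * g x) ≤ ∑ xs f * ∑ xs g
chebyshev xs f g opp = *-cancelˡ-≤ 2 (begin
  2 * (length xs * S)
    ≡⟨ lemma (length xs * S) ⟩
  length xs * S + length xs * S
    ≡⟨ cong₂ _+_ (trans (cong (length xs *_) refl) (trans (*-comm (length xs) S) (trans (sym (∑-*ʳ xs (length xs) _))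
         (∑-cong xs λ x → trans (*-comm (f x * g x) _) (sym (∑-const xs _)))))) (sym (∑-const xs S)) ⟩
  ∑ xs (λ x → ∑ xs (λ _ → f x * g x)) + ∑ xs (λ _ → S)
    ≡⟨ trans (∑-cong xs (λ x → ∑-+ xs _ _)) (∑-+ xs _ _) ⟨
  ∑ xs (λ x → ∑ xs (λ y → f x * g x + f y * g y))
    ≤⟨ ∑-mono xs (λ x → ∑-mono xs (opp x)) ⟩
  ∑ xs (λ x → ∑ xs (λ y → f x * g y + f y * g x))
    ≡⟨ trans (∑-cong xs (λ x → ∑-+ xs _ _)) (∑-+ xs _ _) ⟩
  ∑ xs (λ x → ∑ xs (λ y → f x * g y)) + ∑ xs (λ x → ∑ xs (λ y → f y * g x))
    ≡⟨ cong₂ _+_ (trans (∑-cong xs (λ x → ∑-*ˡ xs (f x) g)) (∑-*ʳ xs (∑ xs g) f))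
                 (trans (∑-cong xs (λ x → ∑-*ʳ xs (g x) f)) (∑-*ˡ xs (∑ xs f) g)) ⟩
  ∑ xs f * ∑ xs g + ∑ xs f * ∑ xs g
    ≡⟨ lemma (∑ xs f * ∑ xs g) ⟨
  2 * (∑ xs f * ∑ xs g) ∎)
  where
  open ≤-Reasoning
  S = ∑ xs (λ x → f x * g x)
  lemma : ∀ a → 2 * a ≡ a + a
  lemma = solve-∀

∏ : List A → (A → ℕ) → ℕ
∏ []       f = 1
∏ (x ∷ xs) f = f x * ∏ xs f

∏-mono-∈ : ∀ (xs : List A) {f g : A → ℕ} → (∀ {x} → x ∈ xs → f x ≤ g x) → ∏ xs f ≤ ∏ xs g
∏-mono-∈ []       le = ≤-refl
∏-mono-∈ (x ∷ xs) le = *-mono-≤ (le (here refl)) (∏-mono-∈ xs (le ∘ there))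

∏-^ : ∀ b (xs : List A) (e : A → ℕ) → ∏ xs (λ x → b ^ e x) ≡ b ^ ∑ xs e
∏-^ b []       e = refl
∏-^ b (x ∷ xs) e = trans (cong (b ^ e x *_) (∏-^ b xs e)) (sym (^-distribˡ-+-* b (e x) (∑ xs e)))

module NegativeCorrelation {Col : Set} (_≟_ : DecidableEquality Col) (cols : List Col) where
  open Class _≟_

  RecoloredTo : Col → Vec Col n → Vec Col n → Set
  RecoloredTo c u u′ = ∀ x → lookup u′ x ≡ lookup u x ⊎ lookup u′ x ≡ c

  -- A correlation inequality of Harris type, by induction on the coordinates. With the head fixed,
  -- the average of `φ` is smallest and that of `g` largest when the head is `c`, so the two
  -- averages are oppositely ordered as functions of the head.
  negative-correlation : ∀ n c (φ : Subset n → ℕ) → Antitone φ →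
    (g : Vec Col n → ℕ) → (∀ {u u′} → RecoloredTo c u u′ → g u ≤ g u′) →
    length (colorings cols n) * ∑ (colorings cols n) (λ u → φ (class c u) * g u)
      ≤ ∑ (colorings cols n) (φ ∘ class c) * ∑ (colorings cols n) g
  negative-correlation zero c φ anti g up = ≤-reflexive (lemma (φ []) (g []))
    where
    lemma : ∀ a b → a * b + 0 + 0 ≡ (a + 0) * (b + 0)
    lemma = solve-∀
  negative-correlation (suc n) c φ anti g up = begin
    length (colorings cols (suc n)) * ∑ (colorings cols (suc n)) (λ u → φ (class c u) * g u)
      ≡⟨ cong₂ _*_ (trans (length-colorings cols (suc n)) (cong (length cols *_) (sym (length-colorings cols n)))) (∑-colorings cols n _) ⟩
    length cols * N * ∑ cols (λ x → ∑ Ω (λ v → φ (b x ∷ class c v) * g (x ∷ v)))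
      ≡⟨ trans (*-assoc (length cols) N _) (cong (length cols *_) (sym (∑-*ˡ cols N _))) ⟩
    length cols * ∑ cols (λ x → N * ∑ Ω (λ v → φ (b x ∷ class c v) * g (x ∷ v)))
      ≤⟨ *-monoʳ-≤ (length cols) (∑-mono cols λ x →
           negative-correlation n c (φ ∘ (b x ∷_)) (anti ∘ s⊆s) (g ∘ (x ∷_)) (λ re → up (extend re))) ⟩
    length cols * ∑ cols (λ x → P x * Q x)
      ≤⟨ chebyshev cols P Q opposite ⟩
    ∑ cols P * ∑ cols Q
      ≡⟨ cong₂ _*_ (∑-colorings cols n _) (∑-colorings cols n g) ⟨
    ∑ (colorings cols (suc n)) (φ ∘ class c) * ∑ (colorings cols (suc n)) g ∎
    where
    open ≤-Reasoning
    Ω = colorings cols n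
    N = length Ω
    b = λ x → does (x ≟ c)
    P = λ x → ∑ Ω (λ v → φ (b x ∷ class c v))
    Q = λ x → ∑ Ω (λ v → g (x ∷ v))
    extend : ∀ {x u u′} → RecoloredTo {n} c u u′ → RecoloredTo c (x ∷ u) (x ∷ u′)
    extend re zero    = inj₁ refl
    extend re (suc i) = re i
    head-to-c : ∀ {y u} → RecoloredTo {suc n} c (y ∷ u) (c ∷ u)
    head-to-c zero    = inj₂ refl
    head-to-c (suc i) = inj₁ refl
    Q-≤ : ∀ y → Q y ≤ Q c
    Q-≤ y = ∑-mono Ω (λ v → up head-to-c)
    opposite : ∀ x y → P x * Q x + P y * Q y ≤ P x * Q y + P y * Q x
    opposite x y with x ≟ c | y ≟ c
    ... | yes refl | yes refl = ≤-refl
    -- Both heads leave the class of `c` unchanged, so the averages of `φ` agree and the order of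
    -- those of `g` does not matter.
    ... | no _     | no _     = ≤-reflexive (+-comm (R * Q x) (R * Q y))
      where R = ∑ Ω (λ v → φ (false ∷ class c v))
    ... | yes refl | no _     = rearrangement (∑-mono Ω (λ v → anti (out⊆ id))) (Q-≤ y)
    ... | no _     | yes refl = ≤-trans (≤-reflexive (+-comm (R * Q x) (S * Q y)))
      (≤-trans (rearrangement (∑-mono Ω (λ v → anti (out⊆ id))) (Q-≤ x)) (≤-reflexive (+-comm (S * Q x) (R * Q y))))
      where
      R = ∑ Ω (λ v → φ (false ∷ class c v))
      S = ∑ Ω (λ v → φ (true ∷ class c v))

  -- One color is split off at a time: moving elements to `c` only shrinks the classes of the other
  -- colors, so the product over those can only grow, as negative correlation demands.
  ∏-class-≤ : ∀ {n} (φ : Subset n → ℕ) → Antitone φ → .{{NonZero (length (colorings cols n))}} →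
    (cs : List Col) → Unique cs → ∀ b →
    (∀ {c} → c ∈ cs → ∑ (colorings cols n) (φ ∘ class c) ≤ b * length (colorings cols n)) →
    ∑ (colorings cols n) (λ u → ∏ cs (λ c → φ (class c u))) ≤ b ^ length cs * length (colorings cols n)
  ∏-class-≤ {n} φ anti [] u b mean = ≤-reflexive (trans (sym (length≡∑1 (colorings cols n))) (sym (*-identityˡ _)))
  ∏-class-≤ {n} φ anti (c ∷ cs) (c∉ ∷ uniq) b mean = *-cancelˡ-≤ N (begin
    N * ∑ Ω (λ u → φ (class c u) * ∏ cs (λ c′ → φ (class c′ u)))
      ≤⟨ negative-correlation n c φ anti (λ u → ∏ cs (λ c′ → φ (class c′ u))) up ⟩
    ∑ Ω (φ ∘ class c) * ∑ Ω (λ u → ∏ cs (λ c′ → φ (class c′ u)))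
      ≤⟨ *-mono-≤ (mean (here refl)) (∏-class-≤ φ anti cs uniq b (mean ∘ there)) ⟩
    b * N * (b ^ length cs * N)
      ≡⟨ lemma b N (b ^ length cs) ⟩
    N * (b * b ^ length cs * N) ∎)
    where
    open ≤-Reasoning
    Ω = colorings cols n
    N = length Ω
    lemma : ∀ b n p → b * n * (p * n) ≡ n * (b * p * n)
    lemma = solve-∀
    up : ∀ {u u′} → RecoloredTo c u u′ → ∏ cs (λ c′ → φ (class c′ u)) ≤ ∏ cs (λ c′ → φ (class c′ u′))
    up {u} {u′} re = ∏-mono-∈ cs λ {c′} c′∈ → anti λ {x} x∈ → shrink c′∈ (re x) x∈
      where
      shrink : ∀ {c′ x} → c′ ∈ cs → lookup u′ x ≡ lookup u x ⊎ lookup u′ x ≡ c → x ∈ˢ class c′ u′ → x ∈ˢ class c′ u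
      shrink c′∈ (inj₁ eq) x∈ = ∈-class⁺ {v = u} (trans (sym eq) (∈-class⁻ {v = u′} x∈))
      shrink c′∈ (inj₂ eq) x∈ = contradiction (trans (sym eq) (∈-class⁻ {v = u′} x∈)) (All.lookup c∉ c′∈)

  -- Markov's inequality for 16 ^ (number of failing colors).
  many-failures : ∀ {n} s → length cols ≡ 2 * s → Unique cols → .{{NonZero (length (colorings cols n))}} →
    (fails : Subset n → Bool) → (∀ {p q} → p ⊆ q → T (fails q) → T (fails p)) →
    (∀ {c} → c ∈ cols → 16 * ∑ (colorings cols n) (λ u → 𝟙 (fails (class c u))) ≤ length (colorings cols n)) →
    4 ^ s * ∑ (colorings cols n) (λ u → 𝟙 (does (s <? ∑ cols (λ c → 𝟙 (fails (class c u)))))) ≤ length (colorings cols n)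
  many-failures {n} s len uniq fails anti rare = *-cancelˡ-≤ (4 ^ s) {{m^n≢0 4 s}} (begin
    4 ^ s * (4 ^ s * ∑ Ω bad)          ≡⟨ *-assoc (4 ^ s) (4 ^ s) _ ⟨
    4 ^ s * 4 ^ s * ∑ Ω bad            ≡⟨ cong (_* ∑ Ω bad) (^-distribʳ-* 4 4 s) ⟨
    16 ^ s * ∑ Ω bad                   ≡⟨ ∑-*ˡ Ω (16 ^ s) bad ⟨
    ∑ Ω (λ u → 16 ^ s * bad u)         ≤⟨ ∑-mono Ω markov ⟩
    ∑ Ω (λ u → 16 ^ count u)           ≡⟨ ∑-cong Ω (λ u → sym (∏-^ 16 cols _)) ⟩
    ∑ Ω (λ u → ∏ cols (λ c → φ (class c u)))
      ≤⟨ ∏-class-≤ φ (λ {p} {q} p⊆q → ^-monoʳ-≤ 16 (𝟙-mono (fails q) (fails p) (anti p⊆q))) cols uniq 2 mean ⟩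
    2 ^ length cols * N                ≡⟨ cong (λ l → 2 ^ l * N) len ⟩
    2 ^ (2 * s) * N                    ≡⟨ cong (_* N) (^-*-assoc 2 2 s) ⟨
    4 ^ s * N ∎)
    where
    open ≤-Reasoning
    Ω = colorings cols n
    N = length Ω
    φ = λ p → 16 ^ 𝟙 (fails p)
    count = λ u → ∑ cols (λ c → 𝟙 (fails (class c u)))
    bad = λ u → 𝟙 (does (s <? count u))
    markov : ∀ u → 16 ^ s * bad u ≤ 16 ^ count u
    markov u = *𝟙-≤ (does (s <? count u)) (λ t → ^-monoʳ-≤ 16 (<⇒≤ (T-does⁻ (s <? count u) t)))
    φ-≤ : ∀ b → 16 ^ 𝟙 b ≤ 1 + 16 * 𝟙 b
    φ-≤ true  = m≤n+m 16 1
    φ-≤ false = ≤-refl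
    -- A failure has probability at most 1/16 and adds at most 16, so each color contributes a
    -- factor 2. The `2 * s` colors give `4 ^ s`, against the threshold `16 ^ s`.
    mean : ∀ {c} → c ∈ cols → ∑ Ω (φ ∘ class c) ≤ 2 * N
    mean {c} c∈ = begin
      ∑ Ω (φ ∘ class c)                                   ≤⟨ ∑-mono Ω (λ u → φ-≤ (fails (class c u))) ⟩
      ∑ Ω (λ u → 1 + 16 * 𝟙 (fails (class c u)))          ≡⟨ ∑-+ Ω (λ _ → 1) _ ⟩
      ∑ Ω (λ _ → 1) + ∑ Ω (λ u → 16 * 𝟙 (fails (class c u)))
        ≡⟨ cong₂ _+_ (sym (length≡∑1 Ω)) (∑-*ˡ Ω 16 _) ⟩
      N + 16 * ∑ Ω (λ u → 𝟙 (fails (class c u)))          ≤⟨ +-monoʳ-≤ N (rare c∈) ⟩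
      N + N                                               ≡⟨ cong (N +_) (+-identityʳ N) ⟨
      2 * N ∎

∑-cartesianProduct : ∀ (xs : List A) (ys : List B) (f : A × B → ℕ) →
  ∑ (cartesianProduct xs ys) f ≡ ∑ xs (λ x → ∑ ys (λ y → f (x , y)))
∑-cartesianProduct []       ys f = refl
∑-cartesianProduct (x ∷ xs) ys f = trans (∑-++ (map (x ,_) ys) (cartesianProduct xs ys) f)
  (cong₂ _+_ (∑-map (x ,_) ys f) (∑-cartesianProduct xs ys f))

length-cartesianProduct : ∀ (xs : List A) (ys : List B) → length (cartesianProduct xs ys) ≡ length xs * length ys
length-cartesianProduct xs ys = trans (length≡∑1 (cartesianProduct xs ys)) (trans (∑-cartesianProduct xs ys _)
  (trans (∑-const xs _) (cong (length xs *_) (sym (length≡∑1 ys)))))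

∑-colorings-proj₁ : ∀ (xs : List A) (ys : List B) n (f : Vec A n → ℕ) →
  ∑ (colorings (cartesianProduct xs ys) n) (f ∘ Vec.map proj₁) ≡ length ys ^ n * ∑ (colorings xs n) f
∑-colorings-proj₁ xs ys zero    f = sym (*-identityˡ _)
∑-colorings-proj₁ xs ys (suc n) f = begin
  ∑ (colorings (cartesianProduct xs ys) (suc n)) (f ∘ Vec.map proj₁)
    ≡⟨ ∑-colorings (cartesianProduct xs ys) n _ ⟩
  ∑ (cartesianProduct xs ys) (λ z → ∑ (colorings (cartesianProduct xs ys) n) (λ v → f (proj₁ z ∷ Vec.map proj₁ v)))
    ≡⟨ ∑-cartesianProduct xs ys _ ⟩
  ∑ xs (λ x → ∑ ys (λ y → ∑ (colorings (cartesianProduct xs ys) n) (λ v → f (x ∷ Vec.map proj₁ v))))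
    ≡⟨ ∑-cong xs (λ x → trans (∑-const ys _) (cong (length ys *_) (∑-colorings-proj₁ xs ys n (f ∘ (x ∷_))))) ⟩
  ∑ xs (λ x → length ys * (length ys ^ n * ∑ (colorings xs n) (λ v → f (x ∷ v))))
    ≡⟨ ∑-cong xs (λ x → sym (*-assoc (length ys) (length ys ^ n) _)) ⟩
  ∑ xs (λ x → length ys ^ suc n * ∑ (colorings xs n) (λ v → f (x ∷ v)))
    ≡⟨ ∑-*ˡ xs (length ys ^ suc n) _ ⟩
  length ys ^ suc n * ∑ xs (λ x → ∑ (colorings xs n) (λ v → f (x ∷ v)))
    ≡⟨ cong (length ys ^ suc n *_) (∑-colorings xs n f) ⟨
  length ys ^ suc n * ∑ (colorings xs (suc n)) f ∎
  where open ≡-Reasoning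

missing? : List (Subset n) → Subset n → Bool
missing? G p = does (¬? (any? (_⊆? p) G))

module _ {Col : Set} (_≟_ : DecidableEquality Col) (cols : List Col) where
  open Class _≟_

  -- Sets smaller than `2 ^ L` are used up by `L` halvings, each exposing one shade `(c , i)`;
  -- together these shades form the class of `c`. The refined palette has `length cols * L` colors,
  -- whence the spread constant, and `K ≤ 2 * length G` turns 32 into 16.
  spread-lemma : ∀ {n} (G : List (Subset n)) K L → 1 ≤ L →
    (∀ {S} → S ∈ G → ∣ S ∣ < 2 ^ L) →
    (∀ X → degree G X * (128 * (length cols * L)) ^ ∣ X ∣ ≤ K) →
    1 ≤ length G → K ≤ 2 * length G → ∀ {c} → c ∈ cols →
    16 * ∑ (colorings cols n) (λ u → 𝟙 (missing? G (class c u))) ≤ length (colorings cols n)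
  spread-lemma {n} G K L 1≤L small degs nonempty K≤ {c} c∈ =
    arithmetic (length G) (L ^ n) (∑ Ω miss) (length Ω) nonempty (m^n>0 L {{>-nonZero 1≤L}} n)
      (≤-trans (≤-reflexive (cong (32 *_) (sym fiber))) (≤-trans failures
        (≤-trans (*-monoˡ-≤ (length Ω′) K≤) (≤-reflexive (cong (2 * length G *_) length-Ω′)))))
    where
    Ω = colorings cols n
    cols′ = cartesianProduct cols (upTo L)
    Ω′ = colorings cols′ n
    miss : Vec Col n → ℕ
    miss u = 𝟙 (missing? G (class c u))
    length-cols′ : length cols′ ≡ length cols * L
    length-cols′ = trans (length-cartesianProduct cols (upTo L)) (cong (length cols *_) (length-upTo L))
    length-Ω′ : length Ω′ ≡ L ^ n * length Ω
    length-Ω′ = trans (length-colorings cols′ n) (trans (cong (_^ n) length-cols′)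
      (trans (^-distribʳ-* (length cols) L n) (trans (*-comm _ (L ^ n)) (cong (L ^ n *_) (sym (length-colorings cols n))))))
    fail : Vec (Col × ℕ) n → Bool
    fail v = missing? G (class c (Vec.map proj₁ v))
    arithmetic : ∀ g l x y → 1 ≤ g → 1 ≤ l → 32 * (l * x * g) ≤ 2 * g * (l * y) → 16 * x ≤ y
    arithmetic g l x y 1≤g 1≤l le = *-cancelˡ-≤ (2 * g * l) {{m*n≢0 (2 * g) l {{m*n≢0 2 g {{_}} {{>-nonZero 1≤g}}}} {{>-nonZero 1≤l}}}}
      (≤-trans (≤-reflexive (l₁ g l x)) (≤-trans le (≤-reflexive (l₂ g l y))))
      where
      l₁ : ∀ g l x → 2 * g * l * (16 * x) ≡ 32 * (l * x * g)
      l₁ = solve-∀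
      l₂ : ∀ g l y → 2 * g * (l * y) ≡ 2 * g * l * y
      l₂ = solve-∀
    fiber : ∑ Ω′ (λ v → 𝟙 (fail v) * length G) ≡ L ^ n * ∑ Ω miss * length G
    fiber = trans (∑-*ʳ Ω′ (length G) (λ v → 𝟙 (fail v))) (cong (_* length G)
      (trans (∑-colorings-proj₁ cols (upTo L) n miss) (cong (λ l → l ^ n * ∑ Ω miss) (length-upTo L))))
    _≟′_ : DecidableEquality (Col × ℕ)
    _≟′_ = ≡-dec _≟_ Data.Nat._≟_
    module S = Spread _≟′_ cols′ (degree G) K
      (λ X → subst (λ l → degree G X * (128 * l) ^ ∣ X ∣ ≤ K) (sym length-cols′) (degs X))
    process : S.Process (λ _ → Void) (2 ^ L) (λ _ → G)
    process = record { local = λ _ → refl ; avoids = λ _ _ () ; bounded = small ; degrees = λ _ _ → ≤-refl }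
    uncovered : ∀ {v R} → T (fail v) → R ∈ G → ¬ (∀ {x} → x ∈ˢ R → ∃ λ i → i < L × lookup v x ≡ (c , i))
    uncovered {v} f R∈ cov = T-does⁻ (¬? (any? (_⊆? class c (Vec.map proj₁ v)) G)) f
      (lose R∈ λ {x} x∈ → ∈-class⁺ {v = Vec.map proj₁ v} (let _ , _ , eq = cov x∈ in trans (lookup-map x proj₁ v) (cong proj₁ eq)))
    cancel : ∀ p x y → 1 ≤ p → 32 * p * x + y ≤ p * y → 32 * x ≤ y
    cancel p x y 1≤p le = *-cancelˡ-≤ p {{>-nonZero 1≤p}} (≤-trans (≤-reflexive (l₁ p x)) (≤-trans (m≤m+n _ y) le))
      where
      l₁ : ∀ p x → p * (32 * x) ≡ 32 * p * x
      l₁ = solve-∀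
    failures : 32 * ∑ Ω′ (λ v → 𝟙 (fail v) * length G) ≤ K * length Ω′
    failures = cancel (2 ^ L) (∑ Ω′ (λ v → 𝟙 (fail v) * length G)) (K * length Ω′) (m^n>0 2 L)
      (S.spread-process L process (c ,_)
        (λ i<L → ∈-cartesianProduct⁺ c∈ (∈-upTo⁺ i<L) , λ ()) (λ { refl → refl }) fail (λ {v} → uncovered {v}))

-- `bound` stands for the size of a whole link of which the list keeps at least half: restricting a
-- family preserves upper bounds on degrees, but not their ratio to its own size.
record SpreadList (s L : ℕ) (G : List (Subset n)) : Set where
  field
    bound      : ℕ
    sizes      : ∀ {S} → S ∈ G → ∣ S ∣ < 2 ^ L
    degrees    : ∀ X → degree G X * (128 * (2 * s * L)) ^ ∣ X ∣ ≤ bound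
    nonempty   : 1 ≤ length G
    comparable : bound ≤ 2 * length G

module _ {s L n : ℕ} (1≤s : 1 ≤ s) (1≤L : 1 ≤ L) {I : Set} (G : I → List (Subset n)) where

  private
    M = 2 * s
    cols = allFin M
    Ω = colorings cols n
  open Class (Fin._≟_ {M})

  private
    failures : Vec (Fin M) n → I → ℕ
    failures u i = ∑ cols (λ c → 𝟙 (missing? (G i) (class c u)))

  good-coloring : (is : List I) → length is ≤ s → All (λ i → SpreadList s L (G i)) is →
    ∃ λ u → All (λ i → failures u i ≤ s) is
  good-coloring is len ok = finish (∑<length⇒∃0 Ω bad few)
    where
    open ≤-Reasoning
    length-cols : length cols ≡ M
    length-cols = length-tabulate id
    bad : Vec (Fin M) n → ℕ
    bad u = ∑ is (λ i → 𝟙 (does (s <? failures u i)))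
    nz : NonZero (length Ω)
    nz = subst NonZero (sym (trans (length-colorings cols n) (cong (_^ n) length-cols)))
      (m^n≢0 M n {{>-nonZero (≤-trans 1≤s (m≤m+n s _))}})
    per-i : ∀ {i} → i ∈ is → 4 ^ s * ∑ Ω (λ u → 𝟙 (does (s <? failures u i))) ≤ length Ω
    per-i {i} i∈ = NegativeCorrelation.many-failures Fin._≟_ cols s length-cols (Unique.allFin⁺ M) {{nz}}
      (missing? (G i))
      (λ {p} {q} p⊆q f → T-does⁺ (¬? (any? (_⊆? p) (G i))) λ ex →
        T-does⁻ (¬? (any? (_⊆? q) (G i))) f (Any.map (λ S⊆p {x} x∈ → p⊆q (S⊆p x∈)) ex))
      (λ c∈ → spread-lemma Fin._≟_ cols (G i) bound L 1≤L sizes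
        (λ X → subst (λ l → degree (G i) X * (128 * (l * L)) ^ ∣ X ∣ ≤ bound) (sym length-cols) (degrees X))
        nonempty comparable c∈)
      where open SpreadList (All.lookup ok i∈)
    -- The union bound over at most `s` families succeeds because `s < 4 ^ s`.
    few : ∑ Ω bad < length Ω
    few = *-cancelˡ-< (4 ^ s) _ _ (begin-strict
      4 ^ s * ∑ Ω bad
        ≡⟨ cong (4 ^ s *_) (∑-swap Ω is _) ⟩
      4 ^ s * ∑ is (λ i → ∑ Ω (λ u → 𝟙 (does (s <? failures u i))))
        ≡⟨ ∑-*ˡ is (4 ^ s) _ ⟨
      ∑ is (λ i → 4 ^ s * ∑ Ω (λ u → 𝟙 (does (s <? failures u i))))
        ≤⟨ ∑-mono-∈ is per-i ⟩
      ∑ is (λ i → length Ω)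
        ≡⟨ ∑-const is _ ⟩
      length is * length Ω
        <⟨ *-monoˡ-< (length Ω) {{nz}} (≤-trans (s≤s len) (n<4^n s)) ⟩
      4 ^ s * length Ω ∎)
    finish : (∃ λ u → u ∈ Ω × bad u ≡ 0) → ∃ λ u → All (λ i → failures u i ≤ s) is
    finish (u , _ , bad≡0) = u , All.tabulate λ {i} i∈ → ≮⇒≥ λ lt →
      <⇒≱ (≤-trans (≤-reflexive (sym (T⇒𝟙 (T-does⁺ (s <? failures u i) lt))))
        (∑-term (λ i → 𝟙 (does (s <? failures u i))) i∈)) (≤-reflexive bad≡0)

  -- At least `s` of the `2 * s` colors succeed for `i`, and fewer than `s` are taken.
  available-color : ∀ {u i} → failures u i ≤ s → (used : List (Fin M)) → length used < s →
    ∃ λ c → c ∉ used × ∃ λ Y → Y ∈ G i × Y ⊆ class c u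
  available-color {u} {i} few used lt = search (any? (λ c → ¬? (DecMembership._∈?_ Fin._≟_ c used)) good)
    where
    open ≤-Reasoning
    good? = λ c → any? (_⊆? class c u) (G i)
    good = filter good? cols
    enough : s ≤ length good
    enough = +-cancelʳ-≤ s s (length good) (begin
      s + s                                      ≡⟨ cong (s +_) (+-identityʳ s) ⟨
      M                                          ≡⟨ length-tabulate {n = M} id ⟨
      length cols                                ≡⟨ length≡∑1 cols ⟩
      ∑ cols (λ _ → 1)                           ≡⟨ ∑-cong cols (λ c → sym (𝟙-not (does (good? c)))) ⟩
      ∑ cols (λ c → 𝟙 (does (good? c)) + 𝟙 (not (does (good? c)))) ≡⟨ ∑-+ cols _ _ ⟩
      ∑ cols (λ c → 𝟙 (does (good? c))) + failures u i
        ≡⟨ cong (_+ failures u i) (length-filter good? cols) ⟨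
      length good + failures u i                 ≤⟨ +-monoʳ-≤ (length good) few ⟩
      length good + s ∎)
    search : Dec (Any (λ c → c ∉ used) good) → ∃ λ c → c ∉ used × ∃ λ Y → Y ∈ G i × Y ⊆ class c u
    search (yes ex) with c , c∈ , c∉ ← find ex with Y , Y∈ , Y⊆ ← find (proj₂ (∈-filter⁻ good? {xs = cols} c∈)) =
      c , c∉ , Y , Y∈ , Y⊆
    search (no none) = contradiction (≤-trans enough (unique-⊆-length (Unique.filter⁺ good? (Unique.allFin⁺ M)) all-used)) (<⇒≱ lt)
      where
      all-used : ∀ {c} → c ∈ good → c ∈ used
      all-used {c} c∈ with DecMembership._∈?_ Fin._≟_ c used
      ... | yes p = p
      ... | no ¬p = contradiction (lose c∈ ¬p) none

  -- The result records that every chosen set lies in a class whose color is outside `used`: this is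
  -- what separates the later sets from the one chosen at the head.
  greedy : ∀ u is → All (λ i → failures u i ≤ s) is → (used : List (Fin M)) → length used + length is ≤ s →
    ∃ λ (ms : List (I × Subset n)) → map proj₁ ms ≡ is × All (λ m → proj₂ m ∈ G (proj₁ m)) ms ×
      All (λ m → ∃ λ c → c ∉ used × proj₂ m ⊆ class c u) ms × AllPairs (Disjoint on proj₂) ms
  greedy u []       few        used le = [] , refl , [] , [] , []
  greedy u (i ∷ is) (f ∷ few) used le
    with c , c∉ , Y , Y∈ , Y⊆ ← available-color {u} {i} f used
      (≤-trans (s≤s (m≤m+n _ (length is))) (≤-trans (≤-reflexive (sym (+-suc _ _))) le))
    with ms , eq , ∈G , cl , disj ← greedy u is few (c ∷ used) (≤-trans (≤-reflexive (sym (+-suc _ _))) le)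
    = (i , Y) ∷ ms , cong (i ∷_) eq , Y∈ ∷ ∈G
    , (c , c∉ , Y⊆) ∷ All.map (λ {m} → weaken {m}) cl
    , All.map (λ {m} → apart {m}) cl ∷ disj
    where
    weaken : ∀ {m : I × Subset n} → (∃ λ c′ → c′ ∉ c ∷ used × proj₂ m ⊆ class c′ u) →
      ∃ λ c′ → c′ ∉ used × proj₂ m ⊆ class c′ u
    weaken (c′ , c′∉ , sub) = c′ , c′∉ ∘ there , λ {x} → sub {x}
    apart : ∀ {m : I × Subset n} → (∃ λ c′ → c′ ∉ c ∷ used × proj₂ m ⊆ class c′ u) → Disjoint Y (proj₂ m)
    apart {m} (c′ , c′∉ , sub) (x , x∈) with x∈Y , x∈m ← x∈p∩q⁻ Y (proj₂ m) x∈ =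
      c′∉ (here (trans (sym (∈-class⁻ {v = u} (sub x∈m))) (∈-class⁻ {v = u} (Y⊆ x∈Y))))

  cross-matching : (is : List I) → length is ≤ s → All (λ i → SpreadList s L (G i)) is →
    ∃ λ (ms : List (I × Subset n)) → map proj₁ ms ≡ is × All (λ m → proj₂ m ∈ G (proj₁ m)) ms ×
      AllPairs (Disjoint on proj₂) ms
  cross-matching is len ok =
    let u , few = good-coloring is len ok
        ms , eq , ∈G , _ , disj = greedy u is few [] len
    in ms , eq , ∈G , disj

-- Arithmetic of subsets

∪-─-cancel : ∀ {F X : Subset n} → X ⊆ F → (F ─ X) ∪ X ≡ F
∪-─-cancel {F = F} {X} X⊆F = ⊆-antisym to from
  where
  to : (F ─ X) ∪ X ⊆ F
  to x∈ with x∈p∪q⁻ (F ─ X) X x∈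
  ... | inj₁ x∈F─X = p─q⊆p F X x∈F─X
  ... | inj₂ x∈X   = X⊆F x∈X
  from : F ⊆ (F ─ X) ∪ X
  from {x} x∈ with x ∈? X
  ... | yes x∈X = x∈p∪q⁺ (inj₂ x∈X)
  ... | no  x∉X = x∈p∪q⁺ (inj₁ (x∈p∧x∉q⇒x∈p─q x∈ x∉X))

disjoint-sym : ∀ {p q : Subset n} → Disjoint p q → Disjoint q p
disjoint-sym {p = p} {q} d (x , x∈) = d (x , subst (x ∈ˢ_) (∩-comm q p) x∈)

∣p∪q∣≤∣p∣+∣q∣ : (p q : Subset n) → ∣ p ∪ q ∣ ≤ ∣ p ∣ + ∣ q ∣
∣p∪q∣≤∣p∣+∣q∣ []            []            = z≤n
∣p∪q∣≤∣p∣+∣q∣ (outside ∷ p) (outside ∷ q) = ∣p∪q∣≤∣p∣+∣q∣ p q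
∣p∪q∣≤∣p∣+∣q∣ (outside ∷ p) (inside ∷ q)  = ≤-trans (s≤s (∣p∪q∣≤∣p∣+∣q∣ p q)) (≤-reflexive (sym (+-suc _ _)))
∣p∪q∣≤∣p∣+∣q∣ (inside ∷ p)  (outside ∷ q) = s≤s (∣p∪q∣≤∣p∣+∣q∣ p q)
∣p∪q∣≤∣p∣+∣q∣ (inside ∷ p)  (inside ∷ q)  = s≤s (≤-trans (∣p∪q∣≤∣p∣+∣q∣ p q) (+-monoʳ-≤ ∣ p ∣ (n≤1+n _)))

disjoint⇒∣p∪q∣≡∣p∣+∣q∣ : (p q : Subset n) → Disjoint p q → ∣ p ∪ q ∣ ≡ ∣ p ∣ + ∣ q ∣
disjoint⇒∣p∪q∣≡∣p∣+∣q∣ []            []            d = refl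
disjoint⇒∣p∪q∣≡∣p∣+∣q∣ (outside ∷ p) (outside ∷ q) d =
  disjoint⇒∣p∪q∣≡∣p∣+∣q∣ p q (λ (x , x∈) → d (suc x , Vec.there x∈))
disjoint⇒∣p∪q∣≡∣p∣+∣q∣ (outside ∷ p) (inside ∷ q)  d =
  trans (cong suc (disjoint⇒∣p∪q∣≡∣p∣+∣q∣ p q (λ (x , x∈) → d (suc x , Vec.there x∈)))) (sym (+-suc _ _))
disjoint⇒∣p∪q∣≡∣p∣+∣q∣ (inside ∷ p)  (outside ∷ q) d =
  cong suc (disjoint⇒∣p∪q∣≡∣p∣+∣q∣ p q (λ (x , x∈) → d (suc x , Vec.there x∈)))
disjoint⇒∣p∪q∣≡∣p∣+∣q∣ (inside ∷ p)  (inside ∷ q)  d = ⊥-elim (d (zero , Vec.here))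

elements : Subset n → List (Fin n)
elements []            = []
elements (inside ∷ p)  = zero ∷ map suc (elements p)
elements (outside ∷ p) = map suc (elements p)

length-elements : (p : Subset n) → length (elements p) ≡ ∣ p ∣
length-elements []            = refl
length-elements (inside ∷ p)  = cong suc (trans (length-map suc (elements p)) (length-elements p))
length-elements (outside ∷ p) = trans (length-map suc (elements p)) (length-elements p)

∈-elements : ∀ {p : Subset n} {x} → x ∈ˢ p → x ∈ elements p
∈-elements {p = inside ∷ p}  Vec.here       = here refl
∈-elements {p = inside ∷ p}  (Vec.there x∈) = there (∈-map⁺ suc (∈-elements x∈))
∈-elements {p = outside ∷ p} (Vec.there x∈) = ∈-map⁺ suc (∈-elements x∈)

-- Families and their links

allSubsets-unique : ∀ n → Unique (allSubsets n)
allSubsets-unique zero    = [] ∷ []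
allSubsets-unique (suc n) = Unique.++⁺
  (Unique.map⁺ ∷-injectiveʳ (allSubsets-unique n)) (Unique.map⁺ ∷-injectiveʳ (allSubsets-unique n)) apart
  where
  apart : ∀ {X} → ¬ (X ∈ map (outside ∷_) (allSubsets n) × X ∈ map (inside ∷_) (allSubsets n))
  apart (o , i) with _ , _ , refl ← ∈-map⁻ (outside ∷_) o with _ , _ , () ← ∈-map⁻ (inside ∷_) i

members-unique : (𝓖 : Family n) → Unique (members 𝓖)
members-unique 𝓖 = Unique.filter⁺ (T? ∘ 𝓖) (allSubsets-unique _)

∈-members⁺ : (𝓖 : Family n) → ∀ {X} → X ∈ᶠ 𝓖 → X ∈ members 𝓖
∈-members⁺ 𝓖 {X} X∈ = ∈-filter⁺ (T? ∘ 𝓖) (∈-allSubsets X) X∈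

∈-members⁻ : (𝓖 : Family n) → ∀ {X} → X ∈ members 𝓖 → X ∈ᶠ 𝓖
∈-members⁻ 𝓖 X∈ = proj₂ (∈-filterᵇ⁻ 𝓖 (allSubsets _) X∈)

unique-map : ∀ (f : A → B) {xs} → Unique xs → (∀ {x y} → x ∈ xs → y ∈ xs → f x ≡ f y → x ≡ y) → Unique (map f xs)
unique-map f []        inj = []
unique-map f {x ∷ xs} (x∉ ∷ u) inj =
  All.map⁺ (All.tabulate λ y∈ eq → All.lookup x∉ y∈ (inj (here refl) (there y∈) eq)) ∷
  unique-map f u (λ x∈ y∈ → inj (there x∈) (there y∈))

card-injection : ∀ {𝓖 𝓗 : Family n} (f : Subset n → Subset n) → (∀ {X} → X ∈ᶠ 𝓖 → f X ∈ᶠ 𝓗) →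
  (∀ {X Y} → X ∈ᶠ 𝓖 → Y ∈ᶠ 𝓖 → f X ≡ f Y → X ≡ Y) → card 𝓖 ≤ card 𝓗
card-injection {𝓖 = 𝓖} {𝓗} f into inj = subst (_≤ card 𝓗) (length-map f (members 𝓖))
  (unique-⊆-length (unique-map f (members-unique 𝓖) (λ x∈ y∈ → inj (∈-members⁻ 𝓖 x∈) (∈-members⁻ 𝓖 y∈))) image)
  where
  image : ∀ {Y} → Y ∈ map f (members 𝓖) → Y ∈ members 𝓗
  image Y∈ with X , X∈ , refl ← ∈-map⁻ f Y∈ = ∈-members⁺ 𝓗 (into (∈-members⁻ 𝓖 X∈))

card-mono : ∀ {𝓖 𝓗 : Family n} → 𝓖 ⊆ᶠ 𝓗 → card 𝓖 ≤ card 𝓗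
card-mono {𝓖 = 𝓖} {𝓗} sub = card-injection {𝓖 = 𝓖} {𝓗} id (λ {X} → sub X) (λ _ _ eq → eq)

card-strict : ∀ {𝓖 𝓗 : Family n} → 𝓖 ⊆ᶠ 𝓗 → ∀ {X} → X ∈ᶠ 𝓗 → ¬ X ∈ᶠ 𝓖 → card 𝓖 < card 𝓗
card-strict {𝓖 = 𝓖} {𝓗} sub {X} X∈ X∉ = unique-⊆-length {xs = X ∷ members 𝓖}
  (All.tabulate (λ {Y} Y∈ eq → X∉ (subst (_∈ᶠ 𝓖) (sym eq) (∈-members⁻ 𝓖 Y∈))) ∷ members-unique 𝓖)
  λ { (here refl) → ∈-members⁺ 𝓗 X∈ ; (there Y∈) → ∈-members⁺ 𝓗 (sub _ (∈-members⁻ 𝓖 Y∈)) }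

card-nonempty⁺ : ∀ {𝓖 : Family n} {X} → X ∈ᶠ 𝓖 → 1 ≤ card 𝓖
card-nonempty⁺ {𝓖 = 𝓖} X∈ with members 𝓖 | ∈-members⁺ 𝓖 X∈
... | _ ∷ _ | _ = s≤s z≤n

card-nonempty⁻ : ∀ {𝓖 : Family n} → 1 ≤ card 𝓖 → NonemptyFamily 𝓖
card-nonempty⁻ {𝓖 = 𝓖} le = first (members 𝓖) (∈-members⁻ 𝓖) le
  where
  first : ∀ xs → (∀ {X} → X ∈ xs → X ∈ᶠ 𝓖) → 1 ≤ length xs → NonemptyFamily 𝓖
  first (X ∷ _) sub _ = X , sub (here refl)

∈-link⁻ : ∀ (𝓕 : Family n) {X Y} → Y ∈ᶠ 𝓕 ⟨ X ⟩ → ∃ λ F → F ∈ᶠ 𝓕 × X ⊆ F × Y ≡ F ─ X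
∈-link⁻ 𝓕 {X} {Y} Y∈ = T-does⁻ (anySubset? λ F → T? (𝓕 F) ×-dec (X ⊆? F) ×-dec (Y ≟ˢ (F ─ X))) Y∈

∈-link⁺ : ∀ (𝓕 : Family n) {X F} → F ∈ᶠ 𝓕 → X ⊆ F → F ─ X ∈ᶠ 𝓕 ⟨ X ⟩
∈-link⁺ 𝓕 {X} {F} F∈ X⊆F = T-does⁺ (anySubset? λ F′ → T? (𝓕 F′) ×-dec (X ⊆? F′) ×-dec ((F ─ X) ≟ˢ (F′ ─ X)))
  (F , F∈ , X⊆F , refl)

-- Removing `X` and adding it back are inverse bijections between the members that contain `X` and
-- the link.
card-link : ∀ (𝓕 : Family n) X → card (𝓕 ⟨ X ⟩) ≡ degree (members 𝓕) X
card-link {n} 𝓕 X = trans (≤-antisym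
  (card-injection {𝓗 = 𝓕 [ X ]} (_∪ X) into₁ inj₁′)
  (card-injection {𝓖 = 𝓕 [ X ]} (_─ X) into₂ inj₂′))
  (trans (length-filterᵇ (𝓕 [ X ]) (allSubsets n)) (trans (∑-cong (allSubsets n) λ F → 𝟙-∧ (𝓕 F) (does (X ⊆? F)))
    (sym (∑-filterᵇ 𝓕 (allSubsets n) _))))
  where
  𝟙-∧ : ∀ b c → 𝟙 (b ∧ c) ≡ 𝟙 b * 𝟙 c
  𝟙-∧ true  c = sym (+-identityʳ _)
  𝟙-∧ false c = refl
  restore : ∀ {Y} → Y ∈ᶠ 𝓕 ⟨ X ⟩ → ∃ λ F → F ∈ᶠ 𝓕 × X ⊆ F × Y ≡ F ─ X × Y ∪ X ≡ F
  restore Y∈ with F , F∈ , X⊆F , refl ← ∈-link⁻ 𝓕 Y∈ = F , F∈ , (λ {x} → X⊆F {x}) , refl , ∪-─-cancel X⊆F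
  into₁ : ∀ {Y} → Y ∈ᶠ 𝓕 ⟨ X ⟩ → (Y ∪ X) ∈ᶠ 𝓕 [ X ]
  into₁ Y∈ with F , F∈ , X⊆F , _ , eq ← restore Y∈ =
    subst (_∈ᶠ 𝓕 [ X ]) (sym eq) (T-∧⁺ {𝓕 F} F∈ (T-does⁺ (X ⊆? F) X⊆F))
  inj₁′ : ∀ {Y Y′} → Y ∈ᶠ 𝓕 ⟨ X ⟩ → Y′ ∈ᶠ 𝓕 ⟨ X ⟩ → Y ∪ X ≡ Y′ ∪ X → Y ≡ Y′
  inj₁′ Y∈ Y′∈ eq with F , _ , _ , p , p′ ← restore Y∈ with F′ , _ , _ , q , q′ ← restore Y′∈ =
    trans p (trans (cong (_─ X) (trans (sym p′) (trans eq q′))) (sym q))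
  split : ∀ {F} → F ∈ᶠ 𝓕 [ X ] → F ∈ᶠ 𝓕 × X ⊆ F
  split {F} F∈ with a , b ← T-∧⁻ {𝓕 F} F∈ = a , T-does⁻ (X ⊆? F) b
  into₂ : ∀ {F} → F ∈ᶠ 𝓕 [ X ] → F ─ X ∈ᶠ 𝓕 ⟨ X ⟩
  into₂ F∈ = ∈-link⁺ 𝓕 (proj₁ (split F∈)) (proj₂ (split F∈))
  inj₂′ : ∀ {F F′} → F ∈ᶠ 𝓕 [ X ] → F′ ∈ᶠ 𝓕 [ X ] → F ─ X ≡ F′ ─ X → F ≡ F′
  inj₂′ F∈ F′∈ eq = trans (sym (∪-─-cancel (proj₂ (split F∈)))) (trans (cong (_∪ X) eq) (∪-─-cancel (proj₂ (split F′∈))))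

link-mono : ∀ {𝓕 𝓖 : Family n} → 𝓕 ⊆ᶠ 𝓖 → ∀ X → 𝓕 ⟨ X ⟩ ⊆ᶠ 𝓖 ⟨ X ⟩
link-mono {𝓕 = 𝓕} {𝓖} sub X Y Y∈ with F , F∈ , X⊆F , refl ← ∈-link⁻ 𝓕 Y∈ = ∈-link⁺ 𝓖 (sub F F∈) X⊆F

link-link : ∀ (𝓖 : Family n) B X → (𝓖 ⟨ B ⟩) ⟨ X ⟩ ⊆ᶠ 𝓖 ⟨ B ∪ X ⟩
link-link 𝓖 B X Z Z∈ with Y , Y∈ , X⊆Y , refl ← ∈-link⁻ (𝓖 ⟨ B ⟩) Z∈ with F , F∈ , B⊆F , refl ← ∈-link⁻ 𝓖 Y∈ =
  subst (_∈ᶠ 𝓖 ⟨ B ∪ X ⟩) (sym (p─q─r≡p─q∪r F B X)) (∈-link⁺ 𝓖 F∈ sub)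
  where
  sub : B ∪ X ⊆ F
  sub x∈ with x∈p∪q⁻ B X x∈
  ... | inj₁ x∈B = B⊆F x∈B
  ... | inj₂ x∈X = p─q⊆p F B (X⊆Y x∈X)

link-link-empty : ∀ (𝓖 : Family n) B X → Nonempty (B ∩ X) → card ((𝓖 ⟨ B ⟩) ⟨ X ⟩) ≡ 0
link-link-empty 𝓖 B X (x , x∈) = n<1⇒n≡0 (≰⇒> λ le → absurd (card-nonempty⁻ {𝓖 = (𝓖 ⟨ B ⟩) ⟨ X ⟩} le))
  where
  absurd : ¬ NonemptyFamily ((𝓖 ⟨ B ⟩) ⟨ X ⟩)
  absurd (Z , Z∈) with Y , Y∈ , X⊆Y , refl ← ∈-link⁻ (𝓖 ⟨ B ⟩) Z∈ with F , F∈ , B⊆F , refl ← ∈-link⁻ 𝓖 Y∈ =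
    let x∈B , x∈X = x∈p∩q⁻ B X x∈ in x∈p─q⇒x∉q F B (X⊆Y x∈X) x∈B

card-≤-link-⊥ : ∀ (𝓖 : Family n) → card 𝓖 ≤ card (𝓖 ⟨ ⊥ ⟩)
card-≤-link-⊥ 𝓖 = card-mono {𝓖 = 𝓖} {𝓗 = 𝓖 ⟨ ⊥ ⟩} λ F F∈ → subst (_∈ᶠ 𝓖 ⟨ ⊥ ⟩) (p─⊥≡p F) (∈-link⁺ 𝓖 F∈ ⊥⊆)

-- Matching numbers

filter-∈-sublists : ∀ {P : A → Set} (P? : ∀ x → Dec (P x)) xs → filter P? xs ∈ sublists xs
filter-∈-sublists P? []       = here refl
filter-∈-sublists P? (x ∷ xs) with does (P? x)
... | true  = ∈-++⁺ʳ (sublists xs) (∈-map⁺ (x ∷_) (filter-∈-sublists P? xs))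
... | false = ∈-++⁺ˡ (filter-∈-sublists P? xs)

∈-sublists⁻ : ∀ (xs : List A) {ys} → ys ∈ sublists xs → All (_∈ xs) ys
∈-sublists⁻ []       (here refl) = []
∈-sublists⁻ (x ∷ xs) ys∈ with ∈-++⁻ (sublists xs) ys∈
... | inj₁ p = All.map there (∈-sublists⁻ xs p)
... | inj₂ p with zs , zs∈ , refl ← ∈-map⁻ (x ∷_) p = here refl ∷ All.map there (∈-sublists⁻ xs zs∈)

unique⇒allPairs : ∀ {R : A → A → Set} {xs} → Unique xs → (∀ {x y} → x ∈ xs → y ∈ xs → x ≢ y → R x y) → AllPairs R xs
unique⇒allPairs []       r = []
unique⇒allPairs (x∉ ∷ u) r = All.tabulate (λ y∈ → r (here refl) (there y∈) (All.lookup x∉ y∈)) ∷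
  unique⇒allPairs u (λ x∈ y∈ → r (there x∈) (there y∈))

allPairs-lookup : ∀ {R : A → A → Set} {xs} → (∀ {x y} → R x y → R y x) → AllPairs R xs →
  ∀ {x y} → x ∈ xs → y ∈ xs → x ≢ y → R x y
allPairs-lookup sy (rs ∷ ps) (here refl) (here refl) x≢y = contradiction refl x≢y
allPairs-lookup sy (rs ∷ ps) (here refl) (there y∈)  x≢y = All.lookup rs y∈
allPairs-lookup sy (rs ∷ ps) (there x∈)  (here refl) x≢y = sy (All.lookup rs x∈)
allPairs-lookup sy (rs ∷ ps) (there x∈)  (there y∈)  x≢y = allPairs-lookup sy ps x∈ y∈ x≢y

-- The definition of `ν` ranges over sublists of `members 𝓕`, whose order `xs` need not follow; so
-- `xs` is replaced by the members that occur in it.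
matching⇒≤ν : ∀ (𝓕 : Family n) {xs} → Unique xs → All (_∈ᶠ 𝓕) xs → AllPairs Disjoint xs → length xs ≤ ν 𝓕
matching⇒≤ν {n} 𝓕 {xs} uniq xs⊆ disj = ≤-trans
  (unique-⊆-length uniq λ x∈ → ∈-filter⁺ in-xs? (∈-members⁺ 𝓕 (All.lookup xs⊆ x∈)) x∈)
  (All.lookup (xs≤max 0 (map length (filter (allPairs? disjoint?) (sublists (members 𝓕)))))
    (∈-map⁺ length (∈-filter⁺ (allPairs? disjoint?) (filter-∈-sublists in-xs? (members 𝓕)) pairwise)))
  where
  open DecMembership (_≟ˢ_ {n}) using () renaming (_∈?_ to _∈ˡ?_)
  in-xs? = _∈ˡ? xs
  ys = filter in-xs? (members 𝓕)
  ∈-ys⁻ : ∀ {y} → y ∈ ys → y ∈ xs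
  ∈-ys⁻ y∈ = proj₂ (∈-filter⁻ in-xs? {xs = members 𝓕} y∈)
  pairwise : AllPairs Disjoint ys
  pairwise = unique⇒allPairs (Unique.filter⁺ in-xs? (members-unique 𝓕))
    (λ x∈ y∈ → allPairs-lookup disjoint-sym disj (∈-ys⁻ x∈) (∈-ys⁻ y∈))

≤ν⇒matching : ∀ (𝓢 : Family n) s → 1 ≤ s → s ≤ ν 𝓢 →
  ∃ λ bs → length bs ≡ s × All (_∈ᶠ 𝓢) bs × AllPairs Disjoint bs
≤ν⇒matching 𝓢 s 1≤s s≤ν = extract (argmax-sel id 0 (map length (filter (allPairs? disjoint?) (sublists (members 𝓢)))))
  where
  extract : ν 𝓢 ≡ 0 ⊎ ν 𝓢 ∈ map length (filter (allPairs? disjoint?) (sublists (members 𝓢))) →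
    ∃ λ bs → length bs ≡ s × All (_∈ᶠ 𝓢) bs × AllPairs Disjoint bs
  -- The maximum may be its default value 0, which `1 ≤ s` excludes.
  extract (inj₁ ν≡0) = contradiction (subst (s ≤_) ν≡0 s≤ν) (<⇒≱ 1≤s)
  extract (inj₂ ν∈)
    with bs , bs∈ , ν≡ ← ∈-map⁻ length ν∈
    with sub , disj ← ∈-filter⁻ (allPairs? disjoint?) {xs = sublists (members 𝓢)} bs∈ =
      take s bs
    , trans (length-take s bs) (m≤n⇒m⊓n≡m (subst (s ≤_) ν≡ s≤ν))
    , All.take⁺ s (All.map (∈-members⁻ 𝓢) (∈-sublists⁻ (members 𝓢) sub))
    , AllPairs.take⁺ s disj

-- Spread approximation

-- x-spreadness for x = (a/b)^(1/d), with roots and denominators cleared.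
RootSpread : (d a b : ℕ) → Family n → Set
RootSpread d a b 𝓖 = ∀ X → card (𝓖 ⟨ X ⟩) ^ d * a ^ ∣ X ∣ ≤ card 𝓖 ^ d * b ^ ∣ X ∣

-- The second premise says that `R` is at most (a/b)^(1/d), so spreadness for that root implies
-- spreadness for `R`. The comparison is made between d-th powers.
root-≤ : ∀ {c e a b R} d j .{{_ : NonZero d}} .{{_ : NonZero b}} →
  c ^ d * a ^ j ≤ e ^ d * b ^ j → b * R ^ d ≤ a → c * R ^ j ≤ e
root-≤ {c} {e} {a} {b} {R} d j spread le = ^-cancelʳ-≤ d (*-cancelʳ-≤ _ _ (b ^ j) {{m^n≢0 b j}} (begin
  (c * R ^ j) ^ d * b ^ j          ≡⟨ cong (_* b ^ j) (^-distribʳ-* c (R ^ j) d) ⟩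
  c ^ d * (R ^ j) ^ d * b ^ j      ≡⟨ cong (λ z → c ^ d * z * b ^ j) (^-comm R j d) ⟩
  c ^ d * (R ^ d) ^ j * b ^ j      ≡⟨ lemma (c ^ d) ((R ^ d) ^ j) (b ^ j) ⟩
  c ^ d * (b ^ j * (R ^ d) ^ j)    ≡⟨ cong (c ^ d *_) (^-distribʳ-* b (R ^ d) j) ⟨
  c ^ d * (b * R ^ d) ^ j          ≤⟨ *-monoʳ-≤ (c ^ d) (^-monoˡ-≤ j le) ⟩
  c ^ d * a ^ j                    ≤⟨ spread ⟩
  e ^ d * b ^ j ∎))
  where
  open ≤-Reasoning
  lemma : ∀ x y z → x * y * z ≡ x * (z * y)
  lemma = solve-∀

module _ {d a b : ℕ} {{_ : NonZero d}} {{_ : NonZero a}} {{_ : NonZero b}} where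

  private
    -- The d-th power of |𝓖(B)| x^|B| for x = (a/b)^(1/d), multiplied by b^n to clear the
    -- denominators.
    weight : Family n → Subset n → ℕ
    weight {n} 𝓖 B = card (𝓖 ⟨ B ⟩) ^ d * a ^ ∣ B ∣ * b ^ (n ∸ ∣ B ∣)

  weight-≤ : ∀ (𝓖 : Family n) B′ B j → ∣ B′ ∣ ≡ ∣ B ∣ + j → weight 𝓖 B′ ≤ weight 𝓖 B →
    card (𝓖 ⟨ B′ ⟩) ^ d * a ^ j ≤ card (𝓖 ⟨ B ⟩) ^ d * b ^ j
  weight-≤ {n} 𝓖 B′ B j size le with m≤n⇒∃[o]m+o≡n (∣p∣≤n B′)
  ... | e , eq = *-cancelʳ-≤ _ _ (a ^ t * b ^ e) {{m*n≢0 _ _ {{m^n≢0 a t}} {{m^n≢0 b e}}}} (begin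
    c′ * a ^ j * (a ^ t * b ^ e)     ≡⟨ l₁ c′ (a ^ j) (a ^ t) (b ^ e) ⟩
    c′ * (a ^ t * a ^ j) * b ^ e     ≡⟨ cong₂ (λ x y → c′ * x * b ^ y) (sym (^-distribˡ-+-* a t j)) (sym e≡) ⟩
    c′ * a ^ (t + j) * b ^ (n ∸ ∣ B′ ∣) ≡⟨ cong (λ x → c′ * a ^ x * b ^ (n ∸ ∣ B′ ∣)) size ⟨
    weight 𝓖 B′                      ≤⟨ le ⟩
    c * a ^ t * b ^ (n ∸ t)          ≡⟨ cong (λ x → c * a ^ t * b ^ x) j+e≡ ⟩
    c * a ^ t * b ^ (j + e)          ≡⟨ cong (c * a ^ t *_) (^-distribˡ-+-* b j e) ⟩
    c * a ^ t * (b ^ j * b ^ e)      ≡⟨ l₂ c (a ^ t) (b ^ j) (b ^ e) ⟩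
    c * b ^ j * (a ^ t * b ^ e) ∎)
    where
    open ≤-Reasoning
    t = ∣ B ∣
    c′ = card (𝓖 ⟨ B′ ⟩) ^ d
    c = card (𝓖 ⟨ B ⟩) ^ d
    e≡ : n ∸ ∣ B′ ∣ ≡ e
    e≡ = trans (cong (_∸ ∣ B′ ∣) (sym eq)) (m+n∸m≡n ∣ B′ ∣ e)
    j+e≡ : n ∸ t ≡ j + e
    j+e≡ = trans (cong (_∸ t) (trans (sym eq) (trans (cong (_+ e) size) (+-assoc t j e)))) (m+n∸m≡n t (j + e))
    l₁ : ∀ w x y z → w * x * (y * z) ≡ w * (y * x) * z
    l₁ = solve-∀
    l₂ : ∀ w x y z → w * x * (y * z) ≡ w * y * (x * z)
    l₂ = solve-∀

  -- If `X` meets `B`, the double link is empty, since members of 𝓖(B) avoid `B`. Otherwise sizes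
  -- add up and `B` is compared with `B ∪ X`.
  maximal⇒spread : ∀ (𝓖 : Family n) B → (∀ B′ → weight 𝓖 B′ ≤ weight 𝓖 B) → RootSpread d a b (𝓖 ⟨ B ⟩)
  maximal⇒spread 𝓖 B maximal X = by-cases (nonempty? (B ∩ X))
    where
    by-cases : Dec (Nonempty (B ∩ X)) →
      card ((𝓖 ⟨ B ⟩) ⟨ X ⟩) ^ d * a ^ ∣ X ∣ ≤ card (𝓖 ⟨ B ⟩) ^ d * b ^ ∣ X ∣
    by-cases (yes meet) = ≤-trans (≤-reflexive (cong (λ c → c ^ d * a ^ ∣ X ∣) (link-link-empty 𝓖 B X meet)))
      (≤-trans (≤-reflexive (cong (_* a ^ ∣ X ∣) (0^d≡0 d))) z≤n)
    by-cases (no disj) = ≤-trans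
      (*-monoˡ-≤ (a ^ ∣ X ∣) (^-monoˡ-≤ d (card-mono {𝓖 = (𝓖 ⟨ B ⟩) ⟨ X ⟩} {𝓗 = 𝓖 ⟨ B ∪ X ⟩} (link-link 𝓖 B X))))
      (weight-≤ 𝓖 (B ∪ X) B ∣ X ∣ (disjoint⇒∣p∪q∣≡∣p∣+∣q∣ B X disj) (maximal (B ∪ X)))

  -- Here `B` is compared with the empty set, whose link is at least as large as `𝓖`.
  maximal⇒large : ∀ (𝓖 : Family n) B → (∀ B′ → weight 𝓖 B′ ≤ weight 𝓖 B) →
    card 𝓖 ^ d * b ^ ∣ B ∣ ≤ card (𝓖 ⟨ B ⟩) ^ d * a ^ ∣ B ∣
  maximal⇒large {n} 𝓖 B maximal = *-cancelʳ-≤ _ _ (b ^ (n ∸ ∣ B ∣)) {{m^n≢0 b (n ∸ ∣ B ∣)}} (begin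
    card 𝓖 ^ d * b ^ ∣ B ∣ * b ^ (n ∸ ∣ B ∣)
      ≡⟨ *-assoc (card 𝓖 ^ d) _ _ ⟩
    card 𝓖 ^ d * (b ^ ∣ B ∣ * b ^ (n ∸ ∣ B ∣))
      ≡⟨ cong (card 𝓖 ^ d *_) (^-distribˡ-+-* b ∣ B ∣ (n ∸ ∣ B ∣)) ⟨
    card 𝓖 ^ d * b ^ (∣ B ∣ + (n ∸ ∣ B ∣))
      ≡⟨ cong (λ x → card 𝓖 ^ d * b ^ x) (m+[n∸m]≡n (∣p∣≤n B)) ⟩
    card 𝓖 ^ d * b ^ n
      ≤⟨ *-monoˡ-≤ (b ^ n) (^-monoˡ-≤ d (card-≤-link-⊥ 𝓖)) ⟩
    card (𝓖 ⟨ ⊥ ⟩) ^ d * b ^ n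
      ≡⟨ cong (_* b ^ n) (*-identityʳ (card (𝓖 ⟨ ⊥ ⟩) ^ d)) ⟨
    card (𝓖 ⟨ ⊥ ⟩) ^ d * a ^ 0 * b ^ n
      ≡⟨ cong (λ x → card (𝓖 ⟨ ⊥ ⟩) ^ d * a ^ x * b ^ (n ∸ x)) (∣⊥∣≡0 n) ⟨
    weight 𝓖 ⊥
      ≤⟨ maximal ⊥ ⟩
    weight 𝓖 B ∎)
    where open ≤-Reasoning

  maximal-link : (𝓖 : Family n) → ∃ λ B →
    RootSpread d a b (𝓖 ⟨ B ⟩) × card 𝓖 ^ d * b ^ ∣ B ∣ ≤ card (𝓖 ⟨ B ⟩) ^ d * a ^ ∣ B ∣
  maximal-link {n} 𝓖 = pack (argmax (weight 𝓖) ⊥ (allSubsets n))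
    (λ B′ → All.lookup (f[xs]≤f[argmax] {f = weight 𝓖} ⊥ (allSubsets n)) (∈-allSubsets B′))
    where
    pack : ∀ B → (∀ B′ → weight 𝓖 B′ ≤ weight 𝓖 B) → ∃ λ B →
      RootSpread d a b (𝓖 ⟨ B ⟩) × card 𝓖 ^ d * b ^ ∣ B ∣ ≤ card (𝓖 ⟨ B ⟩) ^ d * a ^ ∣ B ∣
    pack B maximal = B , maximal⇒spread 𝓖 B maximal , maximal⇒large 𝓖 B maximal

module Approximation {n d a b : ℕ} {{_ : NonZero d}} {{_ : NonZero a}} {{_ : NonZero b}} (q : ℕ)
  (𝓐 𝓕 : Family n) (𝓕⊆𝓐 : 𝓕 ⊆ᶠ 𝓐) (spread𝓐 : RootSpread d a b 𝓐) where

  private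
    instance
      2^d*b≢0 : NonZero (2 ^ d * b)
      2^d*b≢0 = m*n≢0 (2 ^ d) b {{m^n≢0 2 d}}

  -- Halving (a/b)^(1/d) multiplies the denominator under the root by `2 ^ d`.
  Witness : Subset n → Set
  Witness B = ∃ λ (𝓕B : Family n) → 𝓕B ⊆ᶠ 𝓕 × NonemptyFamily (𝓕B ⟨ B ⟩) × RootSpread d a (2 ^ d * b) (𝓕B ⟨ B ⟩)

  record Approximates (𝓖 : Family n) : Set where
    field
      𝓢 𝓕′     : Family n
      small    : AtMost q 𝓢
      subfam   : 𝓕′ ⊆ᶠ 𝓖
      covered  : (𝓖 ∖ᶠ 𝓕′) ⊆ᶠ (𝓐 [[ 𝓢 ]])
      witness  : ∀ B → B ∈ᶠ 𝓢 → Witness B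
      few      : 2 ^ (q + 1) * card 𝓕′ ≤ card 𝓐

  stop : (𝓖 : Family n) → 2 ^ (q + 1) * card 𝓖 ≤ card 𝓐 → Approximates 𝓖
  stop 𝓖 few = record
    { 𝓢 = λ _ → false ; 𝓕′ = 𝓖 ; small = λ _ () ; subfam = λ _ X∈ → X∈
    ; covered = λ X X∈ → ⊥-elim (self (𝓖 X) X∈) ; witness = λ _ () ; few = few }
    where
    self : ∀ b → ¬ T (b ∧ not b)
    self true  ()
    self false ()

  deep-few : ∀ (𝓖 : Family n) B → 𝓖 ⊆ᶠ 𝓕 → q < ∣ B ∣ →
    card 𝓖 ^ d * (2 ^ d * b) ^ ∣ B ∣ ≤ card (𝓖 ⟨ B ⟩) ^ d * a ^ ∣ B ∣ → 2 ^ (q + 1) * card 𝓖 ≤ card 𝓐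
  deep-few 𝓖 B 𝓖⊆𝓕 q< large = ≤-trans (*-monoˡ-≤ (card 𝓖) (^-monoʳ-≤ 2 (subst (_≤ t) (+-comm 1 q) q<)))
    -- The powers of `a` have cancelled, and the remaining quotient of `2 ^ d * b` by `b` has d-th
    -- root 2.
    (≤-trans (≤-reflexive (*-comm (2 ^ t) (card 𝓖))) (root-≤ {a = 2 ^ d * b} {b} {2} d t (begin
      card 𝓖 ^ d * (2 ^ d * b) ^ t       ≤⟨ large ⟩
      card (𝓖 ⟨ B ⟩) ^ d * a ^ t         ≤⟨ *-monoˡ-≤ (a ^ t) (^-monoˡ-≤ d (card-mono {𝓖 = 𝓖 ⟨ B ⟩} {𝓗 = 𝓐 ⟨ B ⟩}
                                              (link-mono {𝓕 = 𝓖} {𝓖 = 𝓐} (λ X X∈ → 𝓕⊆𝓐 X (𝓖⊆𝓕 X X∈)) B))) ⟩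
      card (𝓐 ⟨ B ⟩) ^ d * a ^ t         ≤⟨ spread𝓐 B ⟩
      card 𝓐 ^ d * b ^ t ∎) (≤-reflexive (*-comm b (2 ^ d)))))
    where
    open ≤-Reasoning
    t = ∣ B ∣

  extend : ∀ (𝓖 : Family n) B → 𝓖 ⊆ᶠ 𝓕 → ∣ B ∣ ≤ q → Witness B → Approximates (𝓖 ∖ᶠ (𝓖 [ B ])) → Approximates 𝓖
  extend 𝓖 B 𝓖⊆𝓕 ∣B∣≤q wit rec = record
    { 𝓢 = 𝓢⁺ ; 𝓕′ = R.𝓕′ ; small = small⁺ ; subfam = λ X X∈ → proj₁ (T-∧⁻ {𝓖 X} (R.subfam X X∈))
    ; covered = covered⁺ ; witness = witness⁺ ; few = R.few }
    where
    module R = Approximates rec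
    𝓢⁺ : Family n
    𝓢⁺ X = R.𝓢 X ∨ does (X ≟ˢ B)
    case𝓢⁺ : ∀ {X} → X ∈ᶠ 𝓢⁺ → X ∈ᶠ R.𝓢 ⊎ X ≡ B
    case𝓢⁺ {X} X∈ with Equivalence.to (T-∨ {R.𝓢 X}) X∈
    ... | inj₁ p = inj₁ p
    ... | inj₂ p = inj₂ (T-does⁻ (X ≟ˢ B) p)
    small⁺ : AtMost q 𝓢⁺
    small⁺ X X∈ with case𝓢⁺ {X} X∈
    ... | inj₁ p    = R.small X p
    ... | inj₂ refl = ∣B∣≤q
    witness⁺ : ∀ X → X ∈ᶠ 𝓢⁺ → Witness X
    witness⁺ X X∈ with case𝓢⁺ {X} X∈
    ... | inj₁ p    = R.witness X p
    ... | inj₂ refl = wit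
    in-union : ∀ {F} Y → Y ∈ᶠ 𝓢⁺ → F ∈ᶠ 𝓐 [ Y ] → F ∈ᶠ 𝓐 [[ 𝓢⁺ ]]
    in-union {F} Y Y∈ F∈ = T-does⁺ (anySubset? λ Y → T? (𝓢⁺ Y) ×-dec T? ((𝓐 [ Y ]) F)) (Y , Y∈ , F∈)
    not-in : ∀ {F} b → ¬ B ⊆ F → T (not (b ∧ does (B ⊆? F)))
    not-in false _   = _
    not-in {F} true B⊈F = T-not-does⁺ (B ⊆? F) B⊈F
    covered⁺ : (𝓖 ∖ᶠ R.𝓕′) ⊆ᶠ (𝓐 [[ 𝓢⁺ ]])
    covered⁺ F F∈ with F∈𝓖 , F∉′ ← T-∧⁻ {𝓖 F} F∈ with B ⊆? F
    ... | yes B⊆F = in-union B (Equivalence.from (T-∨ {R.𝓢 B}) (inj₂ (T-does⁺ (B ≟ˢ B) refl)))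
                      (T-∧⁺ {𝓐 F} (𝓕⊆𝓐 F (𝓖⊆𝓕 F F∈𝓖)) (T-does⁺ (B ⊆? F) B⊆F))
    ... | no B⊈F with Y , Y∈ , F∈Y ← T-does⁻ (anySubset? λ Y → T? (R.𝓢 Y) ×-dec T? ((𝓐 [ Y ]) F)) (R.covered F
                        (T-∧⁺ {(𝓖 ∖ᶠ (𝓖 [ B ])) F} (T-∧⁺ {𝓖 F} F∈𝓖 (not-in (𝓖 F) B⊈F)) F∉′)) =
      in-union Y (Equivalence.from (T-∨ {R.𝓢 Y}) (inj₁ Y∈)) F∈Y

  -- The recursion is on a bound for `card 𝓖`. It decreases because the inequality `large` forces a
  -- nonempty 𝓖(B) whenever `𝓖` is nonempty, so at least one member is removed.
  approximate : ∀ m (𝓖 : Family n) → 𝓖 ⊆ᶠ 𝓕 → card 𝓖 ≤ m → Approximates 𝓖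
  approximate zero    𝓖 𝓖⊆𝓕 le = stop 𝓖 (≤-trans (≤-reflexive (trans (cong (2 ^ (q + 1) *_) (n≤0⇒n≡0 le)) (*-zeroʳ (2 ^ (q + 1))))) z≤n)
  approximate (suc m) 𝓖 𝓖⊆𝓕 le = by-size (1 ≤? card 𝓖) (maximal-link {d = d} {a} {2 ^ d * b} 𝓖)
    where
    by-size : Dec (1 ≤ card 𝓖) → (∃ λ B → RootSpread d a (2 ^ d * b) (𝓖 ⟨ B ⟩) ×
      card 𝓖 ^ d * (2 ^ d * b) ^ ∣ B ∣ ≤ card (𝓖 ⟨ B ⟩) ^ d * a ^ ∣ B ∣) → Approximates 𝓖
    by-size (no empty) _ = approximate m 𝓖 𝓖⊆𝓕 (≤-trans (≤-pred (≰⇒> empty)) z≤n)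
    by-size (yes 1≤card) (B , spread , large) = by-rank (∣ B ∣ ≤? q)
      where
      1≤link : 1 ≤ card (𝓖 ⟨ B ⟩)
      1≤link = 1≤m^d⇒1≤m _ d (positive (≤-trans (*-mono-≤ (m^n>0 (card 𝓖) {{>-nonZero 1≤card}} d) (m^n>0 (2 ^ d * b) ∣ B ∣)) large))
        where
        positive : ∀ {x y} → 1 ≤ x * y → 1 ≤ x
        positive {suc x} _ = s≤s z≤n
      ne : NonemptyFamily (𝓖 ⟨ B ⟩)
      ne = card-nonempty⁻ {𝓖 = 𝓖 ⟨ B ⟩} 1≤link
      smaller : card (𝓖 ∖ᶠ (𝓖 [ B ])) < card 𝓖
      smaller =
        let Y , Y∈ = ne
            F , F∈ , B⊆F , _ = ∈-link⁻ 𝓖 {B} Y∈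
        in card-strict {𝓖 = 𝓖 ∖ᶠ (𝓖 [ B ])} {𝓖} (λ X X∈ → proj₁ (T-∧⁻ {𝓖 X} X∈)) F∈
             λ F∈′ → absurd (𝓖 F) F∈ (proj₂ (T-∧⁻ {𝓖 F} F∈′)) (λ {x} → B⊆F {x})
        where
        absurd : ∀ {F} b → T b → T (not (b ∧ does (B ⊆? F))) → B ⊆ F → Void
        absurd {F} true _ t B⊆F = T-not-does⁻ (B ⊆? F) t B⊆F
      by-rank : Dec (∣ B ∣ ≤ q) → Approximates 𝓖
      by-rank (no deep)     = stop 𝓖 (deep-few 𝓖 B 𝓖⊆𝓕 (≰⇒> deep) large)
      by-rank (yes shallow) = extend 𝓖 B 𝓖⊆𝓕 shallow (𝓖 , 𝓖⊆𝓕 , ne , spread)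
        (approximate m (𝓖 ∖ᶠ (𝓖 [ B ])) (λ X X∈ → 𝓖⊆𝓕 X (proj₁ (T-∧⁻ {𝓖 X} X∈))) (≤-pred (≤-trans smaller le)))

-- From a matching in the approximating family to one in the original family

∣⋃─∣-≤ : ∀ (bs : List (Subset n)) B → ∣ ⋃ bs ─ B ∣ ≤ ∑ bs (λ B′ → ∣ B′ ─ B ∣)
∣⋃─∣-≤ {n} []        B = ≤-trans (∣p─q∣≤∣p∣ ⊥ B) (≤-reflexive (∣⊥∣≡0 n))
∣⋃─∣-≤     (B′ ∷ bs) B = begin
  ∣ (B′ ∪ ⋃ bs) ─ B ∣             ≤⟨ p⊆q⇒∣p∣≤∣q∣ split ⟩
  ∣ (B′ ─ B) ∪ (⋃ bs ─ B) ∣       ≤⟨ ∣p∪q∣≤∣p∣+∣q∣ (B′ ─ B) (⋃ bs ─ B) ⟩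
  ∣ B′ ─ B ∣ + ∣ ⋃ bs ─ B ∣       ≤⟨ +-monoʳ-≤ ∣ B′ ─ B ∣ (∣⋃─∣-≤ bs B) ⟩
  ∣ B′ ─ B ∣ + ∑ bs (λ B″ → ∣ B″ ─ B ∣) ∎
  where
  open ≤-Reasoning
  split : (B′ ∪ ⋃ bs) ─ B ⊆ (B′ ─ B) ∪ (⋃ bs ─ B)
  split x∈ with x∈p∪q⁻ B′ (⋃ bs) (p─q⊆p (B′ ∪ ⋃ bs) B x∈)
  ... | inj₁ p = x∈p∪q⁺ (inj₁ (x∈p∧x∉q⇒x∈p─q p (x∈p─q⇒x∉q (B′ ∪ ⋃ bs) B x∈)))
  ... | inj₂ p = x∈p∪q⁺ (inj₂ (x∈p∧x∉q⇒x∈p─q p (x∈p─q⇒x∉q (B′ ∪ ⋃ bs) B x∈)))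

∈-⋃ : ∀ {bs : List (Subset n)} {B x} → B ∈ bs → x ∈ˢ B → x ∈ˢ ⋃ bs
∈-⋃ (here refl) x∈ = x∈p∪q⁺ (inj₁ x∈)
∈-⋃ (there B∈)  x∈ = x∈p∪q⁺ (inj₂ (∈-⋃ B∈ x∈))

-- The set `B` adds nothing to the union outside `B`; this is the source of `s ∸ 1` instead of `s`
-- in the threshold.
∑-≤-one-zero : ∀ {xs : List A} (f : A → ℕ) q → (∀ {x} → x ∈ xs → f x ≤ q) → ∀ {x} → x ∈ xs → f x ≡ 0 →
  ∑ xs f ≤ (length xs ∸ 1) * q
∑-≤-one-zero {xs = x ∷ xs} f q le (here refl) fx≡0 rewrite fx≡0 =
  ≤-trans (∑-mono-∈ xs (le ∘ there)) (≤-reflexive (∑-const xs q))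
∑-≤-one-zero {xs = x ∷ y ∷ xs} f q le (there x∈) fx≡0 =
  +-mono-≤ (le (here refl)) (∑-≤-one-zero f q (le ∘ there) x∈ fx≡0)

allPairs-combine : ∀ {P : A → Set} {Q R S : A → A → Set} {xs} → (∀ {x y} → P x → P y → Q x y → R x y → S x y) →
  All P xs → AllPairs Q xs → AllPairs R xs → AllPairs S xs
allPairs-combine f []       []       []       = []
allPairs-combine f (p ∷ ps) (q ∷ qs) (r ∷ rs) =
  All.map (λ (p′ , q′ , r′) → f p p′ q′ r′) (All.zip (ps , All.zip (q , r))) ∷ allPairs-combine f ps qs rs

module _ {n k s q L d a b : ℕ} {{_ : NonZero d}} {{_ : NonZero b}}
  (1≤k : 1 ≤ k) (1≤s : 1 ≤ s) (1≤L : 1 ≤ L) (k<2^L : k < 2 ^ L)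
  (𝓕 : Family n) (uniform : Uniform k 𝓕)
  (b[2w]^d≤a : b * (2 * ((s ∸ 1) * q)) ^ d ≤ a) (bR^d≤a : b * (128 * (2 * s * L)) ^ d ≤ a)
  where

  module Links (bs : List (Subset n)) (length-bs : length bs ≡ s) (small : ∀ {B} → B ∈ bs → ∣ B ∣ ≤ q)
    (𝓕[_] : Subset n → Family n) (sub : ∀ {B} → B ∈ bs → 𝓕[ B ] ⊆ᶠ 𝓕)
    (nonempty : ∀ {B} → B ∈ bs → NonemptyFamily (𝓕[ B ] ⟨ B ⟩))
    (spread : ∀ {B} → B ∈ bs → RootSpread d a b (𝓕[ B ] ⟨ B ⟩)) where

    H : Subset n → Family n
    H B = 𝓕[ B ] ⟨ B ⟩

    other : Subset n → Subset n
    other B = ⋃ bs ─ B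

    avoids? : ∀ B → Subset n → Bool
    avoids? B Y = does (disjoint? Y (other B))

    G : Subset n → List (Subset n)
    G B = filterᵇ (avoids? B) (members (H B))

    ∣other∣≤ : ∀ {B} → B ∈ bs → ∣ other B ∣ ≤ (s ∸ 1) * q
    ∣other∣≤ {B} B∈ = ≤-trans (∣⋃─∣-≤ bs B) (subst (λ l → ∑ bs (λ B′ → ∣ B′ ─ B ∣) ≤ (l ∸ 1) * q) length-bs
      (∑-≤-one-zero (λ B′ → ∣ B′ ─ B ∣) q (λ {B′} B′∈ → ≤-trans (∣p─q∣≤∣p∣ B′ B) (small B′∈)) B∈
        (n<1⇒n≡0 (≰⇒> no-elements))))
      where
      no-elements : ¬ 1 ≤ ∣ B ─ B ∣
      no-elements le = 1≰0 (≤-trans le (≤-trans (p⊆q⇒∣p∣≤∣q∣ {q = ⊥} B─B⊆⊥) (≤-reflexive (∣⊥∣≡0 n))))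
        where
        1≰0 : ¬ 1 ≤ 0
        1≰0 ()
        B─B⊆⊥ : B ─ B ⊆ ⊥
        B─B⊆⊥ x∈ = contradiction (p─q⊆p B B x∈) (x∈p─q⇒x∉q B B x∈)

    meeting : Subset n → ℕ
    meeting B = ∑ (members (H B)) (λ Y → 𝟙 (not (avoids? B Y)))

    length-G : ∀ B → length (G B) + meeting B ≡ card (H B)
    length-G B = trans (cong (_+ meeting B) (length-filterᵇ (avoids? B) (members (H B))))
      (trans (sym (∑-+ (members (H B)) _ _)) (trans (∑-cong (members (H B)) (λ Y → 𝟙-not (avoids? B Y))) (sym (length≡∑1 (members (H B))))))

    meeting-≤ : ∀ B → meeting B ≤ ∑ (elements (other B)) (λ x → card (H B ⟨ ⁅ x ⁆ ⟩))
    meeting-≤ B = begin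
      meeting B
        ≤⟨ ∑-mono (members (H B)) per-Y ⟩
      ∑ (members (H B)) (λ Y → ∑ (elements (other B)) (λ x → 𝟙 (does (⁅ x ⁆ ⊆? Y))))
        ≡⟨ ∑-swap (members (H B)) (elements (other B)) _ ⟩
      ∑ (elements (other B)) (degree (members (H B)) ∘ ⁅_⁆)
        ≡⟨ ∑-cong (elements (other B)) (λ x → sym (card-link (H B) ⁅ x ⁆)) ⟩
      ∑ (elements (other B)) (λ x → card (H B ⟨ ⁅ x ⁆ ⟩)) ∎
      where
      open ≤-Reasoning
      hit : ∀ Y → Dec (Nonempty (Y ∩ other B)) → ¬ Disjoint Y (other B) →
        1 ≤ ∑ (elements (other B)) (λ x → 𝟙 (does (⁅ x ⁆ ⊆? Y)))
      hit Y (no empty)     meets = ⊥-elim (meets empty)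
      hit Y (yes (x , x∈)) meets =
        let x∈Y , x∈o = x∈p∩q⁻ Y (other B) x∈
        in ≤-trans (≤-reflexive (sym (T⇒𝟙 (T-does⁺ (⁅ x ⁆ ⊆? Y) λ y∈ → subst (_∈ˢ Y) (sym (x∈⁅y⁆⇒x≡y x y∈)) x∈Y))))
             (∑-term (λ x → 𝟙 (does (⁅ x ⁆ ⊆? Y))) (∈-elements x∈o))
      per-Y : ∀ Y → 𝟙 (not (avoids? B Y)) ≤ ∑ (elements (other B)) (λ x → 𝟙 (does (⁅ x ⁆ ⊆? Y)))
      per-Y Y = 𝟙≤ _ λ t → hit Y (nonempty? (Y ∩ other B)) (T-not-does⁻ (disjoint? Y (other B)) t)

    -- When `w` is 0 there is nothing to cancel and the inequality is void; the last premise then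
    -- settles the claim, as no element has to be avoided.
    half-meets : ∀ w m e h → e ≤ w → m * (2 * w) ≤ e * h → (w ≡ 0 → m ≡ 0) → 2 * m ≤ h
    half-meets zero    m e h _   _  z rewrite z refl = z≤n
    half-meets (suc w) m e h e≤w le _ = *-cancelˡ-≤ (suc w) (≤-trans (≤-reflexive (lemma (suc w) m)) (≤-trans le (*-monoˡ-≤ h e≤w)))
      where
      lemma : ∀ w m → w * (2 * m) ≡ m * (2 * w)
      lemma = solve-∀

    -- For `w` > 0, spreadness at singletons puts each point into at most a 1/(2w) share of the
    -- link, and at most `w` points have to be avoided.
    comparable : ∀ {B} → B ∈ bs → card (H B) ≤ 2 * length (G B)
    comparable {B} B∈ = conclude (length (G B)) (meeting B) (card (H B)) (length-G B)
      (half-meets w (meeting B) ∣ other B ∣ (card (H B)) (∣other∣≤ B∈) double none)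
      where
      open ≤-Reasoning
      w = (s ∸ 1) * q
      conclude : ∀ g m h → g + m ≡ h → 2 * m ≤ h → h ≤ 2 * g
      conclude g m h refl le = +-cancelʳ-≤ (g + m) (g + m) (2 * g) (≤-trans (≤-reflexive (lemma g m)) (+-monoʳ-≤ (2 * g) le))
        where
        lemma : ∀ g m → g + m + (g + m) ≡ 2 * g + 2 * m
        lemma = solve-∀
      per-x : ∀ x → card (H B ⟨ ⁅ x ⁆ ⟩) * (2 * w) ≤ card (H B)
      per-x x = ≤-trans (≤-reflexive (cong (card (H B ⟨ ⁅ x ⁆ ⟩) *_) (trans (sym (*-identityʳ _)) (cong ((2 * w) ^_) (sym (∣⁅x⁆∣≡1 x))))))
        (root-≤ {a = a} {b} {2 * w} d ∣ ⁅ x ⁆ ∣ (spread B∈ ⁅ x ⁆) b[2w]^d≤a)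
      double : meeting B * (2 * w) ≤ ∣ other B ∣ * card (H B)
      double = begin
        meeting B * (2 * w)  ≤⟨ *-monoˡ-≤ (2 * w) (meeting-≤ B) ⟩
        ∑ (elements (other B)) (λ x → card (H B ⟨ ⁅ x ⁆ ⟩)) * (2 * w) ≡⟨ ∑-*ʳ (elements (other B)) (2 * w) _ ⟨
        ∑ (elements (other B)) (λ x → card (H B ⟨ ⁅ x ⁆ ⟩) * (2 * w)) ≤⟨ ∑-mono (elements (other B)) per-x ⟩
        ∑ (elements (other B)) (λ _ → card (H B))  ≡⟨ ∑-const (elements (other B)) _ ⟩
        length (elements (other B)) * card (H B)   ≡⟨ cong (_* card (H B)) (length-elements (other B)) ⟩
        ∣ other B ∣ * card (H B) ∎
      none : w ≡ 0 → meeting B ≡ 0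
      none w≡0 = n≤0⇒n≡0 (≤-trans (meeting-≤ B) (≤-reflexive (empty (elements (other B))
        (n≤0⇒n≡0 (≤-trans (≤-reflexive (length-elements (other B))) (≤-trans (∣other∣≤ B∈) (≤-reflexive w≡0)))))))
        where
        empty : ∀ xs → length xs ≡ 0 → ∑ xs (λ x → card (H B ⟨ ⁅ x ⁆ ⟩)) ≡ 0
        empty [] _ = refl

    sizes : ∀ {B} → B ∈ bs → ∀ {Y} → Y ∈ G B → ∣ Y ∣ < 2 ^ L
    sizes {B} B∈ {Y} Y∈ =
      let F , F∈ , _ , eq = ∈-link⁻ 𝓕[ B ] {B} {Y} (∈-members⁻ (H B) (proj₁ (∈-filterᵇ⁻ (avoids? B) (members (H B)) Y∈)))
      in ≤-trans (s≤s (≤-trans (≤-reflexive (cong ∣_∣ eq)) (≤-trans (∣p─q∣≤∣p∣ F B) (≤-reflexive (uniform F (sub B∈ F F∈)))))) k<2^L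

    degrees : ∀ {B} → B ∈ bs → ∀ X → degree (G B) X * (128 * (2 * s * L)) ^ ∣ X ∣ ≤ card (H B)
    degrees {B} B∈ X = ≤-trans (*-monoˡ-≤ ((128 * (2 * s * L)) ^ ∣ X ∣) (≤-trans fewer (≤-reflexive (sym (card-link (H B) X)))))
      (root-≤ {a = a} {b} {128 * (2 * s * L)} d ∣ X ∣ (spread B∈ X) bR^d≤a)
      where
      fewer : degree (G B) X ≤ degree (members (H B)) X
      fewer = ≤-trans (≤-reflexive (∑-filterᵇ (avoids? B) (members (H B)) _))
        (∑-mono (members (H B)) λ Y → ≤-trans (*-monoˡ-≤ (𝟙 (does (X ⊆? Y))) (𝟙≤1 (avoids? B Y))) (≤-reflexive (*-identityˡ _)))

    G-spread : ∀ {B} → B ∈ bs → SpreadList s L (G B)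
    G-spread {B} B∈ = record
      { bound      = card (H B)
      ; sizes      = sizes B∈
      ; degrees    = degrees B∈
      ; nonempty   = positive (length (G B)) (≤-trans (card-nonempty⁺ {𝓖 = H B} (proj₂ (nonempty B∈))) (comparable B∈))
      ; comparable = comparable B∈
      }
      where
      positive : ∀ g → 1 ≤ 2 * g → 1 ≤ g
      positive (suc g) _ = s≤s z≤n

    Selected : Subset n × Subset n → Set
    Selected (B , Y) = B ∈ bs × Y ∈ᶠ H B × Disjoint Y (other B)

    join : Subset n × Subset n → Subset n
    join (B , Y) = Y ∪ B

    join-∈ : ∀ {m} → Selected m → join m ∈ᶠ 𝓕
    join-∈ {B , Y} (B∈ , Y∈ , _) =
      let F , F∈ , B⊆F , eq = ∈-link⁻ 𝓕[ B ] Y∈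
      in subst (_∈ᶠ 𝓕) (sym (trans (cong (_∪ B) eq) (∪-─-cancel (λ {x} → B⊆F {x})))) (sub B∈ F F∈)

    -- In the mixed cases `Y` avoids `other B`, which contains all of `B′` because `B` and `B′` are
    -- disjoint.
    join-disjoint : ∀ {m m′} → Selected m → Selected m′ → Disjoint (proj₁ m) (proj₁ m′) → Disjoint (proj₂ m) (proj₂ m′) →
      Disjoint (join m) (join m′)
    join-disjoint {B , Y} {B′ , Y′} (B∈ , _ , Y∥) (B′∈ , _ , Y′∥) B∥B′ Y∥Y′ (x , x∈)
      with x∈m , x∈m′ ← x∈p∩q⁻ (Y ∪ B) (Y′ ∪ B′) x∈ with x∈p∪q⁻ Y B x∈m | x∈p∪q⁻ Y′ B′ x∈m′
    ... | inj₁ x∈Y | inj₁ x∈Y′ = Y∥Y′ (x , x∈p∩q⁺ (x∈Y , x∈Y′))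
    ... | inj₂ x∈B | inj₂ x∈B′ = B∥B′ (x , x∈p∩q⁺ (x∈B , x∈B′))
    ... | inj₁ x∈Y | inj₂ x∈B′ = Y∥ (x , x∈p∩q⁺ (x∈Y , x∈p∧x∉q⇒x∈p─q (∈-⋃ B′∈ x∈B′) λ x∈B → B∥B′ (x , x∈p∩q⁺ (x∈B , x∈B′))))
    ... | inj₂ x∈B | inj₁ x∈Y′ = Y′∥ (x , x∈p∩q⁺ (x∈Y′ , x∈p∧x∉q⇒x∈p─q (∈-⋃ B∈ x∈B) λ x∈B′ → B∥B′ (x , x∈p∩q⁺ (x∈B , x∈B′))))

    -- Members have `k` ≥ 1 elements, and a nonempty set meets itself. Hence pairwise disjoint
    -- members are distinct, as counting them in `ν` requires.
    disjoint⇒≢ : ∀ {F F′} → F ∈ᶠ 𝓕 → Disjoint F F′ → F ≢ F′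
    disjoint⇒≢ {F} F∈ disj refl = search (nonempty? F)
      where
      search : Dec (Nonempty F) → Void
      search (yes (x , x∈)) = disj (x , x∈p∩q⁺ (x∈ , x∈))
      search (no empty) = contradiction
        (subst (_≤ 0) (uniform F F∈) (≤-trans (p⊆q⇒∣p∣≤∣q∣ {q = ⊥} λ {x} x∈ → contradiction (x , x∈) empty)
          (≤-reflexive (∣⊥∣≡0 n)))) (<⇒≱ 1≤k)

    s≤ν : AllPairs Disjoint bs → s ≤ ν 𝓕
    s≤ν disj = finish (cross-matching {s} {L} 1≤s 1≤L G bs (≤-reflexive length-bs) (All.tabulate G-spread))
      where
      finish : (∃ λ (ms : List (Subset n × Subset n)) → map proj₁ ms ≡ bs × All (λ m → proj₂ m ∈ G (proj₁ m)) ms ×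
        AllPairs (Disjoint on proj₂) ms) → s ≤ ν 𝓕
      finish (ms , eq , ∈G , disj′) = subst (_≤ ν 𝓕) length-joins (matching⇒≤ν 𝓕 unique members-𝓕 pairwise)
        where
        selected : All Selected ms
        selected = All.tabulate λ {m} m∈ →
          let Y∈ , av = ∈-filterᵇ⁻ (avoids? (proj₁ m)) (members (H (proj₁ m))) (All.lookup ∈G m∈)
          in subst (proj₁ m ∈_) eq (∈-map⁺ proj₁ m∈) , ∈-members⁻ (H (proj₁ m)) Y∈ , T-does⁻ (disjoint? (proj₂ m) (other (proj₁ m))) av
        members-𝓕 : All (_∈ᶠ 𝓕) (map join ms)
        members-𝓕 = All.map⁺ (All.map (λ {m} → join-∈ {m}) selected)
        pairwise : AllPairs Disjoint (map join ms)
        pairwise = AllPairs.map⁺ (allPairs-combine (λ {m} {m′} → join-disjoint {m} {m′}) selected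
          (AllPairs.map⁻ (subst (AllPairs Disjoint) (sym eq) disj)) disj′)
        unique : Unique (map join ms)
        unique = distinct members-𝓕 pairwise
          where
          distinct : ∀ {Fs} → All (_∈ᶠ 𝓕) Fs → AllPairs Disjoint Fs → Unique Fs
          distinct []         []       = []
          distinct (F∈ ∷ Fs∈) (d ∷ ds) = All.map (disjoint⇒≢ F∈) d ∷ distinct Fs∈ ds
        length-joins : length (map join ms) ≡ s
        length-joins = trans (length-map join ms) (trans (sym (length-map proj₁ ms)) (trans (cong length eq) length-bs))

  ν-approximation : ν 𝓕 < s → (𝓢 : Family n) → AtMost q 𝓢 →
    (∀ B → B ∈ᶠ 𝓢 → ∃ λ (𝓕B : Family n) → 𝓕B ⊆ᶠ 𝓕 × NonemptyFamily (𝓕B ⟨ B ⟩) × RootSpread d a b (𝓕B ⟨ B ⟩)) →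
    ν 𝓢 < s
  ν-approximation ν𝓕<s 𝓢 small wit = ≰⇒> λ s≤ν𝓢 → refute (≤ν⇒matching 𝓢 s 1≤s s≤ν𝓢)
    where
    -- A family is needed for every `B`; the empty default is harmless since the matching consists
    -- of members of `𝓢`.
    fam : ∀ B → Dec (B ∈ᶠ 𝓢) → Family n
    fam B (yes B∈) = proj₁ (wit B B∈)
    fam B (no _)   = λ _ → false
    fam-ok : ∀ B (B∈? : Dec (B ∈ᶠ 𝓢)) → B ∈ᶠ 𝓢 →
      fam B B∈? ⊆ᶠ 𝓕 × NonemptyFamily (fam B B∈? ⟨ B ⟩) × RootSpread d a b (fam B B∈? ⟨ B ⟩)
    fam-ok B (yes B∈) _  = proj₂ (wit B B∈)
    fam-ok B (no B∉)  B∈ = contradiction B∈ B∉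
    refute : (∃ λ bs → length bs ≡ s × All (_∈ᶠ 𝓢) bs × AllPairs Disjoint bs) → Void
    refute (bs , len , bs⊆ , disj) = <⇒≱ ν𝓕<s (Links.s≤ν bs len (λ {B} B∈ → small B (All.lookup bs⊆ B∈))
      (λ B → fam B (T? (𝓢 B)))
      (λ {B} B∈ → proj₁ (ok B∈)) (λ {B} B∈ → proj₁ (proj₂ (ok B∈))) (λ {B} B∈ → proj₂ (proj₂ (ok B∈))) disj)
      where
      ok : ∀ {B} → B ∈ bs → _
      ok {B} B∈ = fam-ok B (T? (𝓢 B)) (All.lookup bs⊆ B∈)

-- Rational approximations of cuts

ℚ-<⇒≱ : ∀ {p q} → p ℚ.< q → ¬ q ℚ.≤ p
ℚ-<⇒≱ lt le = ℚ.<-irrefl refl (ℚ.<-≤-trans lt le)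

ι : ℕ → ℚ
ι m = ℤ.+ m ℚ./ 1

ι≡ : ∀ m → ι m ≡ mkℚ (ℤ.+ m) 0 (Coprimality.sym (Coprimality.1-coprimeTo m))
ι≡ m = ℚ.↥p/↧p≡p (mkℚ (ℤ.+ m) 0 (Coprimality.sym (Coprimality.1-coprimeTo m)))

ι-mono-≤ : ∀ {m n} → m ≤ n → ι m ℚ.≤ ι n
ι-mono-≤ {m} {n} le = subst₂ ℚ._≤_ (sym (ι≡ m)) (sym (ι≡ n))
  (*≤* (subst₂ ℤ._≤_ (sym (ℤ.*-identityʳ (ℤ.+ m))) (sym (ℤ.*-identityʳ (ℤ.+ n))) (ℤ.+≤+ le)))

ι-mono-< : ∀ {m n} → m < n → ι m ℚ.< ι n
ι-mono-< {m} {n} lt = subst₂ ℚ._<_ (sym (ι≡ m)) (sym (ι≡ n))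
  (*<* (subst₂ ℤ._<_ (sym (ℤ.*-identityʳ (ℤ.+ m))) (sym (ℤ.*-identityʳ (ℤ.+ n))) (ℤ.+<+ lt)))

ι-cancel-≤ : ∀ {m n} → ι m ℚ.≤ ι n → m ≤ n
ι-cancel-≤ {m} {n} le = ≮⇒≥ λ lt → ℚ-<⇒≱ (ι-mono-< lt) le

ι-cancel-< : ∀ {m n} → ι m ℚ.< ι n → m < n
ι-cancel-< {m} {n} lt = ≰⇒> λ le → ℚ-<⇒≱ lt (ι-mono-≤ le)

toℚᵘ-ι : ∀ m → toℚᵘ (ι m) ℚᵘ.≃ mkℚᵘ (ℤ.+ m) 0
toℚᵘ-ι m = ℚ.toℚᵘ-fromℚᵘ (mkℚᵘ (ℤ.+ m) 0)

ι-* : ∀ m n → ι m ℚ.* ι n ≡ ι (m * n)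
ι-* m n = begin
  ι m ℚ.* ι n                ≡⟨ cong₂ ℚ._*_ (ι≡ m) (ι≡ n) ⟩
  ((ℤ.+ m) ℤ.* (ℤ.+ n)) ℚ./ 1    ≡⟨ cong (ℚ._/ 1) (sym (ℤ.pos-* m n)) ⟩
  ι (m * n) ∎
  where open ≡-Reasoning

0≤ι : ∀ m → 0ℚ ℚ.≤ ι m
0≤ι m = ι-mono-≤ {0} {m} z≤n

fraction : ∀ u → 0ℚ ℚ.< u → ∃₂ λ P Q → 1 ≤ P × 1 ≤ Q × u ℚ.* ι Q ≡ ι P
fraction (mkℚ (ℤ.+ zero)   d c) (*<* (ℤ.+<+ ()))
fraction (mkℚ -[1+ _ ]   d c) (*<* ())
fraction u@(mkℚ (ℤ.+ suc p) d c) _ = suc p , suc d , s≤s z≤n , s≤s z≤n , ℚ.toℚᵘ-injective (begin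
  toℚᵘ (u ℚ.* ι (suc d))              ≈⟨ ℚ.toℚᵘ-homo-* u (ι (suc d)) ⟩
  toℚᵘ u ℚᵘ.* toℚᵘ (ι (suc d))        ≈⟨ ℚᵘ.*-congˡ {toℚᵘ u} (toℚᵘ-ι (suc d)) ⟩
  toℚᵘ u ℚᵘ.* mkℚᵘ (ℤ.+ suc d) 0
    ≈⟨ *≡* (trans (ℤ.*-identityʳ ((ℤ.+ suc p) ℤ.* (ℤ.+ suc d)))
         (cong (λ z → (ℤ.+ suc p) ℤ.* (ℤ.+ z)) (sym (*-identityʳ (suc d))))) ⟩
  mkℚᵘ (ℤ.+ suc p) 0                    ≈⟨ toℚᵘ-ι (suc p) ⟨
  toℚᵘ (ι (suc p)) ∎)
  where open ℚᵘ.≃-Reasoning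

pow : ℚ → ℕ → ℚ
pow u zero    = 1ℚ
pow u (suc j) = u ℚ.* pow u j

private
  *-pos : ∀ {p q} → 0ℚ ℚ.< p → 0ℚ ℚ.< q → 0ℚ ℚ.< p ℚ.* q
  *-pos {p} {q} 0<p 0<q = ℚ.positive⁻¹ (p ℚ.* q) {{ℚ.pos*pos⇒pos p {{ℚ.positive 0<p}} q {{ℚ.positive 0<q}}}}

  monoˡ-≤ : ∀ r {p q} → 0ℚ ℚ.≤ r → p ℚ.≤ q → r ℚ.* p ℚ.≤ r ℚ.* q
  monoˡ-≤ r 0≤r = ℚ.*-monoˡ-≤-nonNeg r {{ℚ.nonNegative 0≤r}}

  monoʳ-≤ : ∀ r {p q} → 0ℚ ℚ.≤ r → p ℚ.≤ q → p ℚ.* r ℚ.≤ q ℚ.* r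
  monoʳ-≤ r 0≤r = ℚ.*-monoʳ-≤-nonNeg r {{ℚ.nonNegative 0≤r}}

  monoˡ-< : ∀ r {p q} → 0ℚ ℚ.< r → p ℚ.< q → r ℚ.* p ℚ.< r ℚ.* q
  monoˡ-< r 0<r = ℚ.*-monoʳ-<-pos r {{ℚ.positive 0<r}}

  monoʳ-< : ∀ r {p q} → 0ℚ ℚ.< r → p ℚ.< q → p ℚ.* r ℚ.< q ℚ.* r
  monoʳ-< r 0<r = ℚ.*-monoˡ-<-pos r {{ℚ.positive 0<r}}

  cancelʳ-≤ : ∀ r {p q} → 0ℚ ℚ.< r → p ℚ.* r ℚ.≤ q ℚ.* r → p ℚ.≤ q
  cancelʳ-≤ r 0<r = ℚ.*-cancelʳ-≤-pos r {{ℚ.positive 0<r}}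

  interchange : ∀ p q r s → (p ℚ.* q) ℚ.* (r ℚ.* s) ≡ (p ℚ.* r) ℚ.* (q ℚ.* s)
  interchange p q r s = begin
    (p ℚ.* q) ℚ.* (r ℚ.* s)   ≡⟨ ℚ.*-assoc p q (r ℚ.* s) ⟩
    p ℚ.* (q ℚ.* (r ℚ.* s))   ≡⟨ cong (p ℚ.*_) (trans (sym (ℚ.*-assoc q r s)) (trans (cong (ℚ._* s) (ℚ.*-comm q r)) (ℚ.*-assoc r q s))) ⟩
    p ℚ.* (r ℚ.* (q ℚ.* s))   ≡⟨ ℚ.*-assoc p r (q ℚ.* s) ⟨
    (p ℚ.* r) ℚ.* (q ℚ.* s) ∎
    where open ≡-Reasoning

  0<1 : 0ℚ ℚ.< 1ℚ
  0<1 = ι-mono-< {0} {1} (s≤s z≤n)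

inverse : ∀ u → 0ℚ ℚ.< u → ∃ λ α → 0ℚ ℚ.< α × u ℚ.* α ≡ 1ℚ
inverse u 0<u = (1/ u) {{u≢0}} , ℚ.positive⁻¹ _ {{ℚ.1/pos⇒pos u {{ℚ.positive 0<u}}}} , ℚ.*-inverseʳ u {{u≢0}}
  where
  u≢0 : ℚ.NonZero u
  u≢0 = ℚ.pos⇒nonZero u {{ℚ.positive 0<u}}

pow-pos : ∀ {u} → 0ℚ ℚ.< u → ∀ j → 0ℚ ℚ.< pow u j
pow-pos 0<u zero    = 0<1
pow-pos 0<u (suc j) = *-pos 0<u (pow-pos 0<u j)

pow-* : ∀ u v j → pow u j ℚ.* pow v j ≡ pow (u ℚ.* v) j
pow-* u v zero    = refl
pow-* u v (suc j) = trans (interchange u (pow u j) v (pow v j)) (cong ((u ℚ.* v) ℚ.*_) (pow-* u v j))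

pow-ι : ∀ m j → pow (ι m) j ≡ ι (m ^ j)
pow-ι m zero    = refl
pow-ι m (suc j) = trans (cong (ι m ℚ.*_) (pow-ι m j)) (ι-* m (m ^ j))

pow-1 : ∀ j → pow 1ℚ j ≡ 1ℚ
pow-1 zero    = refl
pow-1 (suc j) = trans (ℚ.*-identityˡ (pow 1ℚ j)) (pow-1 j)

pow-mono : ∀ {u v} → 0ℚ ℚ.< u → u ℚ.≤ v → ∀ j → pow u j ℚ.≤ pow v j
pow-mono 0<u u≤v zero    = ℚ.≤-refl
pow-mono {u} {v} 0<u u≤v (suc j) = ℚ.≤-trans (monoˡ-≤ u (ℚ.<⇒≤ 0<u) (pow-mono 0<u u≤v j))
  (monoʳ-≤ (pow v j) (ℚ.<⇒≤ (pow-pos (ℚ.<-≤-trans 0<u u≤v) j)) u≤v)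

module _ {u : ℚ} {P Q : ℕ} (1≤Q : 1 ≤ Q) (uQ≡P : u ℚ.* ι Q ≡ ι P) where

  private
    clear : ∀ x j → ι x ℚ.* pow u j ℚ.* ι (Q ^ j) ≡ ι (x * P ^ j)
    clear x j = begin
      ι x ℚ.* pow u j ℚ.* ι (Q ^ j)          ≡⟨ ℚ.*-assoc (ι x) (pow u j) _ ⟩
      ι x ℚ.* (pow u j ℚ.* ι (Q ^ j))        ≡⟨ cong (λ z → ι x ℚ.* (pow u j ℚ.* z)) (pow-ι Q j) ⟨
      ι x ℚ.* (pow u j ℚ.* pow (ι Q) j)      ≡⟨ cong (ι x ℚ.*_) (trans (pow-* u (ι Q) j) (trans (cong (λ z → pow z j) uQ≡P) (pow-ι P j))) ⟩
      ι x ℚ.* ι (P ^ j)                      ≡⟨ ι-* x (P ^ j) ⟩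
      ι (x * P ^ j) ∎
      where open ≡-Reasoning
    0<Q^j : ∀ j → 0ℚ ℚ.< ι (Q ^ j)
    0<Q^j j = ι-mono-< (m^n>0 Q {{>-nonZero 1≤Q}} j)

  clear-≤ : ∀ x y j → ι x ℚ.* pow u j ℚ.≤ ι y → x * P ^ j ≤ y * Q ^ j
  clear-≤ x y j le = ι-cancel-≤ (subst₂ ℚ._≤_ (clear x j) (ι-* y (Q ^ j)) (monoʳ-≤ (ι (Q ^ j)) (ℚ.<⇒≤ (0<Q^j j)) le))

  unclear-≤ : ∀ x y j → x * P ^ j ≤ y * Q ^ j → ι x ℚ.* pow u j ℚ.≤ ι y
  unclear-≤ x y j le = cancelʳ-≤ (ι (Q ^ j)) (0<Q^j j) (subst₂ ℚ._≤_ (sym (clear x j)) (sym (ι-* y (Q ^ j))) (ι-mono-≤ le))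

  clear-< : ∀ N → ι N ℚ.< u → N * Q < P
  clear-< N lt = ι-cancel-< (subst₂ ℚ._<_ (ι-* N Q) uQ≡P (monoʳ-< (ι Q) (ι-mono-< 1≤Q) lt))

-- Membership in the upper cut of a product needs each factor strictly inside its own cut; density
-- of the rationals supplies the slack.
enlarge : ∀ {β y p} → 0ℚ ℚ.< β → β ℚ.* y ℚ.< p → ∃ λ E → y ℚ.< E × β ℚ.* E ℚ.< p
enlarge {β} {y} {p} 0<β lt with α , 0<α , βα≡1 ← inverse β 0<β with p′ , lo , hi ← ℚ.<-dense lt =
  α ℚ.* p′
  , subst (ℚ._< α ℚ.* p′) (αβ y) (monoˡ-< α 0<α lo)
  , subst (ℚ._< p) (sym (trans (sym (ℚ.*-assoc β α p′)) (trans (cong (ℚ._* p′) βα≡1) (ℚ.*-identityˡ p′)))) hi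
  where
  αβ : ∀ z → α ℚ.* (β ℚ.* z) ≡ z
  αβ z = trans (sym (ℚ.*-assoc α β z)) (trans (cong (ℚ._* z) (trans (ℚ.*-comm α β) βα≡1)) (ℚ.*-identityˡ z))

upper-^ᶜ : ∀ (x : Cut) {α} → upper x α → 0ℚ ℚ.< α → ∀ j {p} → pow α j ℚ.< p → upper (x ^ᶜ j) p
upper-^ᶜ x α∈ 0<α zero    lt = lt
upper-^ᶜ x {α} α∈ 0<α (suc j) lt with E , lo , hi ← enlarge 0<α lt = α , E , α∈ , upper-^ᶜ x α∈ 0<α j lo , hi

power-step : ∀ {a b A u v t j} → 0ℚ ℚ.< a → 0ℚ ℚ.< b → 0ℚ ℚ.< u → 0ℚ ℚ.< t →
  ι 2 ℚ.≤ a ℚ.* v → ι (2 ^ j) ℚ.≤ b ℚ.* pow u j → a ℚ.* b ℚ.≤ A → v ℚ.≤ t → u ℚ.≤ t →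
  ι (2 ^ suc j) ℚ.≤ A ℚ.* pow t (suc j)
power-step {a} {b} {A} {u} {v} {t} {j} 0<a 0<b 0<u 0<t 2≤av 2^j≤ ab≤A v≤t u≤t = begin
  ι (2 ^ suc j)                      ≡⟨ ι-* 2 (2 ^ j) ⟨
  ι 2 ℚ.* ι (2 ^ j)                  ≤⟨ monoʳ-≤ (ι (2 ^ j)) (0≤ι (2 ^ j)) (ℚ.≤-trans 2≤av (monoˡ-≤ a (ℚ.<⇒≤ 0<a) v≤t)) ⟩
  (a ℚ.* t) ℚ.* ι (2 ^ j)            ≤⟨ monoˡ-≤ (a ℚ.* t) (ℚ.<⇒≤ (*-pos 0<a 0<t))
                                          (ℚ.≤-trans 2^j≤ (monoˡ-≤ b (ℚ.<⇒≤ 0<b) (pow-mono 0<u u≤t j))) ⟩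
  (a ℚ.* t) ℚ.* (b ℚ.* pow t j)      ≡⟨ interchange a t b (pow t j) ⟩
  (a ℚ.* b) ℚ.* (t ℚ.* pow t j)      ≤⟨ monoʳ-≤ (t ℚ.* pow t j) (ℚ.<⇒≤ (pow-pos 0<t (suc j))) ab≤A ⟩
  A ℚ.* pow t (suc j) ∎
  where open ℚ.≤-Reasoning

module _ (r : ℝ) where
  open IsDedekind (proj₂ r)

  private
    R = cut r

  -- If `ι e` were below `ι c` times `pow u j`, the slack would place `ι c` in the upper cut on the
  -- right, hence strictly above itself. The inverse of `u` is available there because roundedness
  -- gives a larger rational still below `r`.
  ≤ᶜ⇒≤ : ∀ {u c e j} → lower R u → 0ℚ ℚ.< u →
    fromℕ c ≤ᶜ ((R ⁻¹) ^ᶜ j) *ᶜ fromℕ e → ι c ℚ.* pow u j ℚ.≤ ι e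
  ≤ᶜ⇒≤ {u} {c} {e} {j} u∈ 0<u le = ℚ.≮⇒≥ λ lt → absurd lt
    where
    cancel : ∀ {α} → u ℚ.* α ≡ 1ℚ → pow α j ℚ.* (ι c ℚ.* pow u j) ≡ ι c
    cancel {α} uα≡1 = begin
      pow α j ℚ.* (ι c ℚ.* pow u j)   ≡⟨ ℚ.*-comm (pow α j) _ ⟩
      (ι c ℚ.* pow u j) ℚ.* pow α j   ≡⟨ ℚ.*-assoc (ι c) (pow u j) (pow α j) ⟩
      ι c ℚ.* (pow u j ℚ.* pow α j)   ≡⟨ cong (ι c ℚ.*_) (trans (pow-* u α j) (trans (cong (λ z → pow z j) uα≡1) (pow-1 j))) ⟩
      ι c ℚ.* 1ℚ                      ≡⟨ ℚ.*-identityʳ (ι c) ⟩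
      ι c ∎
      where open ≡-Reasoning
    absurd : ι e ℚ.< ι c ℚ.* pow u j → Void
    absurd lt =
      let u′ , u<u′ , u′∈ = Equivalence.to (lower-rounded u) u∈
          α , 0<α , uα≡1 = inverse u 0<u
          E , e<E , α^jE<c = enlarge {pow α j} {ι e} {ι c} (pow-pos 0<α j)
            (subst (pow α j ℚ.* ι e ℚ.<_) (cancel uα≡1) (monoˡ-< (pow α j) (pow-pos 0<α j) lt))
          A , α^j<A , EA<c = enlarge {E} {pow α j} {ι c} (ℚ.≤-<-trans (0≤ι e) e<E)
            (subst (ℚ._< ι c) (ℚ.*-comm (pow α j) E) α^jE<c)
          α∈ = u′ , ℚ.<-trans 0<u u<u′ , u′∈
             , subst (ℚ._< α ℚ.* u′) (trans (ℚ.*-comm α u) uα≡1) (monoˡ-< α 0<α u<u′)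
      in ℚ.<-irrefl refl (le (ι c) (A , E , upper-^ᶜ (R ⁻¹) α∈ 0<α j α^j<A , e<E , subst (ℚ._< ι c) (ℚ.*-comm E A) EA<c))

  -- `A` is at least (2/u)^j for one positive rational `u` below `r`.
  PowerBound : ℕ → ℚ → Set
  PowerBound j A = ∃ λ u → lower R u × 0ℚ ℚ.< u × 0ℚ ℚ.< A × ι (2 ^ j) ℚ.≤ A ℚ.* pow u j

  upper-half⁻¹ : ∀ {A} → upper (half R ⁻¹) A → ∃ λ v → lower R v × 0ℚ ℚ.< v × 0ℚ ℚ.< A × ι 2 ℚ.≤ A ℚ.* v
  upper-half⁻¹ {A} (h , 0<h , inj₁ h<0 , _) = ⊥-elim (ℚ.<-asym 0<h h<0)
  upper-half⁻¹ {A} (h , 0<h , inj₂ (v , w , 0≤v , 0≤w , v∈ , w<½ , h<vw) , 1<Ah) =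
    v , v∈ , 0<v , 0<A , two
    where
    h<v½ : h ℚ.< v ℚ.* ½
    h<v½ = ℚ.<-≤-trans h<vw (monoˡ-≤ v 0≤v (ℚ.<⇒≤ w<½))
    0<v : 0ℚ ℚ.< v
    0<v = ℚ.*-cancelʳ-<-nonNeg ½ (subst (ℚ._< v ℚ.* ½) (sym (ℚ.*-zeroˡ ½)) (ℚ.<-trans 0<h h<v½))
    0<A : 0ℚ ℚ.< A
    0<A = ℚ.*-cancelʳ-<-nonNeg h {{ℚ.nonNegative (ℚ.<⇒≤ 0<h)}} (subst (ℚ._< A ℚ.* h) (sym (ℚ.*-zeroˡ h)) (ℚ.<-trans 0<1 1<Ah))
    two : ι 2 ℚ.≤ A ℚ.* v
    two = cancelʳ-≤ ½ (ℚ.positive⁻¹ ½) (ℚ.<⇒≤ (ℚ.<-trans 1<Ah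
      (subst (A ℚ.* h ℚ.<_) (sym (ℚ.*-assoc A v ½)) (monoˡ-< A 0<A h<v½))))

  -- Each factor brings its own rational below `r`. Of two such rationals the larger serves both
  -- bounds, and `u₀` serves the empty power.
  upper-half⁻¹-^ᶜ : ∀ {u₀} → lower R u₀ → 0ℚ ℚ.< u₀ → ∀ j {A} → upper ((half R ⁻¹) ^ᶜ j) A → PowerBound j A
  upper-half⁻¹-^ᶜ {u₀} u₀∈ 0<u₀ zero    {A} 1<A =
    u₀ , u₀∈ , 0<u₀ , ℚ.<-trans 0<1 1<A , ℚ.≤-trans (ℚ.<⇒≤ 1<A) (ℚ.≤-reflexive (sym (ℚ.*-identityʳ A)))
  upper-half⁻¹-^ᶜ {u₀} u₀∈ 0<u₀ (suc j) {A} (a , b , a∈ , b∈ , ab<A)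
    with v , v∈ , 0<v , 0<a , 2≤av ← upper-half⁻¹ {a} a∈
    with u , u∈ , 0<u , 0<b , 2^j≤ ← upper-half⁻¹-^ᶜ u₀∈ 0<u₀ j {b} b∈
    with ℚ.≤-total u v
  ... | inj₁ u≤v = v , v∈ , 0<v , ℚ.<-trans (*-pos {a} {b} 0<a 0<b) ab<A
    , power-step {a} {b} {A} {u} {v} {j = j} 0<a 0<b 0<u 0<v 2≤av 2^j≤ (ℚ.<⇒≤ ab<A) ℚ.≤-refl u≤v
  ... | inj₂ v≤u = u , u∈ , 0<u , ℚ.<-trans (*-pos {a} {b} 0<a 0<b) ab<A
    , power-step {a} {b} {A} {u} {v} {j = j} 0<a 0<b 0<u 0<u 2≤av 2^j≤ (ℚ.<⇒≤ ab<A) v≤u ℚ.≤-refl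

  ≤⇒≤ᶜ-half : ∀ {u₀} → lower R u₀ → 0ℚ ℚ.< u₀ → ∀ c e j →
    (∀ {u} → lower R u → 0ℚ ℚ.< u → ι c ℚ.* pow u j ℚ.≤ ι (e * 2 ^ j)) →
    fromℕ c ≤ᶜ ((half R ⁻¹) ^ᶜ j) *ᶜ fromℕ e
  ≤⇒≤ᶜ-half u₀∈ 0<u₀ c e j hyp p (A , E , A∈ , e<E , AE<p)
    with u , u∈ , 0<u , 0<A , 2^j≤ ← upper-half⁻¹-^ᶜ u₀∈ 0<u₀ j A∈ =
    ℚ.≤-<-trans c≤eA (ℚ.≤-<-trans (ℚ.≤-trans (ℚ.≤-reflexive (ℚ.*-comm (ι e) A)) (monoˡ-≤ A (ℚ.<⇒≤ 0<A) (ℚ.<⇒≤ e<E))) AE<p)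
    where
    c≤eA : ι c ℚ.≤ ι e ℚ.* A
    c≤eA = cancelʳ-≤ (pow u j) (pow-pos 0<u j) (ℚ.≤-trans (hyp u∈ 0<u)
      (ℚ.≤-trans (ℚ.≤-reflexive (sym (ι-* e (2 ^ j))))
      (ℚ.≤-trans (monoˡ-≤ (ι e) (0≤ι e) 2^j≤) (ℚ.≤-reflexive (sym (ℚ.*-assoc (ι e) A (pow u j)))))))

unit-fraction-≤1 : ∀ D .{{_ : NonZero D}} → (ℤ.+ 1) ℚ./ D ℚ.≤ 1ℚ
unit-fraction-≤1 (suc d) = ℚ.toℚᵘ-cancel-≤ (ℚᵘ.≤-respˡ-≃ (ℚᵘ.≃-sym (ℚ.toℚᵘ-fromℚᵘ (mkℚᵘ (ℤ.+ 1) d)))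
  (ℚᵘ.*≤* (ℤ.+≤+ (s≤s z≤n))))

-- For β = t/D in the upper cut, 2^(LD) ≤ m^D < 2^t gives LD < t. A negative β is impossible, since
-- 2^t ≤ 1 ≤ m^D.
log₂-lower-bound : ∀ {m L} → 2 ^ L ≤ m → ∀ {β} → upper (log₂ m) β → ι L ℚ.≤ β
log₂-lower-bound {m} {L} 2^L≤m {mkℚ -[1+ t ] d c} β∈ =
  contradiction (ℚ.<-≤-trans β∈ (unit-fraction-≤1 (2 ^ suc t) {{m^n≢0 2 (suc t)}}))
    (λ lt → ℚ-<⇒≱ lt (ι-mono-≤ (m^n>0 m {{>-nonZero (≤-trans (m^n>0 2 L) 2^L≤m)}} (suc d))))
log₂-lower-bound {m} {L} 2^L≤m {mkℚ (ℤ.+ t) d c} β∈ = subst (ℚ._≤ mkℚ (ℤ.+ t) d c) (sym (ι≡ L))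
  (*≤* (subst₂ ℤ._≤_ (ℤ.pos-* L (suc d)) (sym (ℤ.*-identityʳ (ℤ.+ t))) (ℤ.+≤+ (<⇒≤ L*d<t))))
  where
  open ≤-Reasoning
  L*d<t : L * suc d < t
  L*d<t = ≰⇒> λ le → <⇒≱ (ι-cancel-< β∈) (begin
    2 ^ t             ≤⟨ ^-monoʳ-≤ 2 le ⟩
    2 ^ (L * suc d)   ≡⟨ ^-*-assoc 2 L (suc d) ⟨
    (2 ^ L) ^ suc d   ≤⟨ ^-monoˡ-≤ (suc d) 2^L≤m ⟩
    m ^ suc d ∎)

threshold : ∀ {N M m L p} → 2 ^ L ≤ m → upper (fromℕ N ⊔ᶜ fromℕ M *ᶜ log₂ m) p → ι N ℚ.< p × ι (M * L) ℚ.< p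
threshold {N} {M} {m} {L} {p} 2^L≤m (N<p , α , β , M<α , β∈ , αβ<p) = N<p ,
  ℚ.≤-<-trans (ℚ.≤-trans (ℚ.≤-reflexive (sym (ι-* M L)))
    (ℚ.≤-trans (monoʳ-≤ (ι L) (0≤ι L) (ℚ.<⇒≤ M<α))
      (monoˡ-≤ α (ℚ.≤-trans (0≤ι M) (ℚ.<⇒≤ M<α)) (log₂-lower-bound {m} {L} 2^L≤m {β} β∈)))) αβ<p

-- The extremal spread parameter

-- `P` is carried along because the order has to be transitive only on it: for `RootOrder`
-- transitivity relies on cancelling positive numbers.
least : ∀ {_≲_ : A → A → Set} {P : A → Set} → (∀ {x y} → P x → P y → x ≲ y ⊎ y ≲ x) →
  (∀ {x y z} → P x → P y → P z → x ≲ y → y ≲ z → x ≲ z) →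
  ∀ x xs → All P (x ∷ xs) → ∃ λ y → P y × All (y ≲_) (x ∷ xs)
least {_≲_ = _≲_} total tr x []       (px ∷ []) = x , px , refl-≲ (total px px) ∷ []
  where
  refl-≲ : x ≲ x ⊎ x ≲ x → x ≲ x
  refl-≲ (inj₁ p) = p
  refl-≲ (inj₂ p) = p
least {_≲_ = _≲_} {P} total tr x (x′ ∷ xs) (px ∷ pxs) = choose (least total tr x′ xs pxs)
  where
  choose : (∃ λ y → P y × All (y ≲_) (x′ ∷ xs)) → ∃ λ y → P y × All (y ≲_) (x ∷ x′ ∷ xs)
  choose (y , py , y≲) with total px py
  ... | inj₂ y≲x = y , py , y≲x ∷ y≲
  ... | inj₁ x≲y = x , px , All.tabulate below
    where
    below : ∀ {z} → z ∈ x ∷ x′ ∷ xs → x ≲ z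
    below (here refl) with total px px
    ... | inj₁ p = p
    ... | inj₂ p = p
    below (there z∈) = tr px py (All.lookup pxs z∈) x≲y (All.lookup y≲ z∈)

-- (a/b)^(1/d) ≤ (a/b′)^(1/d′), with roots and denominators cleared.
RootOrder : (a d b d′ b′ : ℕ) → Set
RootOrder a d b d′ b′ = b′ ^ d * a ^ d′ ≤ a ^ d * b ^ d′

-- The d₃-th power of the first inequality times the d₁-th power of the second is the d₂-th power of
-- the claim, multiplied on both sides by `b₂ ^ (d₁ * d₃) * a ^ (d₁ * d₃)`.
rootOrder-trans : ∀ {a d₁ b₁ d₂ b₂ d₃ b₃} → 1 ≤ a → 1 ≤ d₂ → 1 ≤ b₂ →
  RootOrder a d₁ b₁ d₂ b₂ → RootOrder a d₂ b₂ d₃ b₃ → RootOrder a d₁ b₁ d₃ b₃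
rootOrder-trans {a} {d₁} {b₁} {d₂} {b₂} {d₃} {b₃} 1≤a 1≤d₂ 1≤b₂ le₁ le₂ =
  ^-cancelʳ-≤ d₂ {{>-nonZero 1≤d₂}} (*-cancelʳ-≤ _ _ (b₂ ^ (d₁ * d₃) * a ^ (d₁ * d₃))
    {{m*n≢0 _ _ {{m^n≢0 b₂ (d₁ * d₃) {{>-nonZero 1≤b₂}}}} {{m^n≢0 a (d₁ * d₃) {{>-nonZero 1≤a}}}}}} (begin
  (b₃ ^ d₁ * a ^ d₃) ^ d₂ * (x * y)
    ≡⟨ cong (_* (x * y)) (trans (^-distribʳ-* (b₃ ^ d₁) (a ^ d₃) d₂) (cong (_* (a ^ d₃) ^ d₂) (^-comm b₃ d₁ d₂))) ⟩
  (b₃ ^ d₂) ^ d₁ * (a ^ d₃) ^ d₂ * (x * y)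
    ≡⟨ cong₂ (λ v w → (b₃ ^ d₂) ^ d₁ * v * (x * w)) (^-comm a d₃ d₂) (trans (cong (a ^_) (*-comm d₁ d₃)) (sym (^-*-assoc a d₃ d₁))) ⟩
  (b₃ ^ d₂) ^ d₁ * (a ^ d₂) ^ d₃ * (x * (a ^ d₃) ^ d₁)
    ≡⟨ l₁ ((b₃ ^ d₂) ^ d₁) ((a ^ d₂) ^ d₃) x ((a ^ d₃) ^ d₁) ⟩
  x * (a ^ d₂) ^ d₃ * ((b₃ ^ d₂) ^ d₁ * (a ^ d₃) ^ d₁)
    ≡⟨ cong₂ _*_ (trans (cong (_* (a ^ d₂) ^ d₃) (sym (^-*-assoc b₂ d₁ d₃))) (sym (^-distribʳ-* (b₂ ^ d₁) (a ^ d₂) d₃)))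
                 (sym (^-distribʳ-* (b₃ ^ d₂) (a ^ d₃) d₁)) ⟩
  (b₂ ^ d₁ * a ^ d₂) ^ d₃ * (b₃ ^ d₂ * a ^ d₃) ^ d₁
    ≤⟨ *-mono-≤ (^-monoˡ-≤ d₃ le₁) (^-monoˡ-≤ d₁ le₂) ⟩
  (a ^ d₁ * b₁ ^ d₂) ^ d₃ * (a ^ d₂ * b₂ ^ d₃) ^ d₁
    ≡⟨ cong₂ _*_ (^-distribʳ-* (a ^ d₁) (b₁ ^ d₂) d₃) (^-distribʳ-* (a ^ d₂) (b₂ ^ d₃) d₁) ⟩
  ((a ^ d₁) ^ d₃ * (b₁ ^ d₂) ^ d₃) * ((a ^ d₂) ^ d₁ * (b₂ ^ d₃) ^ d₁)
    ≡⟨ cong₂ _*_ (cong₂ _*_ (^-*-assoc a d₁ d₃) (^-comm b₁ d₂ d₃))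
                 (cong₂ _*_ (^-comm a d₂ d₁) (trans (^-*-assoc b₂ d₃ d₁) (cong (b₂ ^_) (*-comm d₃ d₁)))) ⟩
  (y * (b₁ ^ d₃) ^ d₂) * ((a ^ d₁) ^ d₂ * x)
    ≡⟨ l₂ y ((b₁ ^ d₃) ^ d₂) ((a ^ d₁) ^ d₂) x ⟩
  (a ^ d₁) ^ d₂ * (b₁ ^ d₃) ^ d₂ * (x * y)
    ≡⟨ cong (_* (x * y)) (^-distribʳ-* (a ^ d₁) (b₁ ^ d₃) d₂) ⟨
  (a ^ d₁ * b₁ ^ d₃) ^ d₂ * (x * y) ∎))
  where
  open ≤-Reasoning
  x = b₂ ^ (d₁ * d₃)
  y = a ^ (d₁ * d₃)
  l₁ : ∀ p q r s → p * q * (r * s) ≡ r * q * (p * s)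
  l₁ = solve-∀
  l₂ : ∀ p q r s → p * q * (r * s) ≡ r * q * (s * p)
  l₂ = solve-∀

-- The largest r for which 𝓐 is r-spread satisfies r^|X| = |𝓐| / |𝓐(X)| for some X.
tightest-link : ∀ {k} → 1 ≤ k → (𝓐 : Family n) → Uniform k 𝓐 → NonemptyFamily 𝓐 →
  ∃ λ X → 1 ≤ ∣ X ∣ × 1 ≤ card (𝓐 ⟨ X ⟩) × RootSpread ∣ X ∣ (card 𝓐) (card (𝓐 ⟨ X ⟩)) 𝓐
tightest-link {n} {k} 1≤k 𝓐 uniform (F , F∈) = finish
  (least {_≲_ = _≲_} {Candidate} total
    (λ {X} {Y} {Z} _ (1≤d , 1≤b) _ →
      rootOrder-trans {a} {∣ X ∣} {card (𝓐 ⟨ X ⟩)} {∣ Y ∣} {card (𝓐 ⟨ Y ⟩)} {∣ Z ∣} {card (𝓐 ⟨ Z ⟩)} 1≤a 1≤d 1≤b)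
    F candidates (F-candidate ∷ All.tabulate (λ X∈ → proj₂ (∈-filter⁻ candidate? {xs = allSubsets n} X∈))))
  where
  a = card 𝓐
  1≤a : 1 ≤ a
  1≤a = card-nonempty⁺ {𝓖 = 𝓐} F∈
  _≲_ : Subset n → Subset n → Set
  X ≲ Y = RootOrder a (∣ X ∣) (card (𝓐 ⟨ X ⟩)) (∣ Y ∣) (card (𝓐 ⟨ Y ⟩))
  Candidate : Subset n → Set
  Candidate X = 1 ≤ ∣ X ∣ × 1 ≤ card (𝓐 ⟨ X ⟩)
  candidate? : ∀ X → Dec (Candidate X)
  candidate? X = (1 ≤? ∣ X ∣) ×-dec (1 ≤? card (𝓐 ⟨ X ⟩))
  candidates : List (Subset n)
  candidates = filter candidate? (allSubsets n)
  F-candidate : Candidate F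
  F-candidate = subst (1 ≤_) (sym (uniform F F∈)) 1≤k , card-nonempty⁺ {𝓖 = 𝓐 ⟨ F ⟩} (∈-link⁺ 𝓐 {F} F∈ (λ x∈ → x∈))
  total : ∀ {X Y} → Candidate X → Candidate Y → X ≲ Y ⊎ Y ≲ X
  total {X} {Y} _ _ = flip
    (card (𝓐 ⟨ Y ⟩) ^ ∣ X ∣) (a ^ ∣ Y ∣) (a ^ ∣ X ∣) (card (𝓐 ⟨ X ⟩) ^ ∣ Y ∣)
    (≤-total (card (𝓐 ⟨ Y ⟩) ^ ∣ X ∣ * a ^ ∣ Y ∣) (a ^ ∣ X ∣ * card (𝓐 ⟨ X ⟩) ^ ∣ Y ∣))
    where
    flip : ∀ u v w z → u * v ≤ w * z ⊎ w * z ≤ u * v → u * v ≤ w * z ⊎ z * w ≤ v * u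
    flip u v w z (inj₁ le) = inj₁ le
    flip u v w z (inj₂ le) = inj₂ (subst₂ _≤_ (*-comm w z) (*-comm u v) le)
  link-≤ : ∀ Y → card (𝓐 ⟨ Y ⟩) ≤ a
  link-≤ Y = ≤-trans (≤-reflexive (card-link 𝓐 Y))
    (≤-trans (∑-mono (members 𝓐) (λ S → 𝟙≤1 _)) (≤-reflexive (sym (length≡∑1 (members 𝓐)))))
  finish : (∃ λ X → Candidate X × All (X ≲_) (F ∷ candidates)) →
    ∃ λ X → 1 ≤ ∣ X ∣ × 1 ≤ card (𝓐 ⟨ X ⟩) × RootSpread ∣ X ∣ a (card (𝓐 ⟨ X ⟩)) 𝓐
  finish (X , (1≤d , 1≤b) , best) = X , 1≤d , 1≤b , λ Y → check Y ∣ Y ∣ refl (card (𝓐 ⟨ Y ⟩)) refl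
    where
    b = card (𝓐 ⟨ X ⟩)
    check : ∀ Y t → ∣ Y ∣ ≡ t → ∀ c → card (𝓐 ⟨ Y ⟩) ≡ c → c ^ ∣ X ∣ * a ^ t ≤ a ^ ∣ X ∣ * b ^ t
    -- The minimum was taken over nonempty sets with nonempty links. The other sets are immediate:
    -- for the empty set a link has at most |𝓐| members, and for an empty link the left side is 0.
    check Y zero    _  c refl = *-monoˡ-≤ 1 (^-monoˡ-≤ ∣ X ∣ (link-≤ Y))
    check Y (suc t) _  zero _ = ≤-trans (≤-reflexive (cong (_* a ^ suc t) (0^d≡0 ∣ X ∣ {{>-nonZero 1≤d}}))) z≤n
    check Y (suc t) et (suc c) ec = subst₂ (λ t c → c ^ ∣ X ∣ * a ^ t ≤ a ^ ∣ X ∣ * b ^ t) et ec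
      (All.lookup best (there (∈-filter⁺ candidate? (∈-allSubsets Y)
        (subst (1 ≤_) (sym et) (s≤s z≤n) , subst (1 ≤_) (sym ec) (s≤s z≤n)))))

-- Comparison of the extremal parameter with the given one, and the conclusion

dyadic : ∀ k → 1 ≤ k → ∃ λ L → 2 ^ L ≤ 2 * k × k < 2 ^ L × 1 ≤ L
-- The value is ⌊log₂ k⌋ + 1 = ⌊log₂ 2k⌋: the lower estimate compares it with the real logarithm in
-- the threshold, and the upper one makes it enough halvings for sets of size at most `k`.
dyadic k 1≤k = let L , lo , hi = go k 1≤k in suc L , *-monoʳ-≤ 2 lo , hi , s≤s z≤n
  where
  go : ∀ k → 1 ≤ k → ∃ λ L → 2 ^ L ≤ k × k < 2 ^ suc L
  go (suc zero)    _ = 0 , s≤s z≤n , s≤s (s≤s z≤n)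
  go (suc (suc k)) _ with L , lo , hi ← go (suc k) (s≤s z≤n) with suc (suc k) <? 2 ^ suc L
  ... | yes lt = L , m≤n⇒m≤1+n lo , lt
  ... | no ¬lt = suc L , ≮⇒≥ ¬lt , ≤-trans (s≤s hi) (+-mono-≤ (m^n>0 2 (suc L)) (≤-reflexive (sym (+-identityʳ (2 ^ suc L)))))

scale-≤ : ∀ {a b d N P Q} → 1 ≤ Q → N * Q < P → b * P ^ d ≤ a * Q ^ d → b * N ^ d ≤ a
scale-≤ {a} {b} {d} {N} {P} {Q} 1≤Q NQ<P le = *-cancelʳ-≤ _ _ (Q ^ d) {{m^n≢0 Q d {{>-nonZero 1≤Q}}}} (begin
  b * N ^ d * Q ^ d    ≡⟨ *-assoc b (N ^ d) (Q ^ d) ⟩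
  b * (N ^ d * Q ^ d)  ≡⟨ cong (b *_) (^-distribʳ-* N Q d) ⟨
  b * (N * Q) ^ d      ≤⟨ *-monoʳ-≤ b (^-monoˡ-≤ d (<⇒≤ NQ<P)) ⟩
  b * P ^ d            ≤⟨ le ⟩
  a * Q ^ d ∎)
  where open ≤-Reasoning

-- This passes from r*/2 to r/2: a rational P/Q below `r` is at most r* = (a/b)^(1/d), so an
-- r*/2-spread link is also P/(2Q)-spread.
root-half-≤ : ∀ {c e a b P Q} d j .{{_ : NonZero d}} .{{_ : NonZero b}} →
  c ^ d * a ^ j ≤ e ^ d * (2 ^ d * b) ^ j → b * P ^ d ≤ a * Q ^ d → c * P ^ j ≤ e * 2 ^ j * Q ^ j
root-half-≤ {c} {e} {a} {b} {P} {Q} d j spread le = root-≤ {a = a * Q ^ d} {b} d j (begin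
  c ^ d * (a * Q ^ d) ^ j                       ≡⟨ cong (c ^ d *_) (^-distribʳ-* a (Q ^ d) j) ⟩
  c ^ d * (a ^ j * (Q ^ d) ^ j)                 ≡⟨ *-assoc (c ^ d) (a ^ j) _ ⟨
  c ^ d * a ^ j * (Q ^ d) ^ j                   ≤⟨ *-monoˡ-≤ ((Q ^ d) ^ j) spread ⟩
  e ^ d * (2 ^ d * b) ^ j * (Q ^ d) ^ j         ≡⟨ cong₂ (λ x y → e ^ d * x * y) (^-distribʳ-* (2 ^ d) b j) (^-comm Q d j) ⟩
  e ^ d * ((2 ^ d) ^ j * b ^ j) * (Q ^ j) ^ d   ≡⟨ cong (λ x → e ^ d * (x * b ^ j) * (Q ^ j) ^ d) (^-comm 2 d j) ⟩
  e ^ d * ((2 ^ j) ^ d * b ^ j) * (Q ^ j) ^ d   ≡⟨ lemma (e ^ d) ((2 ^ j) ^ d) (b ^ j) ((Q ^ j) ^ d) ⟩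
  e ^ d * (2 ^ j) ^ d * (Q ^ j) ^ d * b ^ j     ≡⟨ cong (λ x → x * (Q ^ j) ^ d * b ^ j) (^-distribʳ-* e (2 ^ j) d) ⟨
  (e * 2 ^ j) ^ d * (Q ^ j) ^ d * b ^ j         ≡⟨ cong (_* b ^ j) (^-distribʳ-* (e * 2 ^ j) (Q ^ j) d) ⟨
  (e * 2 ^ j * Q ^ j) ^ d * b ^ j ∎) le
  where
  open ≤-Reasoning
  lemma : ∀ w x y z → w * (x * y) * z ≡ w * x * z * y
  lemma = solve-∀

double-≤ : ∀ {a b} d N → b * (2 * N) ^ d ≤ a → 2 ^ d * b * N ^ d ≤ a
double-≤ {a} {b} d N le = ≤-trans (≤-reflexive (trans (lemma (2 ^ d) b (N ^ d)) (cong (b *_) (sym (^-distribʳ-* 2 N d))))) le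
  where
  lemma : ∀ x y z → x * y * z ≡ y * (x * z)
  lemma = solve-∀

theorem16 : (n k s q : ℕ) → 1 ≤ n → 1 ≤ k → 1 ≤ s → 1 ≤ q →
    (𝓐 𝓕 : Family n) → Uniform k 𝓐 → 𝓕 ⊆ᶠ 𝓐 →
    (r : ℝ) →
    fromℕ (4 * (s ∸ 1) * q) ⊔ᶜ fromℕ (2 ^ 9 * s) *ᶜ log₂ (2 * k) <ᶜ cut r →
    IsSpread (cut r) 𝓐 →
    ν 𝓕 < s →
    ∃ λ (𝓢 : Family n) → ∃ λ (𝓕′ : Family n) →
    AtMost q 𝓢 ×
    ν 𝓢 < s ×
    𝓕′ ⊆ᶠ 𝓕 ×
    (𝓕 ∖ᶠ 𝓕′) ⊆ᶠ (𝓐 [[ 𝓢 ]]) ×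
    (∀ B → B ∈ᶠ 𝓢 → ∃ λ (𝓕B : Family n) →
    𝓕B ⊆ᶠ 𝓕 × NonemptyFamily (𝓕B ⟨ B ⟩) × IsSpread (half (cut r)) (𝓕B ⟨ B ⟩)) ×
    2 ^ (q + 1) * card 𝓕′ ≤ card 𝓐
theorem16 n k s q 1≤n 1≤k 1≤s 1≤q 𝓐 𝓕 uniform 𝓕⊆𝓐 r (p , p-upper , p-lower) spread ν𝓕<s = by-card (1 ≤? card 𝓐)
  where
  Goal : Set
  Goal = ∃ λ (𝓢 : Family n) → ∃ λ (𝓕′ : Family n) → AtMost q 𝓢 × ν 𝓢 < s × 𝓕′ ⊆ᶠ 𝓕 ×
    (𝓕 ∖ᶠ 𝓕′) ⊆ᶠ (𝓐 [[ 𝓢 ]]) ×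
    (∀ B → B ∈ᶠ 𝓢 → ∃ λ (𝓕B : Family n) →
      𝓕B ⊆ᶠ 𝓕 × NonemptyFamily (𝓕B ⟨ B ⟩) × IsSpread (half (cut r)) (𝓕B ⟨ B ⟩)) ×
    2 ^ (q + 1) * card 𝓕′ ≤ card 𝓐

  at-tightest : (∃ λ X → 1 ≤ ∣ X ∣ × 1 ≤ card (𝓐 ⟨ X ⟩) × RootSpread ∣ X ∣ (card 𝓐) (card (𝓐 ⟨ X ⟩)) 𝓐) → 1 ≤ card 𝓐 → Goal
  at-tightest (X , 1≤d , 1≤b , rootSpread) 1≤a =
    𝓢 , 𝓕′ , small , ν𝓢<s , subfam , covered , spread-witness , few
    where
    a = card 𝓐
    b = card (𝓐 ⟨ X ⟩)
    d = ∣ X ∣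
    instance
      d≢0 : NonZero d
      d≢0 = >-nonZero 1≤d
      a≢0 : NonZero a
      a≢0 = >-nonZero 1≤a
      b≢0 : NonZero b
      b≢0 = >-nonZero 1≤b
      2^d*b≢0 : NonZero (2 ^ d * b)
      2^d*b≢0 = m*n≢0 (2 ^ d) b {{m^n≢0 2 d}}

    module Ap = Approximation {n} {d} {a} {b} q 𝓐 𝓕 𝓕⊆𝓐 rootSpread
    open Ap.Approximates (Ap.approximate (card 𝓕) 𝓕 (λ _ F∈ → F∈) ≤-refl)

    L-spec = dyadic k 1≤k
    L = proj₁ L-spec
    large = threshold {4 * (s ∸ 1) * q} {2 ^ 9 * s} {2 * k} {L} {p} (proj₁ (proj₂ L-spec)) p-upper
    0<p : 0ℚ ℚ.< p
    0<p = ℚ.≤-<-trans (0≤ι (4 * (s ∸ 1) * q)) (proj₁ large)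

    -- Since `X` attains the extremal value, r*^d = a/b, spreadness of `𝓐` at this single set shows
    -- that no positive rational below `r` exceeds r*.
    lower-≤ : ∀ {u P Q} → lower (cut r) u → 0ℚ ℚ.< u → 1 ≤ Q → u ℚ.* ι Q ≡ ι P → b * P ^ d ≤ a * Q ^ d
    lower-≤ {u} {P} {Q} u∈ 0<u 1≤Q eq = clear-≤ {u} {P} {Q} 1≤Q eq b a d (≤ᶜ⇒≤ r {u} {b} {a} {d} u∈ 0<u (spread X))

    root-bound : ∀ N → ι N ℚ.< p → b * N ^ d ≤ a
    root-bound N N<p =
      let P , Q , _ , 1≤Q , eq = fraction p 0<p
      in scale-≤ {a} {b} {d} {N} {P} {Q} 1≤Q (clear-< 1≤Q eq N N<p) (lower-≤ p-lower 0<p 1≤Q eq)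

    ν𝓢<s : ν 𝓢 < s
    ν𝓢<s = ν-approximation {n} {k} {s} {q} {L} {d} {a} {2 ^ d * b} 1≤k 1≤s
      (proj₂ (proj₂ (proj₂ L-spec))) (proj₁ (proj₂ (proj₂ L-spec))) 𝓕 (λ F F∈ → uniform F (𝓕⊆𝓐 F F∈))
      (double-≤ d (2 * ((s ∸ 1) * q)) (subst (λ N → b * N ^ d ≤ a) (l₁ (s ∸ 1) q) (root-bound (4 * (s ∸ 1) * q) (proj₁ large))))
      (double-≤ d (128 * (2 * s * L)) (subst (λ N → b * N ^ d ≤ a) (l₂ s L) (root-bound (2 ^ 9 * s * L) (proj₂ large))))
      ν𝓕<s 𝓢 small witness
      where
      l₁ : ∀ t q → 4 * t * q ≡ 2 * (2 * (t * q))
      l₁ = solve-∀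
      l₂ : ∀ s L → 512 * s * L ≡ 2 * (128 * (2 * s * L))
      l₂ = solve-∀

    spread-witness : ∀ B → B ∈ᶠ 𝓢 → ∃ λ (𝓕B : Family n) →
      𝓕B ⊆ᶠ 𝓕 × NonemptyFamily (𝓕B ⟨ B ⟩) × IsSpread (half (cut r)) (𝓕B ⟨ B ⟩)
    spread-witness B B∈ =
      let 𝓕B , sub , ne , rs = witness B B∈
      in 𝓕B , sub , ne , λ Y → ≤⇒≤ᶜ-half r p-lower 0<p (card ((𝓕B ⟨ B ⟩) ⟨ Y ⟩)) (card (𝓕B ⟨ B ⟩)) ∣ Y ∣
        λ {u} u∈ 0<u →
          let P , Q , _ , 1≤Q , eq = fraction u 0<u
          in unclear-≤ 1≤Q eq (card ((𝓕B ⟨ B ⟩) ⟨ Y ⟩)) (card (𝓕B ⟨ B ⟩) * 2 ^ ∣ Y ∣) ∣ Y ∣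
               (root-half-≤ {a = a} {b} {P} {Q} d ∣ Y ∣ (rs Y) (lower-≤ u∈ 0<u 1≤Q eq))

  by-card : Dec (1 ≤ card 𝓐) → Goal
  by-card (yes 1≤a) = at-tightest (tightest-link 1≤k 𝓐 uniform (card-nonempty⁻ {𝓖 = 𝓐} 1≤a)) 1≤a
  -- For empty `𝓐` there is no tightest set. All families are empty, and taking `𝓕` itself as the
  -- approximating family makes the bound on its matching number the given one.
  by-card (no 𝓐-empty) =
    𝓕 , 𝓕 , (λ F F∈ → empty F∈) , ν𝓕<s , (λ _ F∈ → F∈) , (λ F F∈ → empty (proj₁ (T-∧⁻ {𝓕 F} F∈))) , (λ B B∈ → empty B∈)
    , ≤-trans (≤-reflexive (trans (cong (2 ^ (q + 1) *_) card𝓕≡0) (*-zeroʳ (2 ^ (q + 1))))) z≤n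
    where
    empty : ∀ {ℓ} {W : Set ℓ} {F} → F ∈ᶠ 𝓕 → W
    empty {F = F} F∈ = ⊥-elim (𝓐-empty (card-nonempty⁺ {𝓖 = 𝓐} (𝓕⊆𝓐 F F∈)))
    card𝓕≡0 : card 𝓕 ≡ 0
    card𝓕≡0 = n<1⇒n≡0 (≰⇒> λ le → empty {W = Void} (proj₂ (card-nonempty⁻ {𝓖 = 𝓕} le)))
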